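{- Let $K$ be a complex cubic number field, $n \in \mathbb{Z}$, and $\varepsilon, \delta \in \mathcal{O}_K^\times$ with $\varepsilon + \delta = n$. Then exactly one of the following three cases holds: (1) either $n = 0$, or $(\varepsilon,\delta) = (1,1)$, or $(\varepsilon,\delta) = (-1,-1)$; (2) $K = L_a$ for some nonzero integer $a \geq -1$, $n = \pm a$, and either $(\varepsilon,\delta) = (\pm\sigma(\omega_a), \pm\sigma(-\omega_a + a))$ or $(\varepsilon,\delta) = (\pm\sigma(-\omega_a+a), \pm\sigma(\omega_a))$ for some $\sigma \in \mathrm{Gal}(K/\mathbb{Q})$; (3) $K$ is one of $L_{ -1}$, $L_1$, or $\mathbb{Q}[x]/(x^3-x^2-x-1)$, and $(\varepsilon,\delta)$ is equivalent to one of the following $14$ sporadic solutions (listed as $(\varepsilon,\delta; n)$, with $\omega$ a root of the indicated polynomial): In $L_{ -1}$, $\omega$ a root of $x^3+x^2-1$: $(\omega, -\omega+1; 1)$, $(\omega^2, -\omega^2+1; 1)$, $(\omega^2+\omega, -\omega^2-\omega+1; 1)$, $(-\omega^2-\omega, \omega^2+\omega+1; 1)$, $(\omega^2+2\omega+2, -\omega^2-2\omega-1; 1)$, $(\omega+1, -\omega+1; 2)$, $(\omega^2+\omega+1, -\omega^2-\omega+1; 2)$, $(\omega^2+2\omega+1, -\omega^2-2\omega+2; 3)$, $(\omega^2+2\omega+2, -\omega^2-2\omega+2; 4)$. In $L_1$, $\omega$ a root of $x^3-x^2-1$: $(-\omega^2, \omega^2+1; 1)$, $(\omega^2-\omega,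 -\omega^2+\omega+1; 1)$, $(\omega^2, -\omega^2+2; 2)$, $(\omega^2+1, -\omega^2+2; 3)$. In $\mathbb{Q}[x]/(x^3-x^2-x-1)$, $\omega$ a root of $x^3-x^2-x-1$: $(\omega, -\omega+2; 2)$.
   Context: A cubic field is complex if it has signature $(1,1)$, equivalently negative discriminant. For a nonzero integer $a \geq -1$, $\omega_a$ denotes a root of $g_a(x) = x^3 - ax^2 - 1$ and $L_a = \mathbb{Q}(\omega_a)$; field equalities are up to isomorphism. Two solutions $(\varepsilon_1,\delta_1)$, $(\varepsilon_2,\delta_2)$ of $\varepsilon+\delta=n$ are called equivalent if $(\varepsilon_1,\delta_1) = (\pm\sigma(\varepsilon_2), \pm\sigma(\delta_2))$ or $(\varepsilon_1,\delta_1) = (\pm\sigma(\delta_2), \pm\sigma(\varepsilon_2))$ for some $\sigma \in \mathrm{Gal}(K/\mathbb{Q})$. -}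

module Defs where

open import Data.Integer.Base as ℤ using (ℤ; +_; -[1+_])
open import Data.Rational.Base as ℚ using (ℚ; 0ℚ; 1ℚ; _+_; _*_; _-_; -_; _<_)
open import Data.Product using (Σ; ∃; ∃-syntax; _×_; _,_)
open import Data.Sum using (_⊎_)
open import Data.List.Base using (List; []; _∷_)
open import Data.List.Membership.Propositional using (_∈_)
open import Relation.Binary.PropositionalEquality using (_≡_; _≢_)
open import Relation.Nullary using (¬_)
open import Function.Definitions using (Injective; Surjective)

-- A cubic algebra ℚ[x]/(f) for a monic cubic f = x³ + c₂x² + c₁x + c₀.
-- Elements a₀ + a₁θ + a₂θ² (θ the class of x) are triples over ℚ.

record Cubic : Set where
  constructor cubic
  field
    c₀ c₁ c₂ : ℚ

Elt : Set
Elt = ℚ × ℚ × ℚ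

fromℚ : ℚ → Elt
fromℚ q = q , 0ℚ , 0ℚ

fromℤ : ℤ → Elt
fromℤ z = fromℚ (z ℚ./ 1)

zero one θ : Elt
zero = fromℚ 0ℚ
one  = fromℚ 1ℚ
θ    = 0ℚ , 1ℚ , 0ℚ

add : Elt → Elt → Elt
add (a₀ , a₁ , a₂) (b₀ , b₁ , b₂) = a₀ + b₀ , a₁ + b₁ , a₂ + b₂

neg : Elt → Elt
neg (a₀ , a₁ , a₂) = - a₀ , - a₁ , - a₂

-- multiplication in ℚ[x]/(f), using θ³ = -c₂θ² - c₁θ - c₀
-- and θ⁴ = (c₂² - c₁)θ² + (c₂c₁ - c₀)θ + c₂c₀
mul : Cubic → Elt → Elt → Elt
mul (cubic c₀ c₁ c₂) (a₀ , a₁ , a₂) (b₀ , b₁ , b₂) =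
  (p₀ - c₀ * p₃ + c₂ * c₀ * p₄) ,
  (p₁ - c₁ * p₃ + (c₂ * c₁ - c₀) * p₄) ,
  (p₂ - c₂ * p₃ + (c₂ * c₂ - c₁) * p₄)
  where
  p₀ = a₀ * b₀
  p₁ = a₀ * b₁ + a₁ * b₀
  p₂ = a₀ * b₂ + a₁ * b₁ + a₂ * b₀
  p₃ = a₁ * b₂ + a₂ * b₁
  p₄ = a₂ * b₂

-- K is a field (every nonzero element invertible); for K = ℚ[x]/(f)
-- this says that f is irreducible, i.e. K is a cubic number field.
IsField : Cubic → Set
IsField K = ∀ x → x ≢ zero → ∃[ y ] mul K x y ≡ one

disc : Cubic → ℚ
disc (cubic d c b) =
  b * b * c * c - (4ℚ * c * c * c) - (4ℚ * b * b * b * d)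
    - (27ℚ * d * d) + 18ℚ * b * c * d
  where
  4ℚ 27ℚ 18ℚ : ℚ
  4ℚ  = + 4 ℚ./ 1
  27ℚ = + 27 ℚ./ 1
  18ℚ = + 18 ℚ./ 1

IsComplexCubicField : Cubic → Set
IsComplexCubicField K = IsField K × disc K < 0ℚ

-- evalMonic K [c₀ , … , c_{m-1}] α = α^m + c_{m-1}α^{m-1} + … + c₀
evalMonic : Cubic → List ℤ → Elt → Elt
evalMonic K []       α = one
evalMonic K (c ∷ cs) α = add (fromℤ c) (mul K α (evalMonic K cs α))

IsAlgInt : Cubic → Elt → Set
IsAlgInt K α = ∃[ cs ] evalMonic K cs α ≡ zero

IsUnit : Cubic → Elt → Set
IsUnit K α = IsAlgInt K α × ∃[ β ] (IsAlgInt K β × mul K α β ≡ one)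

record RingHom (L K : Cubic) : Set where
  field
    map     : Elt → Elt
    map-one : map one ≡ one
    map-add : ∀ x y → map (add x y) ≡ add (map x) (map y)
    map-mul : ∀ x y → map (mul L x y) ≡ mul K (map x) (map y)

record RingIso (L K : Cubic) : Set where
  field
    hom  : RingHom L K
    inj  : Injective _≡_ _≡_ (RingHom.map hom)
    surj : Surjective _≡_ _≡_ (RingHom.map hom)
  open RingHom hom public

-- Gal(K/ℚ) = field automorphisms of K (these automatically fix ℚ)
Gal : Cubic → Set
Gal K = RingIso K K

L : ℤ → Cubic
L a = cubic (- 1ℚ) 0ℚ (- (a ℚ./ 1))

M : Cubic
M = cubic (- 1ℚ) (- 1ℚ) (- 1ℚ)

_≡±_ : Elt → Elt → Set
y ≡± x = (y ≡ x) ⊎ (y ≡ neg x)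

Equivalent : Cubic → Elt × Elt → Elt × Elt → Set
Equivalent K (ε₁ , δ₁) (ε₂ , δ₂) =
  ∃[ σ ] let s = RingIso.map {K} {K} σ in
    ((ε₁ ≡± s ε₂) × (δ₁ ≡± s δ₂)) ⊎ ((ε₁ ≡± s δ₂) × (δ₁ ≡± s ε₂))

e : ℤ → ℤ → ℤ → Elt
e a₀ a₁ a₂ = (a₀ ℚ./ 1) , (a₁ ℚ./ 1) , (a₂ ℚ./ 1)

i0 i1 i2 i3 i4 j1 j2 : ℤ
i0 = + 0
i1 = + 1
i2 = + 2
i3 = + 3
i4 = + 4
j1 = ℤ.- (+ 1)
j2 = ℤ.- (+ 2)

sporadicLm1 : List (Elt × Elt × ℤ)
sporadicLm1 =
  (e i0 i1 i0 , e i1 j1 i0 , i1) ∷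
  (e i0 i0 i1 , e i1 i0 j1 , i1) ∷
  (e i0 i1 i1 , e i1 j1 j1 , i1) ∷
  (e i0 j1 j1 , e i1 i1 i1 , i1) ∷
  (e i2 i2 i1 , e j1 j2 j1 , i1) ∷
  (e i1 i1 i0 , e i1 j1 i0 , i2) ∷
  (e i1 i1 i1 , e i1 j1 j1 , i2) ∷
  (e i1 i2 i1 , e i2 j2 j1 , i3) ∷
  (e i2 i2 i1 , e i2 j2 j1 , i4) ∷
  []

sporadicL1 : List (Elt × Elt × ℤ)
sporadicL1 =
  (e i0 i0 j1 , e i1 i0 i1 , i1) ∷
  (e i0 j1 i1 , e i1 i1 j1 , i1) ∷
  (e i0 i0 i1 , e i2 i0 j1 , i2) ∷
  (e i1 i0 i1 , e i2 i0 j1 , i3) ∷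
  []

sporadicM : List (Elt × Elt × ℤ)
sporadicM =
  (e i0 i1 i0 , e i2 j1 i0 , i2) ∷
  []

Case1 : ℤ → Elt → Elt → Set
Case1 n ε δ = (n ≡ i0) ⊎ ((ε ≡ one × δ ≡ one) ⊎ (ε ≡ neg one × δ ≡ neg one))

-- K ≅ L_a via φ : L_a → K; ω_a ∈ K is φ(ω_a); a nonzero, a ≥ −1
Case2 : Cubic → ℤ → Elt → Elt → Set
Case2 K n ε δ =
  ∃[ a ] (a ≢ i0 × j1 ℤ.≤ a × ∃[ φ ] (
    let ω  = RingIso.map {L a} {K} φ θ
        ω' = RingIso.map {L a} {K} φ (add (neg θ) (fromℤ a)) in
    ((n ≡ a) ⊎ (n ≡ ℤ.- a)) ×
    Equivalent K (ε , δ) (ω , ω')))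

SporadicIn : Cubic → List (Elt × Elt × ℤ) → Cubic → Elt → Elt → Set
SporadicIn F sols K ε δ =
  ∃[ φ ] ∃[ ε₀ ] ∃[ δ₀ ] ∃[ m ] ((ε₀ , δ₀ , m) ∈ sols ×
    Equivalent K (ε , δ) (RingIso.map {F} {K} φ ε₀ , RingIso.map {F} {K} φ δ₀))

Case3 : Cubic → Elt → Elt → Set
Case3 K ε δ =
  SporadicIn (L j1) sporadicLm1 K ε δ ⊎
  (SporadicIn (L i1) sporadicL1 K ε δ ⊎ SporadicIn M sporadicM K ε δ)

ExactlyOne : Set → Set → Set → Set
ExactlyOne P Q R =
  (P × ¬ Q × ¬ R) ⊎ ((¬ P × Q × ¬ R) ⊎ (¬ P × ¬ Q × R))

{-# OPTIONS --safe #-}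
-- An irrational unit ε generates K, and by Gauss's lemma its characteristic polynomial f has
-- integer coefficients.  Since ε and δ = n − ε are units, f(0) and f(n) are ±1; changing signs,
-- assume f(0) = −1.  If f(n) = −1, then f = X(X − n)(X − m) − 1 for an integer m, and m = 0 or
-- m = n gives case (2).  Otherwise disc f ≥ 0 as soon as the integers 0, n, m are not very close
-- to each other.  If f(n) = 1, then n divides 2 and the remaining coefficient is bounded in the
-- same way.  As disc f is disc K times a square, it is negative, which leaves 28 pairs (f , n);
-- these are the two orders of each of the 14 sporadic solutions.  The cases exclude each other
-- because a root of f = X³ + c₂X² + c₁X + c₀ that comes from case (2) has c₁ = 0 and c₂ = −n,
-- and none of the sporadic units does.
module Submission where

open import Defs
open import Algebra.Bundles using (CommutativeRing)
open import Algebra.Solver.Ring.AlmostCommutativeRing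
  using (fromCommutativeRing; _-Raw-AlmostCommutative⟶_; -raw-almostCommutative⟶)
import Algebra.Solver.Ring
open import Data.Bool.Base using (Bool; T)
open import Data.Empty using (⊥-elim)
open import Data.Integer.Base as ℤ using (ℤ; +_; -[1+_])
open import Data.Integer.Divisibility.Signed as ℤ∣
  using (divides; _∣?_; ∣ᵤ⇒∣; ∣⇒∣ᵤ) renaming (_∣_ to _∣ℤ_)
import Data.Integer.Properties as ℤ
open import Data.List.Base using (List; []; _∷_; length; reverse; foldl; foldr)
import Data.List.Membership.DecPropositional as DecMembership
open import Data.List.Membership.Propositional using (_∈_)
open import Data.List.Properties using (reverse-foldl)
open import Data.List.Relation.Unary.All as All using (All; []; _∷_)
open import Data.List.Relation.Unary.Any using (here; there)
open import Data.Maybe.Base as Maybe using (just; is-just)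
open import Data.Nat.Base as ℕ using (ℕ; suc; _<_; s≤s; z≤n)
import Data.Nat.Divisibility as ℕ∣
open import Data.Nat.Induction using (Acc; acc; <-wellFounded)
open import Data.Nat.ListAction using (product)
open import Data.Nat.Primality using (Prime; euclidsLemma; prime⇒nonZero; prime⇒nonTrivial)
open import Data.Nat.Primality.Factorisation using (factorise)
import Data.Nat.Properties as ℕ
open import Data.Product using (Σ; ∃-syntax; _×_; _,_; proj₁; proj₂)
open import Data.Product.Properties using (≡-dec)
open import Data.Rational.Base as ℚ using (ℚ; 0ℚ; 1ℚ; _+_; _*_; _-_; -_; ↥_; ↧_; ↧ₙ_)
import Data.Rational.Properties as ℚ
import Data.Rational.Unnormalised.Base as ℚᵘ
import Data.Rational.Unnormalised.Properties as ℚᵘ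
open import Data.Sum.Base as Sum using (_⊎_; inj₁; inj₂)
open import Data.Vec.Base as Vec using (Vec; []; _∷_)
open import Data.Vec.N-ary using (N-ary; _$ⁿ_)
open import Level using (0ℓ)
open import Relation.Binary.Definitions using (WeaklyDecidable; tri<; tri≈; tri>)
open import Relation.Binary.PropositionalEquality
open import Relation.Nullary using (¬_; Dec; yes; no)
open import Relation.Nullary.Decidable
  using (True; toWitness; False; toWitnessFalse; dec⇒maybe; from-yes; _×-dec_; ¬?)

-- Polynomial identities

-- The quantity that links elements to coordinates is `Δ K x`, the determinant of 1, x, x² in the
-- basis 1, θ, θ². When it is nonzero, substituting x for θ is an isomorphism from ℚ[X]/(char K x)
-- to K, and `char K x` is the only monic cubic that vanishes at x; this takes the place of
-- irreducibility and minimal polynomials. Integrality provides an equation of arbitrary degree. Its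
-- divisibility by `char K x` is recorded as a sequence of quotient coefficients that is eventually
-- zero, which turns Gauss's lemma into a statement on linear recurrences. The discriminant bounds
-- work because X(X - n)(X - m) has the square discriminant (nm(n - m))², of degree 6 in n and m,
-- while subtracting 1 adds only terms of degree at most 3. The 28 pairs are three for each of the
-- six orders of 0, n, m, six with n = 1 and f(1) = 1, and four with n = 2 and f(2) = 1; a negative
-- n with f(n) = 1 gives none.

infixl 9 _/1
_/1 : ℤ → ℚ
z /1 = z ℚ./ 1

/1-+ : ∀ a b → (a ℤ.+ b) /1 ≡ a /1 + b /1
/1-+ a b = ℚ.toℚᵘ-injective (begin
  ℚ.toℚᵘ ((a ℤ.+ b) /1)                ≈⟨ ℚ.toℚᵘ-fromℚᵘ (ℚᵘ.mkℚᵘ (a ℤ.+ b) 0) ⟩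
  ℚᵘ.mkℚᵘ (a ℤ.+ b) 0                  ≈⟨ ℚᵘ.*≡* (cong (ℤ._* + 1) (sym (cong₂ ℤ._+_ (ℤ.*-identityʳ a) (ℤ.*-identityʳ b)))) ⟩
  ℚᵘ.mkℚᵘ a 0 ℚᵘ.+ ℚᵘ.mkℚᵘ b 0         ≈⟨ ℚᵘ.+-cong (ℚ.toℚᵘ-fromℚᵘ (ℚᵘ.mkℚᵘ a 0)) (ℚ.toℚᵘ-fromℚᵘ (ℚᵘ.mkℚᵘ b 0)) ⟨
  ℚ.toℚᵘ (a /1) ℚᵘ.+ ℚ.toℚᵘ (b /1)     ≈⟨ ℚ.toℚᵘ-homo-+ (a /1) (b /1) ⟨
  ℚ.toℚᵘ (a /1 + b /1)                 ∎)
  where open ℚᵘ.≃-Reasoning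

/1-* : ∀ a b → (a ℤ.* b) /1 ≡ a /1 * b /1
/1-* a b = ℚ.toℚᵘ-injective (begin
  ℚ.toℚᵘ ((a ℤ.* b) /1)                ≈⟨ ℚ.toℚᵘ-fromℚᵘ (ℚᵘ.mkℚᵘ (a ℤ.* b) 0) ⟩
  ℚᵘ.mkℚᵘ a 0 ℚᵘ.* ℚᵘ.mkℚᵘ b 0         ≈⟨ ℚᵘ.*-cong (ℚ.toℚᵘ-fromℚᵘ (ℚᵘ.mkℚᵘ a 0)) (ℚ.toℚᵘ-fromℚᵘ (ℚᵘ.mkℚᵘ b 0)) ⟨
  ℚ.toℚᵘ (a /1) ℚᵘ.* ℚ.toℚᵘ (b /1)     ≈⟨ ℚ.toℚᵘ-homo-* (a /1) (b /1) ⟨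
  ℚ.toℚᵘ (a /1 * b /1)                 ∎)
  where open ℚᵘ.≃-Reasoning

/1-neg : ∀ a → (ℤ.- a) /1 ≡ - (a /1)
/1-neg a = ℚ.toℚᵘ-injective (begin
  ℚ.toℚᵘ ((ℤ.- a) /1)      ≈⟨ ℚ.toℚᵘ-fromℚᵘ (ℚᵘ.mkℚᵘ (ℤ.- a) 0) ⟩
  ℚᵘ.- ℚᵘ.mkℚᵘ a 0         ≈⟨ ℚᵘ.-‿cong (ℚ.toℚᵘ-fromℚᵘ (ℚᵘ.mkℚᵘ a 0)) ⟨
  ℚᵘ.- ℚ.toℚᵘ (a /1)       ≈⟨ ℚ.toℚᵘ-homo‿- (a /1) ⟨
  ℚ.toℚᵘ (- (a /1))        ∎)
  where open ℚᵘ.≃-Reasoning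

/1-injective : ∀ a b → a /1 ≡ b /1 → a ≡ b
/1-injective a b eq with ℚ.fromℚᵘ-injective {ℚᵘ.mkℚᵘ a 0} {ℚᵘ.mkℚᵘ b 0} eq
... | ℚᵘ.*≡* h = trans (sym (ℤ.*-identityʳ a)) (trans h (ℤ.*-identityʳ b))

-- Ring solvers with integer coefficients

module IntegerSolver (R : CommutativeRing 0ℓ 0ℓ)
    (morphism : ℤ.+-*-rawRing -Raw-AlmostCommutative⟶ fromCommutativeRing R) where

  open CommutativeRing R using (_≈_; reflexive) renaming (trans to ≈-trans; sym to ≈-sym)
  open _-Raw-AlmostCommutative⟶_ morphism using () renaming (⟦_⟧ to embed)

  private
    coeff≟ : WeaklyDecidable (λ a b → embed a ≈ embed b)
    coeff≟ a b = Maybe.map (λ eq → reflexive (cong embed eq)) (dec⇒maybe (a ℤ.≟ b))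

  open Algebra.Solver.Ring ℤ.+-*-rawRing (fromCommutativeRing R) morphism coeff≟ public
    using (Polynomial; con; var; _:+_; _:*_; _:-_; :-_; ⟦_⟧)
  open Algebra.Solver.Ring ℤ.+-*-rawRing (fromCommutativeRing R) morphism coeff≟
    using (normalise; correct; _≟N_; ⟦_⟧N-cong)

  infix 4 _⊜_
  _⊜_ : ∀ {n} → Polynomial n → Polynomial n → Polynomial n × Polynomial n
  _⊜_ = _,_

  agree : ∀ {n} → Polynomial n → Polynomial n → Bool
  agree p q = is-just (normalise p ≟N normalise q)

  -- The hypothesis is a boolean about normal forms over ℤ, so checking an identity is a computation
  -- with integers; the normal forms are never compared after evaluation in `R`. A true boolean also
  -- lets the argument be inferred.
  prove : ∀ {n} ρ ((p , q) : Polynomial n × Polynomial n) {_ : T (agree p q)} → ⟦ p ⟧ ρ ≈ ⟦ q ⟧ ρ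
  prove ρ (p , q) with normalise p ≟N normalise q
  ... | just eq = ≈-trans (≈-sym (correct p ρ)) (≈-trans (⟦ eq ⟧N-cong ρ) (correct q ρ))

  private
    sides : ∀ {n} → N-ary n (Polynomial n) (Polynomial n × Polynomial n) → Polynomial n × Polynomial n
    sides {n} f = f $ⁿ Vec.map var (Vec.allFin n)

  identity : ∀ {n} ρ (f : N-ary n (Polynomial n) (Polynomial n × Polynomial n)) →
             let (p , q) = sides {n} f in
             {_ : T (agree p q)} → ⟦ p ⟧ ρ ≈ ⟦ q ⟧ ρ
  identity {n} ρ f {t} = prove ρ (sides {n} f) {t}

ℤ⟶ℚ : ℤ.+-*-rawRing -Raw-AlmostCommutative⟶ fromCommutativeRing ℚ.+-*-commutativeRing
ℤ⟶ℚ = record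
  { ⟦_⟧ = _/1 ; +-homo = /1-+ ; *-homo = /1-* ; -‿homo = /1-neg ; 0-homo = refl ; 1-homo = refl }

module ℚS = IntegerSolver ℚ.+-*-commutativeRing ℤ⟶ℚ

Poly : ℕ → Set
Poly = ℚS.Polynomial

Poly³ : ℕ → Set
Poly³ n = Poly n × Poly n × Poly n

module _ {n : ℕ} where
  open ℚS using (con; _:+_; _:*_; _:-_; :-_)
  infixl 6 _⊕_
  infixl 7 _⊗_
  _⊕_ _⊗_ _⊖_ : Poly n → Poly n → Poly n
  _⊕_ = _:+_
  _⊗_ = _:*_
  _⊖_ = _:-_
  infixl 6 _⊖_

  addP : Poly³ n → Poly³ n → Poly³ n
  addP (a₀ , a₁ , a₂) (b₀ , b₁ , b₂) = a₀ ⊕ b₀ , a₁ ⊕ b₁ , a₂ ⊕ b₂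

  -- This copy of `mul` and the other symbolic copies keep the bracketing of the originals, so that
  -- evaluating them yields the originals by computation and an identity of polynomials can be used
  -- as one of elements.
  mulP : Poly³ n → Poly³ n → Poly³ n → Poly³ n
  mulP (c₀ , c₁ , c₂) (a₀ , a₁ , a₂) (b₀ , b₁ , b₂) =
    (p₀ ⊖ c₀ ⊗ p₃ ⊕ c₂ ⊗ c₀ ⊗ p₄) ,
    (p₁ ⊖ c₁ ⊗ p₃ ⊕ (c₂ ⊗ c₁ ⊖ c₀) ⊗ p₄) ,
    (p₂ ⊖ c₂ ⊗ p₃ ⊕ (c₂ ⊗ c₂ ⊖ c₁) ⊗ p₄)
    where
    p₀ = a₀ ⊗ b₀
    p₁ = a₀ ⊗ b₁ ⊕ a₁ ⊗ b₀
    p₂ = a₀ ⊗ b₂ ⊕ a₁ ⊗ b₁ ⊕ a₂ ⊗ b₀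
    p₃ = a₁ ⊗ b₂ ⊕ a₂ ⊗ b₁
    p₄ = a₂ ⊗ b₂

  discP : Poly³ n → Poly n
  discP (d , c , b) =
    b ⊗ b ⊗ c ⊗ c ⊖ (con (+ 4) ⊗ c ⊗ c ⊗ c) ⊖ (con (+ 4) ⊗ b ⊗ b ⊗ b ⊗ d)
      ⊖ (con (+ 27) ⊗ d ⊗ d) ⊕ con (+ 18) ⊗ b ⊗ c ⊗ d


  fromP : Poly n → Poly³ n
  fromP p = p , con (+ 0) , con (+ 0)

  evalCubicP : Poly³ n → Poly³ n → Poly³ n → Poly³ n
  evalCubicP K (c₀ , c₁ , c₂) x =
    addP (mulP K x (addP (mulP K x (addP x (fromP c₂))) (fromP c₁))) (fromP c₀)

  ΔP : Poly³ n → Poly³ n → Poly n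
  ΔP K x@(_ , x₁ , x₂) = let (_ , y₁ , y₂) = mulP K x x in x₁ ⊗ y₂ ⊖ x₂ ⊗ y₁

  charP : Poly³ n → Poly³ n → Poly³ n
  charP (c₀ , c₁ , c₂) (x₀ , x₁ , x₂) =
    (:- (x₀ ⊗ (m₁₁ ⊗ m₂₂ ⊖ m₁₂ ⊗ m₂₁) ⊖ m₀₁ ⊗ (x₁ ⊗ m₂₂ ⊖ m₁₂ ⊗ x₂) ⊕ m₀₂ ⊗ (x₁ ⊗ m₂₁ ⊖ m₁₁ ⊗ x₂))) ,
    (x₀ ⊗ m₁₁ ⊖ m₀₁ ⊗ x₁) ⊕ (x₀ ⊗ m₂₂ ⊖ m₀₂ ⊗ x₂) ⊕ (m₁₁ ⊗ m₂₂ ⊖ m₁₂ ⊗ m₂₁) ,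
    (:- (x₀ ⊕ m₁₁ ⊕ m₂₂))
    where
    m₀₁ = :- (c₀ ⊗ x₂)
    m₁₁ = x₀ ⊖ c₁ ⊗ x₂
    m₂₁ = x₁ ⊖ c₂ ⊗ x₂
    m₀₂ = :- (c₀ ⊗ m₂₁)
    m₁₂ = m₀₁ ⊖ c₁ ⊗ m₂₁
    m₂₂ = m₁₁ ⊖ c₂ ⊗ m₂₁

⟦_⟧³ : ∀ {n} → Poly³ n → Vec ℚ n → Elt
⟦ p₀ , p₁ , p₂ ⟧³ ρ = ℚS.⟦ p₀ ⟧ ρ , ℚS.⟦ p₁ ⟧ ρ , ℚS.⟦ p₂ ⟧ ρ

identity³ : ∀ {n} ρ (f : N-ary n (Poly n) (Poly³ n × Poly³ n)) →
            let ((p₀ , p₁ , p₂) , (q₀ , q₁ , q₂)) = f $ⁿ Vec.map ℚS.var (Vec.allFin n) in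
            {_ : T (ℚS.agree p₀ q₀)} {_ : T (ℚS.agree p₁ q₁)} {_ : T (ℚS.agree p₂ q₂)} →
            ⟦ p₀ , p₁ , p₂ ⟧³ ρ ≡ ⟦ q₀ , q₁ , q₂ ⟧³ ρ
identity³ {n} ρ f {t₀} {t₁} {t₂} =
  let ((p₀ , p₁ , p₂) , (q₀ , q₁ , q₂)) = f $ⁿ Vec.map ℚS.var (Vec.allFin n) in
  cong₂ _,_ (ℚS.prove ρ (p₀ , q₀) {t₀}) (cong₂ _,_ (ℚS.prove ρ (p₁ , q₁) {t₁}) (ℚS.prove ρ (p₂ , q₂) {t₂}))

mul-assoc : ∀ K x y z → mul K (mul K x y) z ≡ mul K x (mul K y z)
mul-assoc (cubic c₀ c₁ c₂) (x₀ , x₁ , x₂) (y₀ , y₁ , y₂) (z₀ , z₁ , z₂) =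
  identity³ (c₀ ∷ c₁ ∷ c₂ ∷ x₀ ∷ x₁ ∷ x₂ ∷ y₀ ∷ y₁ ∷ y₂ ∷ z₀ ∷ z₁ ∷ z₂ ∷ [])
    λ c₀ c₁ c₂ x₀ x₁ x₂ y₀ y₁ y₂ z₀ z₁ z₂ →
      let K = c₀ , c₁ , c₂ ; x = x₀ , x₁ , x₂ ; y = y₀ , y₁ , y₂ ; z = z₀ , z₁ , z₂
      in mulP K (mulP K x y) z , mulP K x (mulP K y z)

evalCubic : Cubic → Cubic → Elt → Elt
evalCubic K (cubic c₀ c₁ c₂) x =
  add (mul K x (add (mul K x (add x (fromℚ c₂))) (fromℚ c₁))) (fromℚ c₀)

-- The determinant of 1, x, x² in the basis 1, θ, θ²: the index form of K.
Δ : Cubic → Elt → ℚ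
Δ K x@(_ , x₁ , x₂) = let (_ , y₁ , y₂) = mul K x x in x₁ * y₂ - x₂ * y₁

-- The characteristic polynomial of multiplication by x. Column j of the matrix holds the
-- coordinates of xθʲ, and the coefficients are -det, the sum of the principal 2 × 2 minors, and
-- -trace.
char : Cubic → Elt → Cubic
char (cubic c₀ c₁ c₂) (x₀ , x₁ , x₂) = cubic
    (- (x₀ * (m₁₁ * m₂₂ - m₁₂ * m₂₁) - m₀₁ * (x₁ * m₂₂ - m₁₂ * x₂) + m₀₂ * (x₁ * m₂₁ - m₁₁ * x₂)))
    ((x₀ * m₁₁ - m₀₁ * x₁) + (x₀ * m₂₂ - m₀₂ * x₂) + (m₁₁ * m₂₂ - m₁₂ * m₂₁))
    (- (x₀ + m₁₁ + m₂₂))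
    where
    m₀₁ = - (c₀ * x₂)
    m₁₁ = x₀ - c₁ * x₂
    m₂₁ = x₁ - c₂ * x₂
    m₀₂ = - (c₀ * m₂₁)
    m₁₂ = m₀₁ - c₁ * m₂₁
    m₂₂ = m₁₁ - c₂ * m₂₁

cayley-hamilton : ∀ K x → evalCubic K (char K x) x ≡ zero
cayley-hamilton (cubic c₀ c₁ c₂) (x₀ , x₁ , x₂) =
  identity³ (c₀ ∷ c₁ ∷ c₂ ∷ x₀ ∷ x₁ ∷ x₂ ∷ [])
    λ c₀ c₁ c₂ x₀ x₁ x₂ →
      let K = c₀ , c₁ , c₂ ; x = x₀ , x₁ , x₂ in evalCubicP K (charP K x) x , fromP (ℚS.con (+ 0))

-- Passing from the basis 1, θ, θ² to 1, x, x² multiplies the discriminant by the square of the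
-- determinant of the change of basis.
disc-char : ∀ K x → disc (char K x) ≡ Δ K x * Δ K x * disc K
disc-char (cubic c₀ c₁ c₂) (x₀ , x₁ , x₂) =
  ℚS.identity (c₀ ∷ c₁ ∷ c₂ ∷ x₀ ∷ x₁ ∷ x₂ ∷ [])
    λ c₀ c₁ c₂ x₀ x₁ x₂ →
      let K = c₀ , c₁ , c₂ ; x = x₀ , x₁ , x₂ in discP (charP K x) ℚS.⊜ ΔP K x ⊗ ΔP K x ⊗ discP K

triple : ∀ {x₀ x₁ x₂ y₀ y₁ y₂ : ℚ} → x₀ ≡ y₀ → x₁ ≡ y₁ → x₂ ≡ y₂ → (x₀ , x₁ , x₂) ≡ (y₀ , y₁ , y₂)
triple refl refl refl = refl

-- Cubic algebras

mul-comm : ∀ K x y → mul K x y ≡ mul K y x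
mul-comm (cubic c₀ c₁ c₂) (x₀ , x₁ , x₂) (y₀ , y₁ , y₂) =
  identity³ (c₀ ∷ c₁ ∷ c₂ ∷ x₀ ∷ x₁ ∷ x₂ ∷ y₀ ∷ y₁ ∷ y₂ ∷ []) λ c₀ c₁ c₂ x₀ x₁ x₂ y₀ y₁ y₂ →
    let K = c₀ , c₁ , c₂ ; x = x₀ , x₁ , x₂ ; y = y₀ , y₁ , y₂ in mulP K x y , mulP K y x

mul-distribˡ : ∀ K x y z → mul K x (add y z) ≡ add (mul K x y) (mul K x z)
mul-distribˡ (cubic c₀ c₁ c₂) (x₀ , x₁ , x₂) (y₀ , y₁ , y₂) (z₀ , z₁ , z₂) =
  identity³ (c₀ ∷ c₁ ∷ c₂ ∷ x₀ ∷ x₁ ∷ x₂ ∷ y₀ ∷ y₁ ∷ y₂ ∷ z₀ ∷ z₁ ∷ z₂ ∷ [])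
    λ c₀ c₁ c₂ x₀ x₁ x₂ y₀ y₁ y₂ z₀ z₁ z₂ →
      let K = c₀ , c₁ , c₂ ; x = x₀ , x₁ , x₂ ; y = y₀ , y₁ , y₂ ; z = z₀ , z₁ , z₂
      in mulP K x (addP y z) , addP (mulP K x y) (mulP K x z)

mul-identityˡ : ∀ K x → mul K one x ≡ x
mul-identityˡ (cubic c₀ c₁ c₂) (x₀ , x₁ , x₂) =
  identity³ (c₀ ∷ c₁ ∷ c₂ ∷ x₀ ∷ x₁ ∷ x₂ ∷ []) λ c₀ c₁ c₂ x₀ x₁ x₂ →
    mulP (c₀ , c₁ , c₂) (fromP (ℚS.con (+ 1))) (x₀ , x₁ , x₂) , (x₀ , x₁ , x₂)

fromℚ-* : ∀ K p q → fromℚ (p * q) ≡ mul K (fromℚ p) (fromℚ q)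
fromℚ-* (cubic c₀ c₁ c₂) p q = identity³ (c₀ ∷ c₁ ∷ c₂ ∷ p ∷ q ∷ []) λ c₀ c₁ c₂ p q →
  fromP (p ⊗ q) , mulP (c₀ , c₁ , c₂) (fromP p) (fromP q)

fromℤ-* : ∀ K a b → fromℤ (a ℤ.* b) ≡ mul K (fromℤ a) (fromℤ b)
fromℤ-* K a b = trans (cong fromℚ (/1-* a b)) (fromℚ-* K (a /1) (b /1))

elements : Cubic → CommutativeRing 0ℓ 0ℓ
elements K = record
  { Carrier = Elt ; _≈_ = _≡_ ; _+_ = add ; _*_ = mul K ; -_ = neg ; 0# = zero ; 1# = one
  ; isCommutativeRing = record
    { isRing = record
      { +-isAbelianGroup = record
        { isGroup = record
          { isMonoid = record
            { isSemigroup = record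
              { isMagma = record { isEquivalence = isEquivalence ; ∙-cong = cong₂ add }
              ; assoc = λ (x₀ , x₁ , x₂) (y₀ , y₁ , y₂) (z₀ , z₁ , z₂) →
                  triple (ℚ.+-assoc x₀ y₀ z₀) (ℚ.+-assoc x₁ y₁ z₁) (ℚ.+-assoc x₂ y₂ z₂) }
            ; identity = (λ (x₀ , x₁ , x₂) → triple (ℚ.+-identityˡ x₀) (ℚ.+-identityˡ x₁) (ℚ.+-identityˡ x₂))
                       , (λ (x₀ , x₁ , x₂) → triple (ℚ.+-identityʳ x₀) (ℚ.+-identityʳ x₁) (ℚ.+-identityʳ x₂)) }
          ; inverse = (λ (x₀ , x₁ , x₂) → triple (ℚ.+-inverseˡ x₀) (ℚ.+-inverseˡ x₁) (ℚ.+-inverseˡ x₂))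
                    , (λ (x₀ , x₁ , x₂) → triple (ℚ.+-inverseʳ x₀) (ℚ.+-inverseʳ x₁) (ℚ.+-inverseʳ x₂))
          ; ⁻¹-cong = cong neg }
        ; comm = λ (x₀ , x₁ , x₂) (y₀ , y₁ , y₂) →
            triple (ℚ.+-comm x₀ y₀) (ℚ.+-comm x₁ y₁) (ℚ.+-comm x₂ y₂) }
      ; *-cong = cong₂ (mul K)
      ; *-assoc = mul-assoc K
      ; *-identity = mul-identityˡ K , λ x → trans (mul-comm K x one) (mul-identityˡ K x)
      ; distrib = mul-distribˡ K , λ x y z → trans (mul-comm K (add y z) x)
          (trans (mul-distribˡ K x y z) (cong₂ add (mul-comm K x y) (mul-comm K x z))) }
    ; *-comm = mul-comm K } }

ℤ⟶elements : ∀ K → ℤ.+-*-rawRing -Raw-AlmostCommutative⟶ fromCommutativeRing (elements K)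
ℤ⟶elements K = record
  { ⟦_⟧ = fromℤ ; +-homo = λ a b → cong fromℚ (/1-+ a b) ; *-homo = fromℤ-* K
  ; -‿homo = λ a → cong fromℚ (/1-neg a) ; 0-homo = refl ; 1-homo = refl }

module KS (K : Cubic) = IntegerSolver (elements K) (ℤ⟶elements K)

module _ {p : ℚ} (p≢0 : p ≢ 0ℚ) where
  instance
    nonZero : ℚ.NonZero p
    nonZero = ℚ.≢-nonZero p≢0

  inv : ℚ
  inv = ℚ.1/ p

  *-inv : p * inv ≡ 1ℚ
  *-inv = ℚ.*-inverseʳ p

  *-cancel-zero : ∀ {q} → p * q ≡ 0ℚ → q ≡ 0ℚ
  *-cancel-zero {q} pq≡0 = begin
    q               ≡⟨ ℚ.*-identityˡ q ⟨
    1ℚ * q          ≡⟨ cong (_* q) (ℚ.*-inverseˡ p) ⟨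
    inv * p * q     ≡⟨ ℚ.*-assoc inv p q ⟩
    inv * (p * q)   ≡⟨ cong (inv *_) pq≡0 ⟩
    inv * 0ℚ        ≡⟨ ℚ.*-zeroʳ inv ⟩
    0ℚ              ∎
    where open ≡-Reasoning

value : Cubic → ℚ → ℚ
value (cubic c₀ c₁ c₂) r = r * (r * (r + c₂) + c₁) + c₀

-- Synthetic division gives (θ - r) g(θ) = -f(r). If this is 0, inverting θ - r kills g(θ), whose
-- θ²-coordinate is 1.
no-rational-root : ∀ K → IsField K → ∀ r → value K r ≢ 0ℚ
no-rational-root K@(cubic c₀ c₁ c₂) field-K r f[r]≡0 =
  let (y , xy≡1) = field-K x x≢0 in
  contradict (begin
    g                       ≡⟨ mul-identityˡ K g ⟨
    mul K one g             ≡⟨ cong (λ u → mul K u g) xy≡1 ⟨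
    mul K (mul K x y) g     ≡⟨ cong (λ u → mul K u g) (mul-comm K x y) ⟩
    mul K (mul K y x) g     ≡⟨ mul-assoc K y x g ⟩
    mul K y (mul K x g)     ≡⟨ cong (mul K y) xg≡0 ⟩
    mul K y zero            ≡⟨ CommutativeRing.zeroʳ (elements K) y ⟩
    zero                    ∎)
  where
  open ≡-Reasoning
  x g : Elt
  x = - r , 1ℚ , 0ℚ
  g = r * (r + c₂) + c₁ , r + c₂ , 1ℚ
  x≢0 : x ≢ zero
  x≢0 eq = ℚ.1≢0 (cong (λ u → proj₁ (proj₂ u)) eq)
  contradict : g ≢ zero
  contradict eq = ℚ.1≢0 (cong (λ u → proj₂ (proj₂ u)) eq)
  xg≡0 : mul K x g ≡ zero
  xg≡0 = trans
    (identity³ (c₀ ∷ c₁ ∷ c₂ ∷ r ∷ []) λ c₀ c₁ c₂ r →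
      mulP (c₀ , c₁ , c₂) (ℚS.:- r , ℚS.con (+ 1) , ℚS.con (+ 0)) (r ⊗ (r ⊕ c₂) ⊕ c₁ , r ⊕ c₂ , ℚS.con (+ 1)) ,
      fromP (ℚS.:- (r ⊗ (r ⊗ (r ⊕ c₂) ⊕ c₁) ⊕ c₀)))
    (cong (λ u → fromℚ (- u)) f[r]≡0)

-- Irrational elements are generators

Rational : Elt → Set
Rational x = ∃[ q ] x ≡ fromℚ q

rational? : ∀ x → Dec (Rational x)
rational? (x₀ , x₁ , x₂) with x₁ ℚ.≟ 0ℚ | x₂ ℚ.≟ 0ℚ
... | yes refl | yes refl = yes (x₀ , refl)
... | no x₁≢0  | _        = no λ { (q , refl) → x₁≢0 refl }
... | yes _    | no x₂≢0  = no λ { (q , refl) → x₂≢0 refl }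

-- For x₂ = 0 the form is x₁³; otherwise it is x₂³ f(x₁/x₂ - c₂), where f defines K. So if it
-- vanishes, either x is rational or f has a rational root.
Δ≢0 : ∀ K → IsField K → ∀ x → ¬ Rational x → Δ K x ≢ 0ℚ
Δ≢0 K@(cubic c₀ c₁ c₂) field-K (x₀ , x₁ , x₂) irrational Δ≡0 with x₂ ℚ.≟ 0ℚ
... | yes refl with x₁ ℚ.≟ 0ℚ
...   | yes refl  = irrational (x₀ , refl)
...   | no x₁≢0 = x₁≢0 (*-cancel-zero x₁≢0 (*-cancel-zero x₁≢0 (trans
        (ℚS.identity (c₀ ∷ c₁ ∷ c₂ ∷ x₀ ∷ x₁ ∷ []) λ c₀ c₁ c₂ x₀ x₁ →
          x₁ ⊗ (x₁ ⊗ x₁) ℚS.⊜ ΔP (c₀ , c₁ , c₂) (x₀ , x₁ , ℚS.con (+ 0))) Δ≡0)))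
Δ≢0 K@(cubic c₀ c₁ c₂) field-K (x₀ , x₁ , x₂) irrational Δ≡0 | no x₂≢0 =
  no-rational-root K field-K (s - c₂)
    (*-cancel-zero x₂≢0 (*-cancel-zero x₂≢0 (*-cancel-zero x₂≢0 (begin
      x₂ * (x₂ * (x₂ * value K (s - c₂)))
        ≡⟨ (ℚS.identity (c₀ ∷ c₁ ∷ c₂ ∷ x₀ ∷ x₂ ∷ s ∷ []) λ c₀ c₁ c₂ x₀ x₂ s → let r = s ⊖ c₂ in
           x₂ ⊗ (x₂ ⊗ (x₂ ⊗ (r ⊗ (r ⊗ (r ⊕ c₂) ⊕ c₁) ⊕ c₀))) ℚS.⊜ ΔP (c₀ , c₁ , c₂) (x₀ , x₂ ⊗ s , x₂)) ⟩
      Δ K (x₀ , x₂ * s , x₂) ≡⟨ cong (λ u → Δ K (x₀ , u , x₂)) x₂s≡x₁ ⟩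
      Δ K (x₀ , x₁ , x₂)     ≡⟨ Δ≡0 ⟩
      0ℚ                     ∎))))
  where
  open ≡-Reasoning
  s : ℚ
  s = inv x₂≢0 * x₁
  x₂s≡x₁ : x₂ * s ≡ x₁
  x₂s≡x₁ = trans (sym (ℚ.*-assoc x₂ (inv x₂≢0) x₁)) (trans (cong (_* x₁) (*-inv x₂≢0)) (ℚ.*-identityˡ x₁))

-- Substitution of an element for θ

eval : Cubic → Elt → Elt → Elt
eval K x (u , v , w) = add (fromℚ u) (mul K x (add (fromℚ v) (mul K x (fromℚ w))))

evalP : ∀ {n} → Poly³ n → Poly³ n → Poly³ n → Poly³ n
evalP K x (u , v , w) = addP (fromP u) (mulP K x (addP (fromP v) (mulP K x (fromP w))))

-- Cramer's rule: the last two coordinates of u + vx + wx² form a linear system in v and w with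
-- determinant `Δ K x`, and u is what remains. `eval-surjective` solves the same system for an
-- arbitrary right-hand side.
eval-zero : ∀ K x → Δ K x ≢ 0ℚ → ∀ t → eval K x t ≡ zero → t ≡ zero
eval-zero K@(cubic c₀ c₁ c₂) x@(x₀ , x₁ , x₂) Δ≢0 t@(u , v , w) eq =
  triple
    (begin
      u                                ≡⟨ (ℚS.identity (c₀ ∷ c₁ ∷ c₂ ∷ x₀ ∷ x₁ ∷ x₂ ∷ u ∷ []) λ c₀ c₁ c₂ x₀ x₁ x₂ u →
                                            u ℚS.⊜ proj₁ (evalP (c₀ , c₁ , c₂) (x₀ , x₁ , x₂) (u , ℚS.con (+ 0) , ℚS.con (+ 0)))) ⟩
      proj₁ (eval K x (u , 0ℚ , 0ℚ))   ≡⟨ cong₂ (λ v w → proj₁ (eval K x (u , v , w))) v≡0 w≡0 ⟨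
      proj₁ (eval K x t)               ≡⟨ cong proj₁ eq ⟩
      0ℚ                               ∎)
    v≡0 w≡0
  where
  open ≡-Reasoning
  ρ = c₀ ∷ c₁ ∷ c₂ ∷ x₀ ∷ x₁ ∷ x₂ ∷ u ∷ v ∷ w ∷ []
  y z : Elt
  y = mul K x x
  z = eval K x t
  y₁ y₂ z₁ z₂ : ℚ
  y₁ = proj₁ (proj₂ y)
  y₂ = proj₂ (proj₂ y)
  z₁ = proj₁ (proj₂ z)
  z₂ = proj₂ (proj₂ z)
  vanish : ∀ a b → a * z₁ - b * z₂ ≡ 0ℚ
  vanish a b = trans (cong₂ (λ s t → a * s - b * t) (cong (λ s → proj₁ (proj₂ s)) eq) (cong (λ s → proj₂ (proj₂ s)) eq))
    (ℚS.identity (a ∷ b ∷ []) λ a b → a ⊗ ℚS.con (+ 0) ⊖ b ⊗ ℚS.con (+ 0) ℚS.⊜ ℚS.con (+ 0))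
  v≡0 : v ≡ 0ℚ
  v≡0 = *-cancel-zero Δ≢0 (trans
    (ℚS.identity ρ λ c₀ c₁ c₂ x₀ x₁ x₂ u v w →
      let K = c₀ , c₁ , c₂ ; x = x₀ , x₁ , x₂
          (_ , y₁ , y₂) = mulP K x x ; (_ , z₁ , z₂) = evalP K x (u , v , w)
      in ΔP K x ⊗ v ℚS.⊜ y₂ ⊗ z₁ ⊖ y₁ ⊗ z₂)
    (vanish y₂ y₁))
  w≡0 : w ≡ 0ℚ
  w≡0 = *-cancel-zero Δ≢0 (trans
    (ℚS.identity ρ λ c₀ c₁ c₂ x₀ x₁ x₂ u v w →
      let K = c₀ , c₁ , c₂ ; x = x₀ , x₁ , x₂
          (_ , z₁ , z₂) = evalP K x (u , v , w)
      in ΔP K x ⊗ w ℚS.⊜ (ℚS.:- x₂) ⊗ z₁ ⊖ (ℚS.:- x₁) ⊗ z₂)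
    (vanish (- x₂) (- x₁)))

eval-surjective : ∀ K x → Δ K x ≢ 0ℚ → ∀ z → ∃[ t ] eval K x t ≡ z
eval-surjective K@(cubic c₀ c₁ c₂) x@(x₀ , x₁ , x₂) Δ≢0 z@(z₀ , z₁ , z₂) =
  let (y₀ , y₁ , y₂) = mul K x x
      v = z₁ * y₂ - z₂ * y₁ ; w = x₁ * z₂ - x₂ * z₁
  in (z₀ - (v * x₀ + w * y₀) * i , v * i , w * i) , trans
    (identity³ (c₀ ∷ c₁ ∷ c₂ ∷ x₀ ∷ x₁ ∷ x₂ ∷ z₀ ∷ z₁ ∷ z₂ ∷ i ∷ []) λ c₀ c₁ c₂ x₀ x₁ x₂ z₀ z₁ z₂ i →
      let K = c₀ , c₁ , c₂ ; x = x₀ , x₁ , x₂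
          (y₀ , y₁ , y₂) = mulP K x x
          v = z₁ ⊗ y₂ ⊖ z₂ ⊗ y₁ ; w = x₁ ⊗ z₂ ⊖ x₂ ⊗ z₁
      in evalP K x (z₀ ⊖ (v ⊗ x₀ ⊕ w ⊗ y₀) ⊗ i , v ⊗ i , w ⊗ i) ,
         (z₀ , z₁ ⊗ (ΔP K x ⊗ i) , z₂ ⊗ (ΔP K x ⊗ i)))
    (triple refl (unit z₁) (unit z₂))
  where
  i : ℚ
  i = inv Δ≢0
  unit : ∀ z → z * (Δ K x * i) ≡ z
  unit z = trans (cong (z *_) (*-inv Δ≢0)) (ℚ.*-identityʳ z)

eval-mul : ∀ K F x → evalCubic K F x ≡ zero → ∀ a b → eval K x (mul F a b) ≡ mul K (eval K x a) (eval K x b)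
eval-mul K F@(cubic c₀ c₁ c₂) x root (a₀ , a₁ , a₂) (b₀ , b₁ , b₂) = begin
  eval K x (mul F (a₀ , a₁ , a₂) (b₀ , b₁ , b₂))
    ≡⟨ cong₂ (λ s t → add s (mul K x t))
        (push c₀ p₃ (c₂ * c₀) p₄ p₀ (times a₀ b₀) p₃-hom p₄-hom (times c₂ c₀))
        (cong₂ (λ s t → add s (mul K x t))
          (push c₁ p₃ (c₂ * c₁ - c₀) p₄ p₁ (cong₂ add (times a₀ b₁) (times a₁ b₀)) p₃-hom p₄-hom
            (cong (λ t → add t (neg C₀)) (times c₂ c₁)))
          (push c₂ p₃ (c₂ * c₂ - c₁) p₄ p₂ (cong₂ add (cong₂ add (times a₀ b₂) (times a₁ b₁)) (times a₂ b₀))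
            p₃-hom p₄-hom (cong (λ t → add t (neg C₁)) (times c₂ c₂)))) ⟩
  _ ≡⟨ (identity (C₀ ∷ C₁ ∷ C₂ ∷ fromℚ a₀ ∷ fromℚ a₁ ∷ fromℚ a₂ ∷ fromℚ b₀ ∷ fromℚ b₁ ∷ fromℚ b₂ ∷ x ∷ [])
         λ c₀ c₁ c₂ a₀ a₁ a₂ b₀ b₁ b₂ x →
         let p₀ = a₀ :* b₀
             p₁ = a₀ :* b₁ :+ a₁ :* b₀
             p₂ = a₀ :* b₂ :+ a₁ :* b₁ :+ a₂ :* b₀
             p₃ = a₁ :* b₂ :+ a₂ :* b₁
             p₄ = a₂ :* b₂
         in (p₀ :- c₀ :* p₃ :+ (c₂ :* c₀) :* p₄) :+ x :*
             ((p₁ :- c₁ :* p₃ :+ (c₂ :* c₁ :- c₀) :* p₄) :+ x :*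
              (p₂ :- c₂ :* p₃ :+ (c₂ :* c₂ :- c₁) :* p₄))
            ⊜ (a₀ :+ x :* (a₁ :+ x :* a₂)) :* (b₀ :+ x :* (b₁ :+ x :* b₂))
              :- (x :* (x :* (x :+ c₂) :+ c₁) :+ c₀) :* (p₃ :+ p₄ :* (x :- c₂))) ⟩
  add ab (neg (mul K (evalCubic K F x) q))
    ≡⟨ cong (λ r → add ab (neg (mul K r q))) root ⟩
  add ab (neg (mul K zero q))
    ≡⟨ (identity (ab ∷ q ∷ []) λ ab q → ab :- con (+ 0) :* q ⊜ ab) ⟩
  ab ∎
  where
  open ≡-Reasoning
  open KS K
  C₀ C₁ C₂ ab q : Elt
  C₀ = fromℚ c₀
  C₁ = fromℚ c₁
  C₂ = fromℚ c₂
  ab = mul K (eval K x (a₀ , a₁ , a₂)) (eval K x (b₀ , b₁ , b₂))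
  times : ∀ p q → fromℚ (p * q) ≡ mul K (fromℚ p) (fromℚ q)
  times = fromℚ-* K
  -- The quotient p₄X + (p₃ - c₂p₄) of p₀ + p₁X + p₂X² + p₃X³ + p₄X⁴ by F; `mul F` returns the
  -- remainder, which at a root of F has the value of the product.
  q = add (add (mul K (fromℚ a₁) (fromℚ b₂)) (mul K (fromℚ a₂) (fromℚ b₁)))
          (mul K (mul K (fromℚ a₂) (fromℚ b₂)) (add x (neg C₂)))
  p₀ p₁ p₂ p₃ p₄ : ℚ
  p₀ = a₀ * b₀
  p₁ = a₀ * b₁ + a₁ * b₀
  p₂ = a₀ * b₂ + a₁ * b₁ + a₂ * b₀
  p₃ = a₁ * b₂ + a₂ * b₁
  p₄ = a₂ * b₂
  p₃-hom : fromℚ p₃ ≡ _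
  p₃-hom = cong₂ add (times a₁ b₂) (times a₂ b₁)
  p₄-hom : fromℚ p₄ ≡ _
  p₄-hom = times a₂ b₂
  -- `fromℚ` respects sums by computation, since 0ℚ + 0ℚ reduces, but products only through
  -- `fromℚ-*`.
  push : ∀ c r d s t {r′ s′ t′ d′} → fromℚ t ≡ t′ → fromℚ r ≡ r′ → fromℚ s ≡ s′ → fromℚ d ≡ d′ →
         fromℚ (t - c * r + d * s) ≡ add (add t′ (neg (mul K (fromℚ c) r′))) (mul K d′ s′)
  push c r d s t refl refl refl refl =
    cong₂ (λ u v → add (add (fromℚ t) (neg u)) v) (times c r) (times d s)

eval-add : ∀ K x a b → eval K x (add a b) ≡ add (eval K x a) (eval K x b)
eval-add K x (a₀ , a₁ , a₂) (b₀ , b₁ , b₂) =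
  identity (fromℚ a₀ ∷ fromℚ a₁ ∷ fromℚ a₂ ∷ fromℚ b₀ ∷ fromℚ b₁ ∷ fromℚ b₂ ∷ x ∷ []) λ a₀ a₁ a₂ b₀ b₁ b₂ x →
    (a₀ :+ b₀) :+ x :* ((a₁ :+ b₁) :+ x :* (a₂ :+ b₂)) ⊜ (a₀ :+ x :* (a₁ :+ x :* a₂)) :+ (b₀ :+ x :* (b₁ :+ x :* b₂))
  where open KS K

eval-one : ∀ K x → eval K x one ≡ one
eval-one K x = identity (x ∷ []) λ x → con (+ 1) :+ x :* (con (+ 0) :+ x :* con (+ 0)) ⊜ con (+ 1)
  where open KS K

eval-θ : ∀ K x → eval K x θ ≡ x
eval-θ K x = identity (x ∷ []) λ x → con (+ 0) :+ x :* (con (+ 1) :+ x :* con (+ 0)) ⊜ x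
  where open KS K

eval-injective : ∀ K x → Δ K x ≢ 0ℚ → ∀ s t → eval K x s ≡ eval K x t → s ≡ t
eval-injective K x Δ≢0 s t eq = begin
  s                     ≡⟨ (identity (s ∷ t ∷ []) λ s t → s ⊜ (s :- t) :+ t) ⟩
  add (add s (neg t)) t ≡⟨ cong (λ u → add u t) (eval-zero K x Δ≢0 (add s (neg t)) s-t) ⟩
  add zero t            ≡⟨ (identity (t ∷ []) λ t → con (+ 0) :+ t ⊜ t) ⟩
  t                     ∎
  where
  open ≡-Reasoning
  open KS K
  s-t : eval K x (add s (neg t)) ≡ zero
  s-t = begin
    eval K x (add s (neg t))
      ≡⟨ eval-add K x s (neg t) ⟩
    add (eval K x s) (eval K x (neg t))
      ≡⟨ cong (λ u → add u (eval K x (neg t))) eq ⟩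
    add (eval K x t) (eval K x (neg t))
      ≡⟨ eval-add K x t (neg t) ⟨
    eval K x (add t (neg t))
      ≡⟨ cong (eval K x) (identity (t ∷ []) λ t → t :- t ⊜ con (+ 0)) ⟩
    eval K x zero
      ≡⟨ (identity (x ∷ []) λ x → con (+ 0) :+ x :* (con (+ 0) :+ x :* con (+ 0)) ⊜ con (+ 0)) ⟩
    zero ∎

evalIso : ∀ K F x → Δ K x ≢ 0ℚ → evalCubic K F x ≡ zero → RingIso F K
evalIso K F x Δ≢0 root = record
  { hom = record
    { map = eval K x
    ; map-one = eval-one K x
    ; map-add = eval-add K x
    ; map-mul = eval-mul K F x root }
  ; inj = λ {s} {t} → eval-injective K x Δ≢0 s t
  ; surj = λ z → let (t , eq) = eval-surjective K x Δ≢0 z in t , λ { refl → eq } }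

-- The cubes cancel in the difference, and 1, x, x² are independent. This identifies a
-- characteristic polynomial from any monic cubic equation of x.
cubic-unique : ∀ K x → Δ K x ≢ 0ℚ → ∀ F G → evalCubic K F x ≡ zero → evalCubic K G x ≡ zero → F ≡ G
cubic-unique K x Δ≢0 (cubic c₀ c₁ c₂) (cubic d₀ d₁ d₂) F-root G-root =
  conclude (eval-injective K x Δ≢0 _ _ (begin
    eval K x (c₀ , c₁ , c₂)
      ≡⟨ split c₀ c₁ c₂ ⟩
    add (evalCubic K (cubic c₀ c₁ c₂) x) (neg x³)
      ≡⟨ cong (λ u → add u (neg x³)) (trans F-root (sym G-root)) ⟩
    add (evalCubic K (cubic d₀ d₁ d₂) x) (neg x³)
      ≡⟨ split d₀ d₁ d₂ ⟨
    eval K x (d₀ , d₁ , d₂) ∎))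
  where
  open ≡-Reasoning
  open KS K
  x³ : Elt
  x³ = mul K x (mul K x x)
  split : ∀ c₀ c₁ c₂ → eval K x (c₀ , c₁ , c₂) ≡ add (evalCubic K (cubic c₀ c₁ c₂) x) (neg x³)
  split c₀ c₁ c₂ = identity (fromℚ c₀ ∷ fromℚ c₁ ∷ fromℚ c₂ ∷ x ∷ []) λ c₀ c₁ c₂ x →
    c₀ :+ x :* (c₁ :+ x :* c₂) ⊜ (x :* (x :* (x :+ c₂) :+ c₁) :+ c₀) :- x :* (x :* x)
  conclude : (c₀ , c₁ , c₂) ≡ (d₀ , d₁ , d₂) → cubic c₀ c₁ c₂ ≡ cubic d₀ d₁ d₂
  conclude refl = refl

-- Integrality

ℤ⟶ℤ : ℤ.+-*-rawRing -Raw-AlmostCommutative⟶ fromCommutativeRing ℤ.+-*-commutativeRing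
ℤ⟶ℤ = -raw-almostCommutative⟶ (fromCommutativeRing ℤ.+-*-commutativeRing)

module ℤS = IntegerSolver ℤ.+-*-commutativeRing ℤ⟶ℤ

prime∣* : ∀ {ℓ} → Prime ℓ → ∀ a b → + ℓ ∣ℤ a ℤ.* b → + ℓ ∣ℤ a ⊎ + ℓ ∣ℤ b
prime∣* {ℓ} ℓ-prime a b ℓ∣ab
  with euclidsLemma ℤ.∣ a ∣ ℤ.∣ b ∣ ℓ-prime (subst (ℓ ℕ∣.∣_) (ℤ.abs-* a b) (∣⇒∣ᵤ ℓ∣ab))
... | inj₁ ℓ∣a = inj₁ (∣ᵤ⇒∣ ℓ∣a)
... | inj₂ ℓ∣b = inj₂ (∣ᵤ⇒∣ ℓ∣b)

prime∣*⇒∣ʳ : ∀ {ℓ} → Prime ℓ → ∀ {a b} → ¬ (+ ℓ ∣ℤ a) → + ℓ ∣ℤ a ℤ.* b → + ℓ ∣ℤ b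
prime∣*⇒∣ʳ ℓ-prime {a} {b} ℓ∤a ℓ∣ab with prime∣* ℓ-prime a b ℓ∣ab
... | inj₁ ℓ∣a = ⊥-elim (ℓ∤a ℓ∣a)
... | inj₂ ℓ∣b = ℓ∣b

prime-divisor : ∀ n → .{{_ : ℕ.NonZero n}} → n ≢ 1 → ∃[ ℓ ] Prime ℓ × ℓ ℕ∣.∣ n
prime-divisor n n≢1 with factorise n
... | record { factors = [] ; isFactorisation = n≡1 } = ⊥-elim (n≢1 n≡1)
... | record { factors = ℓ ∷ ls ; isFactorisation = eq ; factorsPrime = ℓ-prime ∷ _ } =
  ℓ , ℓ-prime , subst (ℓ ℕ∣.∣_) (sym eq) (ℕ∣.m∣m*n (product ls))

-- Gauss's lemma.  If F = dX³ − uX² − vX − w is primitive at ℓ, then ℓ divides every coefficient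
-- H k of a cofactor of F as soon as it divides F H = d D P; since ℓ ∣ d, dividing H by ℓ
-- replaces D by D / ℓ, and the descent never stops.
module Gauss {ℓ : ℕ} (ℓ-prime : Prime ℓ) (P : ℕ → ℤ) (d u v w : ℤ) (ℓ∣d : + ℓ ∣ℤ d)
             (ℓ∤F : ¬ (+ ℓ ∣ℤ u × + ℓ ∣ℤ v × + ℓ ∣ℤ w)) where
  Recurrence : ℤ → (ℕ → ℤ) → Set
  Recurrence D H = ∀ k → d ℤ.* H (3 ℕ.+ k) ≡ u ℤ.* H (2 ℕ.+ k) ℤ.+ v ℤ.* H (1 ℕ.+ k) ℤ.+ w ℤ.* H k ℤ.+ d ℤ.* D ℤ.* P k

  private instance
    ℓ-nonZero : ℕ.NonZero ℓ
    ℓ-nonZero = prime⇒nonZero ℓ-prime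

  -- As ℓ ∣ d, modulo ℓ the recurrence says that u H(k+2) + v H(k+1) + w H(k) vanishes. The first of
  -- u, v, w that is prime to ℓ expresses its term through earlier ones: two initial zeros are
  -- needed if it is u, one if it is v, none if it is w.
  all-divisible : ∀ {D H} → H 0 ≡ + 0 → H 1 ≡ + 0 → Recurrence D H → ∀ k → + ℓ ∣ℤ H k
  all-divisible {D} {H} H₀ H₁ rec k with (+ ℓ) ∣? u | (+ ℓ) ∣? v
  ... | no ℓ∤u | _ = proj₁ (both k)
    where
    both : ∀ k → + ℓ ∣ℤ H k × + ℓ ∣ℤ H (suc k)
    both 0 = subst (+ ℓ ∣ℤ_) (sym H₀) (divides (+ 0) refl) , subst (+ ℓ ∣ℤ_) (sym H₁) (divides (+ 0) refl)
    both (suc k) = let (ℓ∣H₀ , ℓ∣H₁) = both k in ℓ∣H₁ , prime∣*⇒∣ʳ ℓ-prime ℓ∤u (subst (+ ℓ ∣ℤ_)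
      (trans (cong (λ t → t ℤ.- v ℤ.* H (1 ℕ.+ k) ℤ.- w ℤ.* H k ℤ.- d ℤ.* D ℤ.* P k) (rec k))
        (ℤS.identity (u ℤ.* H (2 ℕ.+ k) ∷ v ℤ.* H (1 ℕ.+ k) ∷ w ℤ.* H k ∷ d ℤ.* D ℤ.* P k ∷ []) λ a b c e →
          a ℤS.:+ b ℤS.:+ c ℤS.:+ e ℤS.:- b ℤS.:- c ℤS.:- e ℤS.⊜ a))
      (ℤ∣.∣m∣n⇒∣m-n (ℤ∣.∣m∣n⇒∣m-n (ℤ∣.∣m∣n⇒∣m-n
        (ℤ∣.∣m⇒∣m*n _ ℓ∣d) (ℤ∣.∣n⇒∣m*n v ℓ∣H₁)) (ℤ∣.∣n⇒∣m*n w ℓ∣H₀)) (ℤ∣.∣m⇒∣m*n _ (ℤ∣.∣m⇒∣m*n D ℓ∣d))))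
  ... | yes ℓ∣u | no ℓ∤v = go k
    where
    go : ∀ k → + ℓ ∣ℤ H k
    go 0 = subst (+ ℓ ∣ℤ_) (sym H₀) (divides (+ 0) refl)
    go (suc k) = prime∣*⇒∣ʳ ℓ-prime ℓ∤v (subst (+ ℓ ∣ℤ_)
      (trans (cong (λ t → t ℤ.- u ℤ.* H (2 ℕ.+ k) ℤ.- w ℤ.* H k ℤ.- d ℤ.* D ℤ.* P k) (rec k))
        (ℤS.identity (u ℤ.* H (2 ℕ.+ k) ∷ v ℤ.* H (1 ℕ.+ k) ∷ w ℤ.* H k ∷ d ℤ.* D ℤ.* P k ∷ []) λ a b c e →
          a ℤS.:+ b ℤS.:+ c ℤS.:+ e ℤS.:- a ℤS.:- c ℤS.:- e ℤS.⊜ b))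
      (ℤ∣.∣m∣n⇒∣m-n (ℤ∣.∣m∣n⇒∣m-n (ℤ∣.∣m∣n⇒∣m-n
        (ℤ∣.∣m⇒∣m*n _ ℓ∣d) (ℤ∣.∣m⇒∣m*n _ ℓ∣u)) (ℤ∣.∣n⇒∣m*n w (go k))) (ℤ∣.∣m⇒∣m*n _ (ℤ∣.∣m⇒∣m*n D ℓ∣d))))
  ... | yes ℓ∣u | yes ℓ∣v = prime∣*⇒∣ʳ ℓ-prime (λ ℓ∣w → ℓ∤F (ℓ∣u , ℓ∣v , ℓ∣w)) (subst (+ ℓ ∣ℤ_)
      (trans (cong (λ t → t ℤ.- u ℤ.* H (2 ℕ.+ k) ℤ.- v ℤ.* H (1 ℕ.+ k) ℤ.- d ℤ.* D ℤ.* P k) (rec k))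
        (ℤS.identity (u ℤ.* H (2 ℕ.+ k) ∷ v ℤ.* H (1 ℕ.+ k) ∷ w ℤ.* H k ∷ d ℤ.* D ℤ.* P k ∷ []) λ a b c e →
          a ℤS.:+ b ℤS.:+ c ℤS.:+ e ℤS.:- a ℤS.:- b ℤS.:- e ℤS.⊜ c))
      (ℤ∣.∣m∣n⇒∣m-n (ℤ∣.∣m∣n⇒∣m-n (ℤ∣.∣m∣n⇒∣m-n
        (ℤ∣.∣m⇒∣m*n _ ℓ∣d) (ℤ∣.∣m⇒∣m*n _ ℓ∣u)) (ℤ∣.∣m⇒∣m*n _ ℓ∣v)) (ℤ∣.∣m⇒∣m*n _ (ℤ∣.∣m⇒∣m*n D ℓ∣d))))

  -- The entry at 3 is the leading coefficient of the quotient. Keeping it equal to D is what makes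
  -- D itself divisible by ℓ.
  descent : ∀ {D} → Acc _<_ D → D ≢ 0 → ∀ H → H 0 ≡ + 0 → H 1 ≡ + 0 → H 3 ≡ + D → ¬ Recurrence (+ D) H
  descent {D} (acc rs) D≢0 H H₀ H₁ H₃ rec =
    descent {D′} (rs D′<D) D′≢0 H′ (cancel (trans (sym (H-eq 0)) H₀)) (cancel (trans (sym (H-eq 1)) H₁))
      H′₃ rec′
    where
    ℓ∣H : ∀ k → + ℓ ∣ℤ H k
    ℓ∣H = all-divisible H₀ H₁ rec
    H′ : ℕ → ℤ
    H′ k = ℤ∣.quotient (ℓ∣H k)
    H-eq : ∀ k → H k ≡ H′ k ℤ.* + ℓ
    H-eq k = ℤ∣._∣_.equality (ℓ∣H k)
    ℓ∣D : ℓ ℕ∣.∣ D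
    ℓ∣D = ∣⇒∣ᵤ (subst (+ ℓ ∣ℤ_) H₃ (ℓ∣H 3))
    D′ : ℕ
    D′ = ℕ∣.quotient ℓ∣D
    D-eq : D ≡ D′ ℕ.* ℓ
    D-eq = ℕ∣._∣_.equality ℓ∣D
    D′≢0 : D′ ≢ 0
    D′≢0 D′≡0 = D≢0 (trans D-eq (cong (ℕ._* ℓ) D′≡0))
    D′<D : D′ < D
    D′<D = ℕ∣.quotient-< ℓ∣D {{prime⇒nonTrivial ℓ-prime}} {{ℕ.≢-nonZero D≢0}}
    cancel : ∀ {a b} → a ℤ.* + ℓ ≡ b ℤ.* + ℓ → a ≡ b
    cancel {a} {b} = ℤ.*-cancelʳ-≡ a b (+ ℓ)
    D-eqℤ : + D ≡ + D′ ℤ.* + ℓ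
    D-eqℤ = trans (cong +_ D-eq) (ℤ.pos-* D′ ℓ)
    H′₃ : H′ 3 ≡ + D′
    H′₃ = cancel (trans (sym (H-eq 3)) (trans H₃ D-eqℤ))
    rec′ : Recurrence (+ D′) H′
    rec′ k = cancel (begin
      d ℤ.* H′ (3 ℕ.+ k) ℤ.* + ℓ
        ≡⟨ trans (ℤ.*-assoc d _ _) (cong (d ℤ.*_) (sym (H-eq (3 ℕ.+ k)))) ⟩
      d ℤ.* H (3 ℕ.+ k)
        ≡⟨ rec k ⟩
      u ℤ.* H (2 ℕ.+ k) ℤ.+ v ℤ.* H (1 ℕ.+ k) ℤ.+ w ℤ.* H k ℤ.+ d ℤ.* + D ℤ.* P k
        ≡⟨ cong₂ ℤ._+_ (cong₂ ℤ._+_ (cong₂ (λ a b → u ℤ.* a ℤ.+ v ℤ.* b) (H-eq (2 ℕ.+ k)) (H-eq (1 ℕ.+ k)))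
             (cong (w ℤ.*_) (H-eq k))) (cong (λ a → d ℤ.* a ℤ.* P k) D-eqℤ) ⟩
      u ℤ.* (H′ (2 ℕ.+ k) ℤ.* + ℓ) ℤ.+ v ℤ.* (H′ (1 ℕ.+ k) ℤ.* + ℓ) ℤ.+ w ℤ.* (H′ k ℤ.* + ℓ) ℤ.+ d ℤ.* (+ D′ ℤ.* + ℓ) ℤ.* P k
        ≡⟨ (ℤS.identity (u ∷ v ∷ w ∷ d ∷ + D′ ∷ + ℓ ∷ P k ∷ H′ (2 ℕ.+ k) ∷ H′ (1 ℕ.+ k) ∷ H′ k ∷ [])
              λ u v w d D ℓ P a b c →
              u :* (a :* ℓ) :+ v :* (b :* ℓ) :+ w :* (c :* ℓ) :+ d :* (D :* ℓ) :* P
                ℤS.⊜ (u :* a :+ v :* b :+ w :* c :+ d :* D :* P) :* ℓ) ⟩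
      (u ℤ.* H′ (2 ℕ.+ k) ℤ.+ v ℤ.* H′ (1 ℕ.+ k) ℤ.+ w ℤ.* H′ k ℤ.+ d ℤ.* + D′ ℤ.* P k) ℤ.* + ℓ ∎)
      where
      open ≡-Reasoning
      open ℤS using (_:*_; _:+_)

*-↧ : ∀ q → (↧ q) /1 * q ≡ (↥ q) /1
*-↧ q@record{} = ℚ.toℚᵘ-injective (begin
  ℚ.toℚᵘ ((↧ q) /1 * q)                ≈⟨ ℚ.toℚᵘ-homo-* ((↧ q) /1) q ⟩
  ℚ.toℚᵘ ((↧ q) /1) ℚᵘ.* ℚ.toℚᵘ q      ≈⟨ ℚᵘ.*-congʳ (ℚ.toℚᵘ-fromℚᵘ (ℚᵘ.mkℚᵘ (↧ q) 0)) ⟩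
  ℚᵘ.mkℚᵘ (↧ q) 0 ℚᵘ.* ℚ.toℚᵘ q        ≈⟨ ℚᵘ.*≡* (trans (ℤ.*-identityʳ _) (trans (ℤ.*-comm (↧ q) (↥ q))
                                            (cong (λ n → ↥ q ℤ.* + n) (sym (ℕ.+-identityʳ _))))) ⟩
  ℚᵘ.mkℚᵘ (↥ q) 0                      ≈⟨ ℚ.toℚᵘ-fromℚᵘ (ℚᵘ.mkℚᵘ (↥ q) 0) ⟨
  ℚ.toℚᵘ ((↥ q) /1)                    ∎)
  where open ℚᵘ.≃-Reasoning

Integer : ℚ → Set
Integer q = ∃[ z ] q ≡ z /1

common-denominator : ∀ m (f : ℕ → ℚ) → (∀ k → f (m ℕ.+ k) ≡ 0ℚ) →
                     ∃[ D ] D ≢ 0 × Σ (ℕ → ℤ) λ H → ∀ k → (+ D) /1 * f k ≡ H k /1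
common-denominator 0 f vanish = 1 , (λ ()) , (λ _ → + 0) , λ k → trans (ℚ.*-identityˡ (f k)) (vanish k)
common-denominator (suc m) f vanish =
  let (D , D≢0 , H , eq) = common-denominator m (λ k → f (suc k)) vanish
      d = ↧ₙ f 0
  in d ℕ.* D , nonzero D≢0 , (λ { 0 → + D ℤ.* ↥ f 0 ; (suc k) → + d ℤ.* H k }) , λ
    { 0 → begin
        (+ (d ℕ.* D)) /1 * f 0        ≡⟨ cong (_* f 0) (split d D) ⟩
        (+ d) /1 * (+ D) /1 * f 0     ≡⟨ (ℚS.identity ((+ d) /1 ∷ (+ D) /1 ∷ f 0 ∷ []) λ d D f → d ⊗ D ⊗ f ℚS.⊜ D ⊗ (d ⊗ f)) ⟩
        (+ D) /1 * ((+ d) /1 * f 0)   ≡⟨ cong ((+ D) /1 *_) (*-↧ (f 0)) ⟩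
        (+ D) /1 * (↥ f 0) /1         ≡⟨ /1-* (+ D) (↥ f 0) ⟨
        (+ D ℤ.* ↥ f 0) /1            ∎
    ; (suc k) → begin
        (+ (d ℕ.* D)) /1 * f (suc k)        ≡⟨ cong (_* f (suc k)) (split d D) ⟩
        (+ d) /1 * (+ D) /1 * f (suc k)     ≡⟨ ℚ.*-assoc ((+ d) /1) ((+ D) /1) (f (suc k)) ⟩
        (+ d) /1 * ((+ D) /1 * f (suc k))   ≡⟨ cong ((+ d) /1 *_) (eq k) ⟩
        (+ d) /1 * H k /1                   ≡⟨ /1-* (+ d) (H k) ⟨
        (+ d ℤ.* H k) /1                    ∎ }
  where
  open ≡-Reasoning
  split : ∀ a b → (+ (a ℕ.* b)) /1 ≡ (+ a) /1 * (+ b) /1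
  split a b = trans (cong _/1 (ℤ.pos-* a b)) (/1-* (+ a) (+ b))
  nonzero : ∀ {D} → D ≢ 0 → ↧ₙ f 0 ℕ.* D ≢ 0
  nonzero {suc D} D≢0 ()
  nonzero {0} D≢0 _ = D≢0 refl

-- z is the sequence of coefficients of the quotient of the polynomial with coefficients P by
-- X³ − pX² − qX − r; that it ends expresses that the division is exact.
module _ (P : ℕ → ℤ) (p q r : ℚ) (z : ℕ → ℚ) (z₀ : z 0 ≡ 0ℚ) (z₁ : z 1 ≡ 0ℚ) (z₃ : z 3 ≡ 1ℚ)
         (z-rec : ∀ k → z (3 ℕ.+ k) ≡ p * z (2 ℕ.+ k) + q * z (1 ℕ.+ k) + r * z k + P k /1)
         (m : ℕ) (z-ends : ∀ k → z (m ℕ.+ k) ≡ 0ℚ) where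

  -- With a common denominator D of the finite sequence z, the integers D z would start the descent
  -- of `Gauss` if some coefficient were prime to ℓ. The argument is by contradiction, hence the
  -- double negation; divisibility is decidable, so this is enough.
  imprimitive : ∀ u v w {ℓ d} → Prime ℓ → ℓ ℕ∣.∣ d →
    (+ d) /1 * p ≡ u /1 → (+ d) /1 * q ≡ v /1 → (+ d) /1 * r ≡ w /1 →
    ¬ ¬ (+ ℓ ∣ℤ u × + ℓ ∣ℤ v × + ℓ ∣ℤ w)
  imprimitive u v w {ℓ} {d} ℓ-prime ℓ∣d p-eq q-eq r-eq ℓ∤F =
    let (D , D≢0 , H , H-eq) = common-denominator m z z-ends
        at : ∀ k a {t} → z k ≡ t → (+ D) /1 * t ≡ a /1 → H k ≡ a
        at k a z-eq Dt = /1-injective (H k) a (trans (sym (H-eq k)) (trans (cong ((+ D) /1 *_) z-eq) Dt))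
    in Gauss.descent ℓ-prime P (+ d) u v w (∣ᵤ⇒∣ ℓ∣d) ℓ∤F (<-wellFounded D) D≢0 H
         (at 0 (+ 0) z₀ (ℚ.*-zeroʳ ((+ D) /1))) (at 1 (+ 0) z₁ (ℚ.*-zeroʳ ((+ D) /1))) (at 3 (+ D) z₃ (ℚ.*-identityʳ ((+ D) /1)))
         λ k → /1-injective (+ d ℤ.* H (3 ℕ.+ k)) (u ℤ.* H (2 ℕ.+ k) ℤ.+ v ℤ.* H (1 ℕ.+ k) ℤ.+ w ℤ.* H k ℤ.+ + d ℤ.* + D ℤ.* P k) (begin
           (+ d ℤ.* H (3 ℕ.+ k)) /1
             ≡⟨ trans (/1-* (+ d) (H (3 ℕ.+ k))) (cong ((+ d) /1 *_) (sym (H-eq (3 ℕ.+ k)))) ⟩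
           (+ d) /1 * ((+ D) /1 * z (3 ℕ.+ k))
             ≡⟨ cong (λ t → (+ d) /1 * ((+ D) /1 * t)) (z-rec k) ⟩
           (+ d) /1 * ((+ D) /1 * (p * z (2 ℕ.+ k) + q * z (1 ℕ.+ k) + r * z k + P k /1))
             ≡⟨ (ℚS.identity ((+ d) /1 ∷ (+ D) /1 ∷ p ∷ q ∷ r ∷ z (2 ℕ.+ k) ∷ z (1 ℕ.+ k) ∷ z k ∷ P k /1 ∷ [])
                  λ d D p q r x y z P →
                  d ⊗ (D ⊗ (p ⊗ x ⊕ q ⊗ y ⊕ r ⊗ z ⊕ P))
                    ℚS.⊜ (d ⊗ p) ⊗ (D ⊗ x) ⊕ (d ⊗ q) ⊗ (D ⊗ y) ⊕ (d ⊗ r) ⊗ (D ⊗ z) ⊕ d ⊗ D ⊗ P) ⟩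
           (+ d) /1 * p * ((+ D) /1 * z (2 ℕ.+ k)) + (+ d) /1 * q * ((+ D) /1 * z (1 ℕ.+ k))
             + (+ d) /1 * r * ((+ D) /1 * z k) + (+ d) /1 * (+ D) /1 * P k /1
             ≡⟨ cong₂ _+_ (cong₂ _+_ (cong₂ _+_ (cong₂ _*_ p-eq (H-eq (2 ℕ.+ k))) (cong₂ _*_ q-eq (H-eq (1 ℕ.+ k))))
                  (cong₂ _*_ r-eq (H-eq k))) refl ⟩
           u /1 * H (2 ℕ.+ k) /1 + v /1 * H (1 ℕ.+ k) /1 + w /1 * H k /1 + (+ d) /1 * (+ D) /1 * P k /1
             ≡⟨ embed u (H (2 ℕ.+ k)) v (H (1 ℕ.+ k)) w (H k) (+ d) (+ D) (P k) ⟨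
           (u ℤ.* H (2 ℕ.+ k) ℤ.+ v ℤ.* H (1 ℕ.+ k) ℤ.+ w ℤ.* H k ℤ.+ + d ℤ.* + D ℤ.* P k) /1 ∎)
    where
    open ≡-Reasoning
    embed : ∀ a a′ b b′ c c′ d D P →
      (a ℤ.* a′ ℤ.+ b ℤ.* b′ ℤ.+ c ℤ.* c′ ℤ.+ d ℤ.* D ℤ.* P) /1
        ≡ a /1 * a′ /1 + b /1 * b′ /1 + c /1 * c′ /1 + d /1 * D /1 * P /1
    embed a a′ b b′ c c′ d D P =
      trans (/1-+ (a ℤ.* a′ ℤ.+ b ℤ.* b′ ℤ.+ c ℤ.* c′) (d ℤ.* D ℤ.* P)) (cong₂ _+_
        (trans (/1-+ (a ℤ.* a′ ℤ.+ b ℤ.* b′) (c ℤ.* c′)) (cong₂ _+_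
          (trans (/1-+ (a ℤ.* a′) (b ℤ.* b′)) (cong₂ _+_ (/1-* a a′) (/1-* b b′))) (/1-* c c′)))
        (trans (/1-* (d ℤ.* D) P) (cong (_* P /1) (/1-* d D))))

  -- Strong induction on a common denominator d of p, q, r: a prime ℓ ∣ d divides all three
  -- numerators, so d / ℓ is a common denominator too, until d = 1.
  exact-quotient⇒integers : ∀ {d} → Acc _<_ d → d ≢ 0 → ∀ u v w →
    (+ d) /1 * p ≡ u /1 → (+ d) /1 * q ≡ v /1 → (+ d) /1 * r ≡ w /1 → Integer p × Integer q × Integer r
  exact-quotient⇒integers {d} (acc rs) d≢0 u v w p-eq q-eq r-eq = by-unit (d ℕ.≟ 1)
    where
    module _ {ℓ} (ℓ-prime : Prime ℓ) (ℓ∣d : ℓ ℕ∣.∣ d) where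
      d′ : ℕ
      d′ = ℕ∣.quotient ℓ∣d
      d-eq : d ≡ d′ ℕ.* ℓ
      d-eq = ℕ∣._∣_.equality ℓ∣d
      d′<d : d′ < d
      d′<d = ℕ∣.quotient-< ℓ∣d {{prime⇒nonTrivial ℓ-prime}} {{ℕ.≢-nonZero d≢0}}
      ℓ≢0 : (+ ℓ) /1 ≢ 0ℚ
      ℓ≢0 eq with /1-injective (+ ℓ) (+ 0) eq
      ... | refl = ℕ.≢-nonZero⁻¹ 0 {{prime⇒nonZero ℓ-prime}} refl
      reduce : ∀ p u u′ → (+ d) /1 * p ≡ u /1 → u ≡ u′ ℤ.* + ℓ → (+ d′) /1 * p ≡ u′ /1
      reduce p u u′ p-eq u-eq = begin
        (+ d′) /1 * p                  ≡⟨ (ℚS.identity ((+ d′) /1 ∷ p ∷ u′ /1 ∷ []) λ d p u → d ⊗ p ℚS.⊜ (d ⊗ p ⊖ u) ⊕ u) ⟩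
        (+ d′) /1 * p - u′ /1 + u′ /1  ≡⟨ cong (_+ u′ /1) (*-cancel-zero ℓ≢0 (begin
          (+ ℓ) /1 * ((+ d′) /1 * p - u′ /1)
            ≡⟨ (ℚS.identity ((+ d′) /1 ∷ p ∷ u′ /1 ∷ (+ ℓ) /1 ∷ []) λ d p u ℓ → ℓ ⊗ (d ⊗ p ⊖ u) ℚS.⊜ (d ⊗ ℓ) ⊗ p ⊖ u ⊗ ℓ) ⟩
          (+ d′) /1 * (+ ℓ) /1 * p - u′ /1 * (+ ℓ) /1
            ≡⟨ cong₂ (λ a b → a * p - b) (trans (sym (/1-* (+ d′) (+ ℓ))) (cong _/1 (sym (trans (cong +_ d-eq) (ℤ.pos-* d′ ℓ)))))
                 (trans (sym (/1-* u′ (+ ℓ))) (cong _/1 (sym u-eq))) ⟩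
          (+ d) /1 * p - u /1
            ≡⟨ cong (_- u /1) p-eq ⟩
          u /1 - u /1
            ≡⟨ ℚ.+-inverseʳ (u /1) ⟩
          0ℚ ∎)) ⟩
        0ℚ + u′ /1                     ≡⟨ ℚ.+-identityˡ (u′ /1) ⟩
        u′ /1                          ∎
        where open ≡-Reasoning

      by-divisibility : Dec (+ ℓ ∣ℤ u) → Dec (+ ℓ ∣ℤ v) → Dec (+ ℓ ∣ℤ w) → Integer p × Integer q × Integer r
      by-divisibility (yes (divides u′ u-eq)) (yes (divides v′ v-eq)) (yes (divides w′ w-eq)) =
        exact-quotient⇒integers (rs d′<d) (λ d′≡0 → d≢0 (trans d-eq (cong (ℕ._* ℓ) d′≡0)))
          u′ v′ w′ (reduce p u u′ p-eq u-eq) (reduce q v v′ q-eq v-eq) (reduce r w w′ r-eq w-eq)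
      by-divisibility (no ℓ∤u) _ _ =
        ⊥-elim (imprimitive u v w ℓ-prime ℓ∣d p-eq q-eq r-eq λ (ℓ∣u , _ , _) → ℓ∤u ℓ∣u)
      by-divisibility (yes _) (no ℓ∤v) _ =
        ⊥-elim (imprimitive u v w ℓ-prime ℓ∣d p-eq q-eq r-eq λ (_ , ℓ∣v , _) → ℓ∤v ℓ∣v)
      by-divisibility (yes _) (yes _) (no ℓ∤w) =
        ⊥-elim (imprimitive u v w ℓ-prime ℓ∣d p-eq q-eq r-eq λ (_ , _ , ℓ∣w) → ℓ∤w ℓ∣w)

    by-unit : Dec (d ≡ 1) → Integer p × Integer q × Integer r
    by-unit (no d≢1) =
      let (ℓ , ℓ-prime , ℓ∣d) = prime-divisor d {{ℕ.≢-nonZero d≢0}} d≢1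
      in by-divisibility ℓ-prime ℓ∣d ((+ ℓ) ∣? u) ((+ ℓ) ∣? v) ((+ ℓ) ∣? w)
    by-unit (yes d≡1) = (u , over-one u p-eq) , (v , over-one v q-eq) , (w , over-one w r-eq)
      where
      over-one : ∀ n {t} → (+ d) /1 * t ≡ n /1 → t ≡ n /1
      over-one n {t} eq = trans (sym (ℚ.*-identityˡ t)) (trans (cong (λ d → (+ d) /1 * t) (sym d≡1)) eq)

-- Division by a cubic with Horner's scheme

IntegerCubic : Cubic → Set
IntegerCubic F = ∃[ a ] ∃[ b ] ∃[ c ] F ≡ cubic (a /1) (b /1) (c /1)

module _ (F : Cubic) where
  open Cubic F

  step : Elt → ℤ → Elt
  step t c = add (fromℤ c) (mul F θ t)

  -- After the last digit the scheme goes on with zeros; the states form an infinite sequence, and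
  -- the end of the quotient becomes the vanishing of a tail.
  run : List ℤ → Elt → ℕ → Elt
  run l       t 0       = t
  run []      t (suc k) = run [] (step t (+ 0)) k
  run (c ∷ l) t (suc k) = run l (step t c) k

  digit : List ℤ → ℕ → ℤ
  digit []      k       = + 0
  digit (c ∷ l) 0       = c
  digit (c ∷ l) (suc k) = digit l k

  run-suc : ∀ l t k → run l t (suc k) ≡ step (run l t k) (digit l k)
  run-suc []      t 0       = refl
  run-suc (c ∷ l) t 0       = refl
  run-suc []      t (suc k) = run-suc [] (step t (+ 0)) k
  run-suc (c ∷ l) t (suc k) = run-suc l (step t c) k

  run-length : ∀ l t k → run l t (length l ℕ.+ k) ≡ run [] (foldl step t l) k
  run-length []      t k = refl
  run-length (c ∷ l) t k = run-length l (step t c) k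

  run-zero : ∀ k → run [] zero k ≡ zero
  run-zero 0       = refl
  run-zero (suc k) = trans (cong (λ t → run [] t k) (KS.identity F (θ ∷ []) λ θ → con (+ 0) :+ θ :* con (+ 0) ⊜ con (+ 0)))
                           (run-zero k)
    where open KS F using (con; _:+_; _:*_; _⊜_)

  foldl-evalMonic : ∀ cs → foldl step one (reverse cs) ≡ evalMonic F cs θ
  foldl-evalMonic cs = trans (reverse-foldl step one cs) (go cs)
    where
    go : ∀ cs → foldr (λ c t → step t c) one cs ≡ evalMonic F cs θ
    go []       = refl
    go (c ∷ cs) = cong (λ t → step t c) (go cs)

  step-coordinates : ∀ x y z c → step (x , y , z) c ≡ (c /1 - c₀ * z , x - c₁ * z , y - c₂ * z)
  step-coordinates x y z c = identity³ (c₀ ∷ c₁ ∷ c₂ ∷ x ∷ y ∷ z ∷ c /1 ∷ []) λ c₀ c₁ c₂ x y z c →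
    addP (fromP c) (mulP (c₀ , c₁ , c₂) (con (+ 0) , con (+ 1) , con (+ 0)) (x , y , z)) ,
    (c ⊖ c₀ ⊗ z , x ⊖ c₁ ⊗ z , y ⊖ c₂ ⊗ z)
    where open ℚS using (con)

  -- Horner's scheme modulo F is division by F: when a state is multiplied by θ, its θ²-coordinate
  -- is the multiple of F that is removed, hence a coefficient of the quotient. As θ is a root, the
  -- state after the last digit is zero and stays so.
  integral-θ⇒integers : ∀ cs → evalMonic F cs θ ≡ zero → IntegerCubic F
  integral-θ⇒integers cs root = conclude
    where
    open ≡-Reasoning
    -- Coefficients in descending order, with the leading 1 that `evalMonic` leaves implicit. From
    -- the state zero this 1 needs three steps to reach the θ²-coordinate, whence `Z₃`.
    l : List ℤ
    l = + 1 ∷ reverse cs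
    P : ℕ → ℤ
    P = digit l
    t : ℕ → Elt
    t = run l zero
    X Y Z : ℕ → ℚ
    X k = proj₁ (t k)
    Y k = proj₁ (proj₂ (t k))
    Z k = proj₂ (proj₂ (t k))
    t-suc : ∀ k → t (suc k) ≡ (P k /1 - c₀ * Z k , X k - c₁ * Z k , Y k - c₂ * Z k)
    t-suc k = trans (run-suc l zero k) (step-coordinates (X k) (Y k) (Z k) (P k))
    X-suc : ∀ k → X (suc k) ≡ P k /1 - c₀ * Z k
    X-suc k = cong proj₁ (t-suc k)
    Y-suc : ∀ k → Y (suc k) ≡ X k - c₁ * Z k
    Y-suc k = cong (λ t → proj₁ (proj₂ t)) (t-suc k)
    Z-suc : ∀ k → Z (suc k) ≡ Y k - c₂ * Z k
    Z-suc k = cong (λ t → proj₂ (proj₂ t)) (t-suc k)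
    minus-zero : ∀ a c {b z} → a ≡ b → z ≡ 0ℚ → a - c * z ≡ b
    minus-zero a c refl refl = ℚS.identity (a ∷ c ∷ []) λ a c → a ⊖ c ⊗ ℚS.con (+ 0) ℚS.⊜ a
    Z₁ : Z 1 ≡ 0ℚ
    Z₁ = trans (Z-suc 0) (minus-zero (Y 0) c₂ refl refl)
    Y₁ : Y 1 ≡ 0ℚ
    Y₁ = trans (Y-suc 0) (minus-zero (X 0) c₁ refl refl)
    X₁ : X 1 ≡ 1ℚ
    X₁ = trans (X-suc 0) (minus-zero (P 0 /1) c₀ refl refl)
    Z₂ : Z 2 ≡ 0ℚ
    Z₂ = trans (Z-suc 1) (minus-zero (Y 1) c₂ Y₁ Z₁)
    Y₂ : Y 2 ≡ 1ℚ
    Y₂ = trans (Y-suc 1) (minus-zero (X 1) c₁ X₁ Z₁)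
    Z₃ : Z 3 ≡ 1ℚ
    Z₃ = trans (Z-suc 2) (minus-zero (Y 2) c₂ Y₂ Z₂)
    Z-rec : ∀ k → Z (3 ℕ.+ k) ≡ (- c₂) * Z (2 ℕ.+ k) + (- c₁) * Z (1 ℕ.+ k) + (- c₀) * Z k + P k /1
    Z-rec k = begin
      Z (3 ℕ.+ k)
        ≡⟨ Z-suc (2 ℕ.+ k) ⟩
      Y (2 ℕ.+ k) - c₂ * Z (2 ℕ.+ k)
        ≡⟨ cong (_- c₂ * Z (2 ℕ.+ k)) (trans (Y-suc (1 ℕ.+ k)) (cong (_- c₁ * Z (1 ℕ.+ k)) (X-suc k))) ⟩
      P k /1 - c₀ * Z k - c₁ * Z (1 ℕ.+ k) - c₂ * Z (2 ℕ.+ k)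
        ≡⟨ (ℚS.identity (P k /1 ∷ c₀ ∷ c₁ ∷ c₂ ∷ Z k ∷ Z (1 ℕ.+ k) ∷ Z (2 ℕ.+ k) ∷ []) λ p c₀ c₁ c₂ x y z →
             p ⊖ c₀ ⊗ x ⊖ c₁ ⊗ y ⊖ c₂ ⊗ z
               ℚS.⊜ (ℚS.:- c₂) ⊗ z ⊕ (ℚS.:- c₁) ⊗ y ⊕ (ℚS.:- c₀) ⊗ x ⊕ p) ⟩
      (- c₂) * Z (2 ℕ.+ k) + (- c₁) * Z (1 ℕ.+ k) + (- c₀) * Z k + P k /1 ∎
    start : foldl step zero l ≡ zero
    start = begin
      foldl step (step zero (+ 1)) (reverse cs)
        ≡⟨ cong (λ u → foldl step u (reverse cs)) (KS.identity F (θ ∷ []) λ θ → con (+ 1) :+ θ :* con (+ 0) ⊜ con (+ 1)) ⟩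
      foldl step one (reverse cs)
        ≡⟨ foldl-evalMonic cs ⟩
      evalMonic F cs θ
        ≡⟨ root ⟩
      zero ∎
      where open KS F using (con; _:+_; _:*_; _⊜_)
    Z-ends : ∀ k → Z (length l ℕ.+ k) ≡ 0ℚ
    Z-ends k = cong (λ t → proj₂ (proj₂ t))
      (trans (run-length l zero k) (trans (cong (λ u → run [] u k) start) (run-zero k)))
    negate : ∀ c → Integer (- c) → Integer c
    negate c (a , eq) = ℤ.- a , trans (ℚS.identity (c ∷ []) λ c → c ℚS.⊜ ℚS.:- (ℚS.:- c))
                                      (trans (cong -_ eq) (sym (/1-neg a)))
    conclude : IntegerCubic F
    conclude =
      let (p , q , r) = exact-quotient⇒integers P (- c₂) (- c₁) (- c₀) Z refl Z₁ Z₃ Z-rec (length l) Z-ends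
                          (<-wellFounded (proj₁ cd)) (proj₁ (proj₂ cd))
                          (H 0) (H 1) (H 2) (H-eq 0) (H-eq 1) (H-eq 2)
          (a , a-eq) = negate c₂ p ; (b , b-eq) = negate c₁ q ; (c , c-eq) = negate c₀ r
      in c , b , a , trans (cong₂ (λ x y → cubic x y c₂) c-eq b-eq) (cong (cubic _ _) a-eq)
      where
      coefficients : ℕ → ℚ
      coefficients 0 = - c₂
      coefficients 1 = - c₁
      coefficients 2 = - c₀
      coefficients _ = 0ℚ
      cd : ∃[ D ] D ≢ 0 × Σ (ℕ → ℤ) λ H → ∀ k → (+ D) /1 * coefficients k ≡ H k /1
      cd = common-denominator 3 coefficients λ _ → refl
      H : ℕ → ℤ
      H = proj₁ (proj₂ (proj₂ cd))
      H-eq : ∀ k → (+ proj₁ cd) /1 * coefficients k ≡ H k /1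
      H-eq = proj₂ (proj₂ (proj₂ cd))

-- Units

ℤcubic : ℤ → ℤ → ℤ → Cubic
ℤcubic c₀ c₁ c₂ = cubic (c₀ /1) (c₁ /1) (c₂ /1)

eval-fromℚ : ∀ K x q → eval K x (fromℚ q) ≡ fromℚ q
eval-fromℚ K x q = identity (x ∷ fromℚ q ∷ []) λ x q → q :+ x :* (con (+ 0) :+ x :* con (+ 0)) ⊜ q
  where open KS K

eval-evalMonic : ∀ K F x → evalCubic K F x ≡ zero → ∀ cs → eval K x (evalMonic F cs θ) ≡ evalMonic K cs x
eval-evalMonic K F x root []       = eval-one K x
eval-evalMonic K F x root (c ∷ cs) = begin
  eval K x (add (fromℤ c) (mul F θ (evalMonic F cs θ)))
    ≡⟨ eval-add K x (fromℤ c) (mul F θ (evalMonic F cs θ)) ⟩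
  add (eval K x (fromℤ c)) (eval K x (mul F θ (evalMonic F cs θ)))
    ≡⟨ cong₂ add (eval-fromℚ K x (c /1)) (eval-mul K F x root θ (evalMonic F cs θ)) ⟩
  add (fromℤ c) (mul K (eval K x θ) (eval K x (evalMonic F cs θ)))
    ≡⟨ cong₂ (λ s t → add (fromℤ c) (mul K s t)) (eval-θ K x) (eval-evalMonic K F x root cs) ⟩
  add (fromℤ c) (mul K x (evalMonic K cs x)) ∎
  where open ≡-Reasoning

-- Substitution of x is injective on ℚ[X]/(char K x), so an integral equation of x pulls back to one
-- of the class of X, to which the division applies.
integral-char : ∀ K x → Δ K x ≢ 0ℚ → IsAlgInt K x → IntegerCubic (char K x)
integral-char K x Δx≢0 (cs , root) = integral-θ⇒integers (char K x) cs
  (eval-zero K x Δx≢0 (evalMonic (char K x) cs θ)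
    (trans (eval-evalMonic K (char K x) x (cayley-hamilton K x) cs) root))

-- A rational q is handled by the cubic algebra ℚ[X]/(X²(X − q)).
integral-rational : ∀ K q → IsAlgInt K (fromℚ q) → Integer q
integral-rational K q (cs , root) =
  let (_ , _ , c , eq) = integral-θ⇒integers F (+ 0 ∷ + 0 ∷ cs) root′
  in ℤ.- c , trans (ℚS.identity (q ∷ []) λ q → q ℚS.⊜ ℚS.:- (ℚS.:- q))
       (trans (cong (λ F → - Cubic.c₂ F) eq) (sym (/1-neg c)))
  where
  open ≡-Reasoning
  open KS (cubic 0ℚ 0ℚ (- q))
  F : Cubic
  F = cubic 0ℚ 0ℚ (- q)
  θ² : Elt
  θ² = mul F θ θ
  θ³ : mul F θ θ² ≡ mul F (fromℚ q) θ²
  θ³ = identity³ (q ∷ []) λ q →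
    let F = ℚS.con (+ 0) , ℚS.con (+ 0) , ℚS.:- q ; θ = ℚS.con (+ 0) , ℚS.con (+ 1) , ℚS.con (+ 0)
    in mulP F θ (mulP F θ θ) , mulP F (fromP q) (mulP F θ θ)
  -- θ² is an eigenvector of multiplication by θ with eigenvalue q, so a polynomial in θ acts on it
  -- as its value at q. The two zeros put in front of `cs` in `root′` multiply by X², which brings
  -- in θ².
  spectrum : ∀ cs → ∃[ g ] evalMonic K cs (fromℚ q) ≡ fromℚ g × mul F (evalMonic F cs θ) θ² ≡ mul F (fromℚ g) θ²
  spectrum []       = 1ℚ , refl , refl
  spectrum (c ∷ cs) =
    let (g , K-eq , F-eq) = spectrum cs ; E = evalMonic F cs θ in
    c /1 + q * g
    , cong (add (fromℤ c)) (trans (cong (mul K (fromℚ q)) K-eq) (sym (fromℚ-* K q g)))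
    , (begin
        mul F (add (fromℤ c) (mul F θ E)) θ²
          ≡⟨ (identity (fromℤ c ∷ θ ∷ E ∷ θ² ∷ []) λ c θ E θ² → (c :+ θ :* E) :* θ² ⊜ c :* θ² :+ θ :* (E :* θ²)) ⟩
        add (mul F (fromℤ c) θ²) (mul F θ (mul F E θ²))
          ≡⟨ cong (λ u → add (mul F (fromℤ c) θ²) (mul F θ u)) F-eq ⟩
        add (mul F (fromℤ c) θ²) (mul F θ (mul F (fromℚ g) θ²))
          ≡⟨ (identity (fromℤ c ∷ θ ∷ fromℚ g ∷ θ² ∷ []) λ c θ g θ² → c :* θ² :+ θ :* (g :* θ²) ⊜ c :* θ² :+ g :* (θ :* θ²)) ⟩
        add (mul F (fromℤ c) θ²) (mul F (fromℚ g) (mul F θ θ²))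
          ≡⟨ cong (λ u → add (mul F (fromℤ c) θ²) (mul F (fromℚ g) u)) θ³ ⟩
        add (mul F (fromℤ c) θ²) (mul F (fromℚ g) (mul F (fromℚ q) θ²))
          ≡⟨ (identity (fromℤ c ∷ fromℚ g ∷ fromℚ q ∷ θ² ∷ []) λ c g q θ² → c :* θ² :+ g :* (q :* θ²) ⊜ (c :+ q :* g) :* θ²) ⟩
        mul F (add (fromℤ c) (mul F (fromℚ q) (fromℚ g))) θ²
          ≡⟨ cong (λ u → mul F (add (fromℤ c) u) θ²) (fromℚ-* F q g) ⟨
        mul F (fromℚ (c /1 + q * g)) θ² ∎)
  root′ : evalMonic F (+ 0 ∷ + 0 ∷ cs) θ ≡ zero
  root′ = let (g , K-eq , F-eq) = spectrum cs ; E = evalMonic F cs θ in begin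
    add (fromℤ (+ 0)) (mul F θ (add (fromℤ (+ 0)) (mul F θ E)))
      ≡⟨ (identity (θ ∷ E ∷ []) λ θ E → con (+ 0) :+ θ :* (con (+ 0) :+ θ :* E) ⊜ E :* (θ :* θ)) ⟩
    mul F E θ²
      ≡⟨ F-eq ⟩
    mul F (fromℚ g) θ²
      ≡⟨ cong (λ u → mul F u θ²) (trans (sym K-eq) root) ⟩
    mul F zero θ²
      ≡⟨ (identity (θ² ∷ []) λ θ² → con (+ 0) :* θ² ⊜ con (+ 0)) ⟩
    zero ∎

IsSign : ℤ → Set
IsSign s = s ≡ + 1 ⊎ s ≡ ℤ.- (+ 1)

ℤ-unit : ∀ a b → a ℤ.* b ≡ + 1 → IsSign a
ℤ-unit a b ab≡1 = sign a (ℕ.m*n≡1⇒m≡1 ℤ.∣ a ∣ ℤ.∣ b ∣ (trans (sym (ℤ.abs-* a b)) (cong ℤ.∣_∣ ab≡1)))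
  where
  sign : ∀ a → ℤ.∣ a ∣ ≡ 1 → IsSign a
  sign (+ _)    refl = inj₁ refl
  sign -[1+ 0 ] refl = inj₂ refl

one≢zero : one ≢ zero
one≢zero eq = ℚ.1≢0 (cong proj₁ eq)

inverse-rational : ∀ K x q → mul K x (fromℚ q) ≡ one → Rational x
inverse-rational K x q xq≡1 = by-zero (q ℚ.≟ 0ℚ)
  where
  open ≡-Reasoning
  open KS K
  by-zero : Dec (q ≡ 0ℚ) → Rational x
  by-zero (yes q≡0) = ⊥-elim (one≢zero (begin
    one                ≡⟨ xq≡1 ⟨
    mul K x (fromℚ q)  ≡⟨ cong (λ q → mul K x (fromℚ q)) q≡0 ⟩
    mul K x zero       ≡⟨ (identity (x ∷ []) λ x → x :* con (+ 0) ⊜ con (+ 0)) ⟩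
    zero               ∎))
  by-zero (no q≢0) = inv q≢0 , (begin
    x                                           ≡⟨ (identity (x ∷ []) λ x → x ⊜ x :* con (+ 1)) ⟩
    mul K x one                                 ≡⟨ cong (λ u → mul K x (fromℚ u)) (*-inv q≢0) ⟨
    mul K x (fromℚ (q * inv q≢0))               ≡⟨ cong (mul K x) (fromℚ-* K q (inv q≢0)) ⟩
    mul K x (mul K (fromℚ q) (fromℚ (inv q≢0))) ≡⟨ mul-assoc K x (fromℚ q) (fromℚ (inv q≢0)) ⟨
    mul K (mul K x (fromℚ q)) (fromℚ (inv q≢0)) ≡⟨ cong (λ u → mul K u (fromℚ (inv q≢0))) xq≡1 ⟩
    mul K one (fromℚ (inv q≢0))                 ≡⟨ mul-identityˡ K (fromℚ (inv q≢0)) ⟩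
    fromℚ (inv q≢0)                             ∎)

rational-unit : ∀ K q → IsUnit K (fromℚ q) → ∃[ s ] IsSign s × q ≡ s /1
rational-unit K q (q-int , β , β-int , qβ≡1) =
  let (s , β≡s) = inverse-rational K β q (trans (mul-comm K β (fromℚ q)) qβ≡1)
      (a , a-eq) = integral-rational K q q-int
      (b , b-eq) = integral-rational K s (subst (IsAlgInt K) β≡s β-int)
  in a , ℤ-unit a b (/1-injective (a ℤ.* b) (+ 1) (trans (/1-* a b) (inverses a-eq b-eq β≡s))) , a-eq
  where
  inverses : ∀ {a b s} → q ≡ a → s ≡ b → β ≡ fromℚ s → a * b ≡ 1ℚ
  inverses {s = s} refl refl refl = cong proj₁ (trans (fromℚ-* K q s) qβ≡1)

-- The inverse of an irrational unit is irrational too, so both characteristic polynomials are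
-- integral, and their constant terms are inverse to each other.
unit-char : ∀ K → IsField K → ∀ x → ¬ Rational x → IsUnit K x →
            ∃[ c₀ ] ∃[ c₁ ] ∃[ c₂ ] IsSign c₀ × char K x ≡ ℤcubic c₀ c₁ c₂
unit-char K field-K x irrational (x-int , β , β-int , xβ≡1) =
  let Δx≢0 = Δ≢0 K field-K x irrational
      Δβ≢0 = Δ≢0 K field-K β λ { (q , refl) → irrational (inverse-rational K x q xβ≡1) }
      (c₀ , c₁ , c₂ , c-eq) = integral-char K x Δx≢0 x-int
      (d₀ , d₁ , d₂ , d-eq) = integral-char K β Δβ≢0 β-int
  in c₀ , c₁ , c₂ , ℤ-unit c₀ d₀ (/1-injective (c₀ ℤ.* d₀) (+ 1) (trans (/1-* c₀ d₀)
       (constants (c₀ /1) (c₁ /1) (c₂ /1) (d₀ /1) (d₁ /1) (d₂ /1) Δx≢0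
       (trans (cong (λ F → evalCubic K F x) (sym c-eq)) (cayley-hamilton K x))
       (trans (cong (λ F → evalCubic K F β) (sym d-eq)) (cayley-hamilton K β))))) , c-eq
  where
  open ≡-Reasoning
  open KS K
  -- Let F and G be the cubics that vanish at x and at β = 1/x. Then x³G(1/x) - d₀F(x) is a
  -- vanishing combination of 1, x, x² with constant term 1 - d₀c₀.
  constants : ∀ c₀ c₁ c₂ d₀ d₁ d₂ → Δ K x ≢ 0ℚ → evalCubic K (cubic c₀ c₁ c₂) x ≡ zero → evalCubic K (cubic d₀ d₁ d₂) β ≡ zero →
    c₀ * d₀ ≡ 1ℚ
  constants c₀ c₁ c₂ d₀ d₁ d₂ Δx≢0 x-root β-root = begin
    c₀ * d₀
      ≡⟨ (ℚS.identity (c₀ ∷ d₀ ∷ []) λ c d → c ⊗ d ℚS.⊜ ℚS.con (+ 1) ⊖ (ℚS.con (+ 1) ⊖ d ⊗ c)) ⟩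
    1ℚ - (1ℚ - d₀ * c₀)
      ≡⟨ cong (λ u → 1ℚ - proj₁ u) (eval-zero K x Δx≢0 (1ℚ - d₀ * c₀ , d₂ - d₀ * c₁ , d₁ - d₀ * c₂) (begin
        eval K x (1ℚ - d₀ * c₀ , d₂ - d₀ * c₁ , d₁ - d₀ * c₂)
          ≡⟨ cong₂ (λ a b → add a (mul K x b)) (push 1ℚ c₀) (cong₂ (λ a b → add a (mul K x b)) (push d₂ c₁) (push d₁ c₂)) ⟩
        _ ≡⟨ (identity (fromℚ c₀ ∷ fromℚ c₁ ∷ fromℚ c₂ ∷ fromℚ d₀ ∷ fromℚ d₁ ∷ fromℚ d₂ ∷ x ∷ []) λ c₀ c₁ c₂ d₀ d₁ d₂ x →
              (con (+ 1) :- d₀ :* c₀) :+ x :* ((d₂ :- d₀ :* c₁) :+ x :* (d₁ :- d₀ :* c₂)) ⊜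
              (con (+ 1) :* (con (+ 1) :* (con (+ 1) :+ d₂ :* x) :+ d₁ :* x :* x) :+ d₀ :* x :* x :* x)
                :- d₀ :* (x :* (x :* (x :+ c₂) :+ c₁) :+ c₀)) ⟩
        reversed one (evalCubic K (cubic c₀ c₁ c₂) x)
          ≡⟨ cong₂ reversed (sym xβ≡1) x-root ⟩
        reversed (mul K x β) zero
          ≡⟨ (identity (fromℚ d₀ ∷ fromℚ d₁ ∷ fromℚ d₂ ∷ x ∷ β ∷ []) λ d₀ d₁ d₂ x β →
              (x :* β) :* ((x :* β) :* ((x :* β) :+ d₂ :* x) :+ d₁ :* x :* x) :+ d₀ :* x :* x :* x :- d₀ :* con (+ 0)
                ⊜ x :* x :* x :* (β :* (β :* (β :+ d₂) :+ d₁) :+ d₀)) ⟩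
        mul K (mul K (mul K x x) x) (evalCubic K (cubic d₀ d₁ d₂) β)
          ≡⟨ cong (mul K (mul K (mul K x x) x)) β-root ⟩
        mul K (mul K (mul K x x) x) zero
          ≡⟨ (identity (x ∷ []) λ x → x :* x :* x :* con (+ 0) ⊜ con (+ 0)) ⟩
        zero ∎)) ⟩
    1ℚ ∎
    where
    push : ∀ a b → fromℚ (a - d₀ * b) ≡ add (fromℚ a) (neg (mul K (fromℚ d₀) (fromℚ b)))
    push a b = cong (λ u → add (fromℚ a) (neg u)) (fromℚ-* K d₀ b)
    -- This is x³G(β) with xβ written as u, minus d₀r. Taking u = 1 shows a polynomial in x, taking
    -- u = xβ a multiple of G(β).
    reversed : Elt → Elt → Elt
    reversed u r = add (add (mul K u (add (mul K u (add u (mul K (fromℚ d₂) x))) (mul K (mul K (fromℚ d₁) x) x)))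
                            (mul K (mul K (mul K (fromℚ d₀) x) x) x)) (neg (mul K (fromℚ d₀) r))

-- The norm of n - x is the characteristic polynomial of x at n; this is how the unit δ yields f(n)
-- = ±1.
char-reflect : ∀ K n x → Cubic.c₀ (char K (add (neg x) (fromℚ n))) ≡ - value (char K x) n
char-reflect (cubic c₀ c₁ c₂) n (x₀ , x₁ , x₂) =
  ℚS.identity (c₀ ∷ c₁ ∷ c₂ ∷ n ∷ x₀ ∷ x₁ ∷ x₂ ∷ []) λ c₀ c₁ c₂ n x₀ x₁ x₂ →
    let K = c₀ , c₁ , c₂ ; (d₀ , d₁ , d₂) = charP K (x₀ , x₁ , x₂)
    in proj₁ (charP K (:- x₀ ⊕ n , :- x₁ ⊕ con (+ 0) , :- x₂ ⊕ con (+ 0)))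
         ℚS.⊜ (:- (n ⊗ (n ⊗ (n ⊕ d₂) ⊕ d₁) ⊕ d₀))
  where open ℚS using (:-_; con)

char-neg : ∀ K x → let cubic d₀ d₁ d₂ = char K x in char K (neg x) ≡ cubic (- d₀) d₁ (- d₂)
char-neg (cubic c₀ c₁ c₂) (x₀ , x₁ , x₂) = conclude
  (identity³ (c₀ ∷ c₁ ∷ c₂ ∷ x₀ ∷ x₁ ∷ x₂ ∷ []) λ c₀ c₁ c₂ x₀ x₁ x₂ →
    let K = c₀ , c₁ , c₂ ; (d₀ , d₁ , d₂) = charP K (x₀ , x₁ , x₂)
    in charP K (:- x₀ , :- x₁ , :- x₂) , ((:- d₀) , d₁ , (:- d₂)))
  where
  open ℚS using (:-_)
  conclude : ∀ {a b c d e f : ℚ} → (a , b , c) ≡ (d , e , f) → cubic a b c ≡ cubic d e f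
  conclude refl = refl

square-positive : ∀ p → p ≢ 0ℚ → ℚ.Positive (p * p)
square-positive p p≢0 with ℚ.<-cmp p 0ℚ
... | tri< p<0 _ _ = ℚ.neg*neg⇒pos p {{ℚ.negative p<0}} p {{ℚ.negative p<0}}
... | tri≈ _ p≡0 _ = ⊥-elim (p≢0 p≡0)
... | tri> _ _ p>0 = ℚ.pos*pos⇒pos p {{ℚ.positive p>0}} p {{ℚ.positive p>0}}

disc-char-negative : ∀ K x → disc K ℚ.< 0ℚ → Δ K x ≢ 0ℚ → disc (char K x) ℚ.< 0ℚ
disc-char-negative K x disc<0 Δx≢0 = subst (ℚ._< 0ℚ) (sym (disc-char K x))
  (ℚ.negative⁻¹ (Δ K x * Δ K x * disc K)
    {{ℚ.pos*neg⇒neg (Δ K x * Δ K x) {{square-positive (Δ K x) Δx≢0}} (disc K) {{ℚ.negative disc<0}}}})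

valueℤ : ℤ → ℤ → ℤ → ℤ → ℤ
valueℤ c₀ c₁ c₂ n = n ℤ.* (n ℤ.* (n ℤ.+ c₂) ℤ.+ c₁) ℤ.+ c₀

value-/1 : ∀ c₀ c₁ c₂ n → value (ℤcubic c₀ c₁ c₂) (n /1) ≡ valueℤ c₀ c₁ c₂ n /1
value-/1 c₀ c₁ c₂ n = sym (trans (/1-+ (n ℤ.* (n ℤ.* (n ℤ.+ c₂) ℤ.+ c₁)) c₀) (cong (_+ c₀ /1)
  (trans (/1-* n (n ℤ.* (n ℤ.+ c₂) ℤ.+ c₁)) (cong (n /1 *_)
    (trans (/1-+ (n ℤ.* (n ℤ.+ c₂)) c₁) (cong (_+ c₁ /1)
      (trans (/1-* n (n ℤ.+ c₂)) (cong (n /1 *_) (/1-+ n c₂)))))))))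

private
  infixl 7 _·_
  _·_ : ℤ → ℤ → ℤ
  _·_ = ℤ._*_

discℤ : ℤ → ℤ → ℤ → ℤ
discℤ d c b = b · b · c · c ℤ.- + 4 · c · c · c ℤ.- + 4 · b · b · b · d ℤ.- + 27 · d · d ℤ.+ + 18 · b · c · d

private
  /1-⊗ : ∀ a b {p q} → a /1 ≡ p → b /1 ≡ q → (a ℤ.* b) /1 ≡ p * q
  /1-⊗ a b refl refl = /1-* a b
  /1-⊕ : ∀ a b {p q} → a /1 ≡ p → b /1 ≡ q → (a ℤ.+ b) /1 ≡ p + q
  /1-⊕ a b refl refl = /1-+ a b
  /1-⊖ : ∀ a b {p q} → a /1 ≡ p → b /1 ≡ q → (a ℤ.- b) /1 ≡ p - q
  /1-⊖ a b refl refl = trans (/1-+ a (ℤ.- b)) (cong (a /1 +_) (/1-neg b))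
  /1-⊗⁴ : ∀ a b c d → (a ℤ.* b ℤ.* c ℤ.* d) /1 ≡ a /1 * b /1 * c /1 * d /1
  /1-⊗⁴ a b c d = /1-⊗ (a ℤ.* b ℤ.* c) d (/1-⊗ (a ℤ.* b) c (/1-* a b) refl) refl

disc-/1 : ∀ c₀ c₁ c₂ → disc (ℤcubic c₀ c₁ c₂) ≡ discℤ c₀ c₁ c₂ /1
disc-/1 d c b = sym
  (/1-⊕ (b · b · c · c ℤ.- + 4 · c · c · c ℤ.- + 4 · b · b · b · d ℤ.- + 27 · d · d) (+ 18 · b · c · d)
    (/1-⊖ (b · b · c · c ℤ.- + 4 · c · c · c ℤ.- + 4 · b · b · b · d) (+ 27 · d · d)
      (/1-⊖ (b · b · c · c ℤ.- + 4 · c · c · c) (+ 4 · b · b · b · d)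
        (/1-⊖ (b · b · c · c) (+ 4 · c · c · c) (/1-⊗⁴ b b c c) (/1-⊗⁴ (+ 4) c c c))
        (/1-⊗ (+ 4 · b · b · b) d (/1-⊗⁴ (+ 4) b b b) refl))
      (/1-⊗ (+ 27 · d) d (/1-* (+ 27) d) refl))
    (/1-⊗⁴ (+ 18) b c d))

/1-cancel-<0 : ∀ z → z /1 ℚ.< 0ℚ → z ℤ.< + 0
/1-cancel-<0 (+ n)    n<0 = ⊥-elim (ℚ.<-irrefl refl (ℚ.≤-<-trans (ℚ.nonNegative⁻¹ ((+ n) /1) {{ℚ.normalize-nonNeg n 1}}) n<0))
/1-cancel-<0 -[1+ n ] _   = ℤ.-<+

-- Cubics of negative discriminant

-- A polynomial with coefficients in ℕ, constant term first, is not negative on ℕ; the signs of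
-- discriminants are read off after a substitution that makes all coefficients natural numbers.
horner : List ℕ → ℤ → ℤ
horner []       x = + 0
horner (c ∷ cs) x = + c ℤ.+ x ℤ.* horner cs x

horner₂ : List (List ℕ) → ℤ → ℤ → ℤ
horner₂ []       x y = + 0
horner₂ (r ∷ rs) x y = horner r x ℤ.+ y ℤ.* horner₂ rs x y

module _ {n : ℕ} where
  open ℤS

  hornerP : List ℕ → Polynomial n → Polynomial n
  hornerP []       x = con (+ 0)
  hornerP (c ∷ cs) x = con (+ c) :+ x :* hornerP cs x

  horner₂P : List (List ℕ) → Polynomial n → Polynomial n → Polynomial n
  horner₂P []       x y = con (+ 0)
  horner₂P (r ∷ rs) x y = hornerP r x :+ y :* horner₂P rs x y

  discℤP : Polynomial n → Polynomial n → Polynomial n → Polynomial n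
  discℤP d c b = b :* b :* c :* c :- con (+ 4) :* c :* c :* c :- con (+ 4) :* b :* b :* b :* d
                   :- con (+ 27) :* d :* d :+ con (+ 18) :* b :* c :* d

Natural : ℤ → Set
Natural z = ∃[ n ] z ≡ + n

natural-+* : ∀ {a b} k → Natural a → Natural b → Natural (a ℤ.+ + k ℤ.* b)
natural-+* k (m , refl) (n , refl) = m ℕ.+ k ℕ.* n , cong (λ t → + m ℤ.+ t) (sym (ℤ.pos-* k n))

horner-natural : ∀ cs k → Natural (horner cs (+ k))
horner-natural []       k = 0 , refl
horner-natural (c ∷ cs) k = natural-+* k (c , refl) (horner-natural cs k)

horner₂-natural : ∀ rs k l → Natural (horner₂ rs (+ k) (+ l))
horner₂-natural []       k l = 0 , refl
horner₂-natural (r ∷ rs) k l = natural-+* l (horner-natural r k) (horner₂-natural rs k l)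

natural≮0 : ∀ {z w} → z ≡ w → Natural w → ¬ (z ℤ.< + 0)
natural≮0 refl (n , refl) (ℤ.+<+ ())

-- The discriminant of X(X − n)(X − m) − 1 when a and b are the gaps between the integers 0, n, m
-- in increasing order.
E : ℤ → ℤ → ℤ
E a b = a · a · (b · b) · ((a ℤ.+ b) · (a ℤ.+ b)) ℤ.+ + 2 · (a ℤ.- b) · (+ 2 · a ℤ.+ b) · (a ℤ.+ + 2 · b) ℤ.- + 27

EP : ∀ {n} → ℤS.Polynomial n → ℤS.Polynomial n → ℤS.Polynomial n
EP a b = a :* a :* (b :* b) :* ((a :+ b) :* (a :+ b)) :+ con (+ 2) :* (a :- b) :* (con (+ 2) :* a :+ b) :* (a :+ con (+ 2) :* b) :- con (+ 27)
  where open ℤS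

module _ where
  open ℤS using (_⊜_; con; _:+_; _:*_; _:-_; :-_)

  -- The substitutions X ↦ 1 - X and X ↦ 1/X permute, up to sign, the cubics for which θ and 1 - θ
  -- are units, and preserve the discriminant. Therefore one quartic serves `E 1 (4 + x)`,
  -- `E (2 + x) 1` and both ends of `one-family`.
  quartic : List ℕ
  quartic = 49 ∷ 126 ∷ 67 ∷ 14 ∷ 1 ∷ []

  -- The discriminant a²b²(a + b)² of X(X - n)(X - m) dominates. The middle term is 54 times the
  -- value of this cubic at the mean of its roots; it changes sign when a and b are exchanged, which
  -- is why the gaps (1, 2) and (1, 3) are left over but (2, 1) and (3, 1) are not.
  E-cases : ∀ i j → E (+ suc i) (+ suc j) ℤ.< + 0 → i ≡ 0 × (j ≡ 0 ⊎ j ≡ 1 ⊎ j ≡ 2)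
  E-cases 0 0 _ = refl , inj₁ refl
  E-cases 0 1 _ = refl , inj₂ (inj₁ refl)
  E-cases 0 2 _ = refl , inj₂ (inj₂ refl)
  E-cases 0 (suc (suc (suc j))) E<0 = ⊥-elim (natural≮0
    (ℤS.identity (+ j ∷ []) λ x → EP (con (+ 1)) (con (+ 4) :+ x) ⊜ hornerP quartic x) (horner-natural quartic j) E<0)
  E-cases (suc i) 0 E<0 = ⊥-elim (natural≮0
    (ℤS.identity (+ i ∷ []) λ x → EP (con (+ 2) :+ x) (con (+ 1)) ⊜ hornerP quartic x) (horner-natural quartic i) E<0)
  E-cases (suc i) (suc j) E<0 = ⊥-elim (natural≮0
    (ℤS.identity (+ i ∷ + j ∷ []) λ x y → EP (con (+ 2) :+ x) (con (+ 2) :+ y) ⊜ horner₂P rows x y) (horner₂-natural rows i j) E<0)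
    where
    rows : List (List ℕ)
    rows = (229 ∷ 456 ∷ 244 ∷ 52 ∷ 4 ∷ [])
         ∷ (312 ∷ 544 ∷ 278 ∷ 56 ∷ 4 ∷ [])
         ∷ (172 ∷ 266 ∷ 120 ∷ 20 ∷ 1 ∷ [])
         ∷ (44 ∷ 56 ∷ 20 ∷ 2 ∷ [])
         ∷ (4 ∷ 4 ∷ 1 ∷ [])
         ∷ []

  -- (n , b , c) stands for the solution (θ , n − θ) in ℚ[X]/(X³ + bX² + cX − 1).
  exceptions : List (ℤ × ℤ × ℤ)
  exceptions =
    (+ 1 , + 1 , + 0) ∷
    (+ 1 , + 0 , + 1) ∷
    (+ 1 , + 0 , -[1+ 0 ]) ∷
    (+ 1 , -[1+ 0 ] , + 2) ∷
    (+ 1 , -[1+ 1 ] , + 3) ∷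
    (+ 1 , -[1+ 2 ] , + 4) ∷
    (+ 1 , -[1+ 2 ] , + 2) ∷
    (+ 1 , -[1+ 3 ] , + 5) ∷
    (+ 1 , -[1+ 3 ] , + 3) ∷
    (+ 1 , -[1+ 4 ] , + 4) ∷
    (+ 2 , -[1+ 0 ] , -[1+ 0 ]) ∷
    (+ 2 , -[1+ 0 ] , -[1+ 1 ]) ∷
    (+ 2 , -[1+ 1 ] , + 1) ∷
    (+ 2 , -[1+ 2 ] , + 2) ∷
    (+ 2 , -[1+ 3 ] , + 5) ∷
    (+ 2 , -[1+ 4 ] , + 7) ∷
    (+ 3 , -[1+ 1 ] , -[1+ 2 ]) ∷
    (+ 3 , -[1+ 3 ] , + 3) ∷
    (+ 4 , -[1+ 4 ] , + 4) ∷
    (-[1+ 0 ] , + 3 , + 2) ∷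
    (-[1+ 0 ] , + 0 , -[1+ 0 ]) ∷
    (-[1+ 0 ] , -[1+ 0 ] , -[1+ 1 ]) ∷
    (-[1+ 0 ] , -[1+ 1 ] , -[1+ 2 ]) ∷
    (-[1+ 1 ] , + 5 , + 6) ∷
    (-[1+ 1 ] , + 3 , + 2) ∷
    (-[1+ 2 ] , + 7 , + 12) ∷
    (-[1+ 2 ] , + 5 , + 6) ∷
    (-[1+ 3 ] , + 7 , + 12) ∷
    []

  _∈?_ : (t : ℤ × ℤ × ℤ) (l : List (ℤ × ℤ × ℤ)) → Dec (t ∈ l)
  _∈?_ = DecMembership._∈?_ (≡-dec ℤ._≟_ (≡-dec ℤ._≟_ ℤ._≟_))

  found : ∀ t {_ : True (t ∈? exceptions)} → t ∈ exceptions
  found t {w} = toWitness w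

  -- `first` is f = X²(X - n) - 1, where ε is ω_n itself; `second` is f = X(X - n)² - 1, where n - ε
  -- is -ω_a for a = -n.
  data Classified (n b c : ℤ) : Set where
    first       : b ≡ ℤ.- n → c ≡ + 0 → Classified n b c
    second      : b ≡ ℤ.- (n ℤ.+ n) → c ≡ n ℤ.* n → Classified n b c
    exceptional : (n , b , c) ∈ exceptions → Classified n b c

  D : ℤ → ℤ → ℤ
  D n m = discℤ (ℤ.- (+ 1)) (n ℤ.* m) (ℤ.- (n ℤ.+ m))

  DP : ∀ {k} → ℤS.Polynomial k → ℤS.Polynomial k → ℤS.Polynomial k
  DP n m = discℤP (con (ℤ.- (+ 1))) (n :* m) (:- (n :+ m))

  ClassifiedPair : ℤ → ℤ → Set
  ClassifiedPair n m = Classified n (ℤ.- (n ℤ.+ m)) (n ℤ.* m)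

  -- f and g express n and m through these gaps, for one of the six orders of 0, n, m.
  configuration : (f g : ℤ → ℤ → ℤ) → (∀ x y → D (f x y) (g x y) ≡ E x y) →
    ClassifiedPair (f (+ 1) (+ 1)) (g (+ 1) (+ 1)) → ClassifiedPair (f (+ 1) (+ 2)) (g (+ 1) (+ 2)) →
    ClassifiedPair (f (+ 1) (+ 3)) (g (+ 1) (+ 3)) →
    ∀ i j → D (f (+ suc i) (+ suc j)) (g (+ suc i) (+ suc j)) ℤ.< + 0 →
    ClassifiedPair (f (+ suc i) (+ suc j)) (g (+ suc i) (+ suc j))
  configuration f g D≡E c₁ c₂ c₃ i j D<0
    with E-cases i j (subst (ℤ._< + 0) (D≡E (+ suc i) (+ suc j)) D<0)
  ... | refl , inj₁ refl        = c₁
  ... | refl , inj₂ (inj₁ refl) = c₂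
  ... | refl , inj₂ (inj₂ refl) = c₃

  -- The coincidences m = 0 and m = n give the two families of case (2). In each of the six strict
  -- orders of 0, n, m the gaps are passed from left to right, because `E` is not symmetric.
  classify-pair : ∀ n m → n ≢ + 0 → D n m ℤ.< + 0 → ClassifiedPair n m
  classify-pair n (+ 0) n≢0 _ = first (cong ℤ.-_ (ℤ.+-identityʳ n)) (ℤ.*-zeroʳ n)
  classify-pair (+ 0) m n≢0 = ⊥-elim (n≢0 refl)
  classify-pair (+ suc i) -[1+ j ] _ = configuration (λ x y → y) (λ x y → ℤ.- x)
    (λ x y → ℤS.identity (x ∷ y ∷ []) λ x y → DP y (:- x) ⊜ EP x y)
    (exceptional (found _)) (exceptional (found _)) (exceptional (found _)) j i
  classify-pair -[1+ i ] (+ suc j) _ = configuration (λ x y → ℤ.- x) (λ x y → y)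
    (λ x y → ℤS.identity (x ∷ y ∷ []) λ x y → DP (:- x) y ⊜ EP x y)
    (exceptional (found _)) (exceptional (found _)) (exceptional (found _)) i j
  classify-pair (+ suc i) (+ suc j) _ with ℕ.<-cmp i j
  ... | tri≈ _ refl _ = λ _ → second refl refl
  ... | tri> _ _ j<i with ℕ.m≤n⇒∃[o]m+o≡n j<i
  ...   | k , refl = subst (λ z → D z (+ suc j) ℤ.< + 0 → ClassifiedPair z (+ suc j))
      (cong +_ (ℕ.+-suc (suc j) k))
      (configuration (λ x y → x ℤ.+ y) (λ x y → x)
        (λ x y → ℤS.identity (x ∷ y ∷ []) λ x y → DP (x :+ y) x ⊜ EP x y)
        (exceptional (found _)) (exceptional (found _)) (exceptional (found _)) j k)
  classify-pair (+ suc i) (+ suc j) _ | tri< i<j _ _ with ℕ.m≤n⇒∃[o]m+o≡n i<j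
  ... | k , refl = subst (λ z → D (+ suc i) z ℤ.< + 0 → ClassifiedPair (+ suc i) z)
      (cong +_ (ℕ.+-suc (suc i) k))
      (configuration (λ x y → x) (λ x y → x ℤ.+ y)
        (λ x y → ℤS.identity (x ∷ y ∷ []) λ x y → DP x (x :+ y) ⊜ EP x y)
        (exceptional (found _)) (exceptional (found _)) (exceptional (found _)) i k)
  classify-pair -[1+ i ] -[1+ j ] _ with ℕ.<-cmp i j
  ... | tri≈ _ refl _ = λ _ → second refl refl
  ... | tri> _ _ j<i with ℕ.m≤n⇒∃[o]m+o≡n j<i
  ...   | k , refl = subst (λ z → D z -[1+ j ] ℤ.< + 0 → ClassifiedPair z -[1+ j ])
      (cong (λ z → ℤ.- (+ z)) (trans (ℕ.+-comm (suc k) (suc j)) (ℕ.+-suc (suc j) k)))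
      (configuration (λ x y → ℤ.- (x ℤ.+ y)) (λ x y → ℤ.- y)
        (λ x y → ℤS.identity (x ∷ y ∷ []) λ x y → DP (:- (x :+ y)) (:- y) ⊜ EP x y)
        (exceptional (found _)) (exceptional (found _)) (exceptional (found _)) k j)
  classify-pair -[1+ i ] -[1+ j ] _ | tri< i<j _ _ with ℕ.m≤n⇒∃[o]m+o≡n i<j
  ... | k , refl = subst (λ z → D -[1+ i ] z ℤ.< + 0 → ClassifiedPair -[1+ i ] z)
      (cong (λ z → ℤ.- (+ z)) (trans (ℕ.+-comm (suc k) (suc i)) (ℕ.+-suc (suc i) k)))
      (configuration (λ x y → ℤ.- y) (λ x y → ℤ.- (x ℤ.+ y))
        (λ x y → ℤS.identity (x ∷ y ∷ []) λ x y → DP (:- y) (:- (x :+ y)) ⊜ EP x y)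
        (exceptional (found _)) (exceptional (found _)) (exceptional (found _)) k i)

  difference : ∀ n b c → c ≡ (n ℤ.* (n ℤ.+ b) ℤ.+ c) ℤ.- n ℤ.* (n ℤ.+ b)
  difference n b c = ℤS.identity (n ∷ b ∷ c ∷ []) λ n b c → c ⊜ (n :* (n :+ b) :+ c) :- n :* (n :+ b)

  classify-divisor : ∀ n b c → n ℤ.* (n ℤ.* (n ℤ.+ b) ℤ.+ c) ≡ + 2 → discℤ (ℤ.- (+ 1)) c b ℤ.< + 0 → Classified n b c
  classify-divisor n b c nk≡2 disc<0 = by-n n refl
    where
    k : ℤ
    k = n ℤ.* (n ℤ.+ b) ℤ.+ c
    solve-c : ∀ n′ k′ .{{_ : ℤ.NonZero n′}} → n ≡ n′ → n′ ℤ.* k′ ≡ + 2 → c ≡ k′ ℤ.- n′ ℤ.* (n′ ℤ.+ b)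
    solve-c n′ k′ refl n′k′≡2 = trans (difference n b c)
      (cong (ℤ._- n ℤ.* (n ℤ.+ b)) (ℤ.*-cancelˡ-≡ n k k′ (trans nk≡2 (sym n′k′≡2))))
    small : ∀ a a′ → a ℕ.* a′ ≡ 2 → a ≡ 1 ⊎ a ≡ 2
    small 0 _ ()
    small 1 _ _ = inj₁ refl
    small 2 _ _ = inj₂ refl
    small (suc (suc (suc a))) a′ eq with ℕ∣.∣⇒≤ (ℕ∣.divides a′ (trans (sym eq) (ℕ.*-comm (suc (suc (suc a))) a′)))
    ... | s≤s (s≤s ())
    finish : ∀ {n′ c′} → n ≡ n′ → c ≡ c′ → (discℤ (ℤ.- (+ 1)) c′ b ℤ.< + 0 → Classified n′ b c′) → Classified n b c
    finish refl refl f = f disc<0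
    -- As f(1) = 1, the reciprocal cubic -X³f(1/X) takes the value -1 at 1. It is X(X - 1)(X + b) -
    -- 1 and has the discriminant of f, so the bounds on b are those for the gaps between 0, 1 and
    -- -b.
    one-family : ∀ b → discℤ (ℤ.- (+ 1)) (+ 2 ℤ.- + 1 ℤ.* (+ 1 ℤ.+ b)) b ℤ.< + 0 → Classified (+ 1) b (+ 2 ℤ.- + 1 ℤ.* (+ 1 ℤ.+ b))
    one-family (+ 0) _ = exceptional (found _)
    one-family (+ 1) _ = exceptional (found _)
    one-family -[1+ 0 ] _ = exceptional (found _)
    one-family -[1+ 1 ] _ = exceptional (found _)
    one-family -[1+ 2 ] _ = exceptional (found _)
    one-family -[1+ 3 ] _ = exceptional (found _)
    one-family (+ suc (suc x)) disc<0 = ⊥-elim (natural≮0 (ℤS.identity (+ x ∷ []) λ x → let b = con (+ 2) :+ x in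
      discℤP (con (ℤ.- (+ 1))) (con (+ 2) :- con (+ 1) :* (con (+ 1) :+ b)) b ⊜ hornerP quartic x) (horner-natural quartic x) disc<0)
    one-family -[1+ suc (suc (suc (suc x))) ] disc<0 = ⊥-elim (natural≮0 (ℤS.identity (+ x ∷ []) λ x → let b = :- (con (+ 5) :+ x) in
      discℤP (con (ℤ.- (+ 1))) (con (+ 2) :- con (+ 1) :* (con (+ 1) :+ b)) b ⊜ hornerP quartic x) (horner-natural quartic x) disc<0)
    -- Here c = -3 - 2b, and with y = b + 3 the discriminant is y²(4y² - 27), negative exactly for y
    -- = ±1 and y = ±2; at y = 0 the cubic is (X - 1)³. The symmetry in y is X ↦ 2 - X, which
    -- exchanges ε and δ, so both ends share one quartic.
    quartic₂ : List ℕ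
    quartic₂ = 81 ∷ 270 ∷ 189 ∷ 48 ∷ 4 ∷ []
    two-family : ∀ b → discℤ (ℤ.- (+ 1)) (+ 1 ℤ.- + 2 ℤ.* (+ 2 ℤ.+ b)) b ℤ.< + 0 → Classified (+ 2) b (+ 1 ℤ.- + 2 ℤ.* (+ 2 ℤ.+ b))
    two-family -[1+ 0 ] _ = exceptional (found _)
    two-family -[1+ 1 ] _ = exceptional (found _)
    two-family -[1+ 2 ] (ℤ.+<+ ())
    two-family -[1+ 3 ] _ = exceptional (found _)
    two-family -[1+ 4 ] _ = exceptional (found _)
    two-family (+ x) disc<0 = ⊥-elim (natural≮0 (ℤS.identity (+ x ∷ []) λ b →
      discℤP (con (ℤ.- (+ 1))) (con (+ 1) :- con (+ 2) :* (con (+ 2) :+ b)) b ⊜ hornerP quartic₂ b) (horner-natural quartic₂ x) disc<0)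
    two-family -[1+ suc (suc (suc (suc (suc x)))) ] disc<0 = ⊥-elim (natural≮0 (ℤS.identity (+ x ∷ []) λ x → let b = :- (con (+ 6) :+ x) in
      discℤP (con (ℤ.- (+ 1))) (con (+ 1) :- con (+ 2) :* (con (+ 2) :+ b)) b ⊜ hornerP quartic₂ x) (horner-natural quartic₂ x) disc<0)
    -- These are Shanks's simplest cubics X³ + bX² + (b - 3)X - 1, whose discriminant is the square
    -- of b² - 3b + 9.
    minus-one-family : ∀ b → ¬ (discℤ (ℤ.- (+ 1)) (-[1+ 1 ] ℤ.- -[1+ 0 ] ℤ.* (-[1+ 0 ] ℤ.+ b)) b ℤ.< + 0)
    minus-one-family (+ 0) (ℤ.+<+ ())
    minus-one-family (+ 1) (ℤ.+<+ ())
    minus-one-family (+ suc (suc x)) = natural≮0 (ℤS.identity (+ x ∷ []) λ x → let b = con (+ 2) :+ x in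
      discℤP (con (ℤ.- (+ 1))) (con -[1+ 1 ] :- con -[1+ 0 ] :* (con -[1+ 0 ] :+ b)) b ⊜ hornerP cs x) (horner-natural cs x)
      where
      cs : List ℕ
      cs = 49 ∷ 14 ∷ 15 ∷ 2 ∷ 1 ∷ []
    minus-one-family -[1+ x ] = natural≮0 (ℤS.identity (+ suc x ∷ []) λ x → let b = :- x in
      discℤP (con (ℤ.- (+ 1))) (con -[1+ 1 ] :- con -[1+ 0 ] :* (con -[1+ 0 ] :+ b)) b ⊜ hornerP cs x) (horner-natural cs (suc x))
      where
      cs : List ℕ
      cs = 81 ∷ 54 ∷ 27 ∷ 6 ∷ 1 ∷ []
    -- Here c = 2b - 5, and the discriminant is 4y⁴ + 13y² + 32 with y = b - 3, which is always
    -- positive.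
    minus-two-family : ∀ b → ¬ (discℤ (ℤ.- (+ 1)) (-[1+ 0 ] ℤ.- -[1+ 1 ] ℤ.* (-[1+ 1 ] ℤ.+ b)) b ℤ.< + 0)
    minus-two-family (+ 0) (ℤ.+<+ ())
    minus-two-family (+ 1) (ℤ.+<+ ())
    minus-two-family (+ 2) (ℤ.+<+ ())
    minus-two-family (+ suc (suc (suc x))) = natural≮0 (ℤS.identity (+ x ∷ []) λ x → let b = con (+ 3) :+ x in
      discℤP (con (ℤ.- (+ 1))) (con -[1+ 0 ] :- con -[1+ 1 ] :* (con -[1+ 1 ] :+ b)) b ⊜ hornerP cs x) (horner-natural cs x)
      where
      cs : List ℕ
      cs = 32 ∷ 0 ∷ 13 ∷ 0 ∷ 4 ∷ []
    minus-two-family -[1+ x ] = natural≮0 (ℤS.identity (+ suc x ∷ []) λ x → let b = :- x in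
      discℤP (con (ℤ.- (+ 1))) (con -[1+ 0 ] :- con -[1+ 1 ] :* (con -[1+ 1 ] :+ b)) b ⊜ hornerP cs x) (horner-natural cs (suc x))
      where
      cs : List ℕ
      cs = 473 ∷ 510 ∷ 229 ∷ 48 ∷ 4 ∷ []
    by-n : ∀ n′ → n ≡ n′ → Classified n b c
    by-n n′ n≡n′ with n′ | n≡n′ | small ℤ.∣ n′ ∣ ℤ.∣ k ∣ (trans
      (cong (λ n → ℤ.∣ n ∣ ℕ.* ℤ.∣ k ∣) (sym n≡n′)) (trans (sym (ℤ.abs-* n k)) (cong ℤ.∣_∣ nk≡2)))
    ... | + _      | eq | inj₁ refl = finish eq (solve-c (+ 1) (+ 2) eq refl) (one-family b)
    ... | + _      | eq | inj₂ refl = finish eq (solve-c (+ 2) (+ 1) eq refl) (two-family b)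
    ... | -[1+ 0 ] | eq | inj₁ refl = finish eq (solve-c -[1+ 0 ] -[1+ 1 ] eq refl) λ disc<0 → ⊥-elim (minus-one-family b disc<0)
    ... | -[1+ 1 ] | eq | inj₂ refl = finish eq (solve-c -[1+ 1 ] -[1+ 0 ] eq refl) λ disc<0 → ⊥-elim (minus-two-family b disc<0)

  private
    add-one : ∀ {x r} → x ℤ.+ ℤ.- (+ 1) ≡ r → x ≡ r ℤ.+ + 1
    add-one {x} eq = trans (ℤS.identity (x ∷ []) λ x → x ⊜ (x :+ con (ℤ.- (+ 1))) :+ con (+ 1)) (cong (ℤ._+ + 1) eq)

  classify : ∀ n b c → n ≢ + 0 → IsSign (valueℤ (ℤ.- (+ 1)) c b n) → discℤ (ℤ.- (+ 1)) c b ℤ.< + 0 → Classified n b c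
  classify n b c n≢0 (inj₁ f[n]≡1) disc<0 = classify-divisor n b c
    (add-one f[n]≡1) disc<0
  classify n b c n≢0 (inj₂ f[n]≡-1) disc<0 =
    subst₂ (Classified n) (sym b-eq) (sym c-eq) (classify-pair n m n≢0 (subst₂ (λ c b → discℤ (ℤ.- (+ 1)) c b ℤ.< + 0) c-eq b-eq disc<0))
    where
    -- The third root of f + 1, whose other roots are 0 and n and whose sum of roots is -b.
    m : ℤ
    m = ℤ.- (n ℤ.+ b)
    b-eq : b ≡ ℤ.- (n ℤ.+ m)
    b-eq = ℤS.identity (n ∷ b ∷ []) λ n b → b ⊜ :- (n :+ (:- (n :+ b)))
    k≡0 : n ℤ.* (n ℤ.+ b) ℤ.+ c ≡ + 0
    k≡0 with ℤ.i*j≡0⇒i≡0∨j≡0 n (add-one f[n]≡-1)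
    ... | inj₁ n≡0 = ⊥-elim (n≢0 n≡0)
    ... | inj₂ eq  = eq
    c-eq : c ≡ n ℤ.* m
    c-eq = trans (difference n b c) (trans (cong (ℤ._- n ℤ.* (n ℤ.+ b)) k≡0)
      (ℤS.identity (n ∷ b ∷ []) λ n b → con (+ 0) :- n :* (n :+ b) ⊜ n :* (:- (n :+ b))))

-- The sporadic solutions

module Hom {F K : Cubic} (φ : RingHom F K) where
  open RingHom φ
  open ≡-Reasoning
  private
    module SF = KS F
    module SK = KS K

  map-zero : map zero ≡ zero
  map-zero = begin
    map zero
      ≡⟨ SK.identity (map zero ∷ []) (λ z → z SK.⊜ (z SK.:+ z) SK.:- z) ⟩
    add (add (map zero) (map zero)) (neg (map zero))
      ≡⟨ cong (λ u → add u (neg (map zero))) (map-add zero zero) ⟨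
    add (map zero) (neg (map zero))
      ≡⟨ SK.identity (map zero ∷ []) (λ z → z SK.:- z SK.⊜ SK.con (+ 0)) ⟩
    zero ∎

  map-neg : ∀ x → map (neg x) ≡ neg (map x)
  map-neg x = begin
    map (neg x)
      ≡⟨ SK.identity (map (neg x) ∷ map x ∷ []) (λ y x → y SK.⊜ (y SK.:+ x) SK.:- x) ⟩
    add (add (map (neg x)) (map x)) (neg (map x))
      ≡⟨ cong (λ u → add u (neg (map x))) (trans (sym (map-add (neg x) x))
           (trans (cong map (SF.identity (x ∷ []) λ x → SF.:- x SF.:+ x SF.⊜ SF.con (+ 0))) map-zero)) ⟩
    add zero (neg (map x))
      ≡⟨ SK.identity (map x ∷ []) (λ x → SK.con (+ 0) SK.:- x SK.⊜ SK.:- x) ⟩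
    neg (map x) ∎

  map-fromℕ : ∀ n → map (fromℤ (+ n)) ≡ fromℤ (+ n)
  map-fromℕ 0       = map-zero
  map-fromℕ (suc n) = begin
    map (fromℤ (+ suc n))                   ≡⟨ cong (λ q → map (fromℚ q)) (/1-+ (+ 1) (+ n)) ⟩
    map (add one (fromℤ (+ n)))             ≡⟨ map-add one (fromℤ (+ n)) ⟩
    add (map one) (map (fromℤ (+ n)))       ≡⟨ cong₂ add map-one (map-fromℕ n) ⟩
    add one (fromℤ (+ n))                   ≡⟨ cong fromℚ (/1-+ (+ 1) (+ n)) ⟨
    fromℤ (+ suc n)                         ∎

  map-fromℤ : ∀ z → map (fromℤ z) ≡ fromℤ z
  map-fromℤ (+ n)    = map-fromℕ n
  map-fromℤ -[1+ n ] = begin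
    map (fromℤ -[1+ n ])          ≡⟨ cong (λ q → map (fromℚ q)) (/1-neg (+ suc n)) ⟩
    map (neg (fromℤ (+ suc n)))   ≡⟨ map-neg (fromℤ (+ suc n)) ⟩
    neg (map (fromℤ (+ suc n)))   ≡⟨ cong neg (map-fromℕ (suc n)) ⟩
    neg (fromℤ (+ suc n))         ≡⟨ cong fromℚ (/1-neg (+ suc n)) ⟨
    fromℤ -[1+ n ]                ∎

  -- `RingHom` does not ask for ℚ-linearity. Additivity and `map-one` fix ℤ, and multiplying by the
  -- denominator of q and then by its inverse extends this to ℚ.
  map-fromℚ : ∀ q → map (fromℚ q) ≡ fromℚ q
  map-fromℚ q = begin
    map (fromℚ q)
      ≡⟨ unscale K (map (fromℚ q)) ⟩
    mul K (fromℚ i) (mul K (fromℤ d) (map (fromℚ q)))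
      ≡⟨ cong (mul K (fromℚ i)) (begin
           mul K (fromℤ d) (map (fromℚ q))         ≡⟨ cong (λ u → mul K u (map (fromℚ q))) (map-fromℤ d) ⟨
           mul K (map (fromℤ d)) (map (fromℚ q))   ≡⟨ map-mul (fromℤ d) (fromℚ q) ⟨
           map (mul F (fromℤ d) (fromℚ q))         ≡⟨ cong map (fromℚ-* F (d /1) q) ⟨
           map (fromℚ (d /1 * q))                  ≡⟨ cong (λ q → map (fromℚ q)) (*-↧ q) ⟩
           map (fromℤ (↥ q))                       ≡⟨ map-fromℤ (↥ q) ⟩
           fromℤ (↥ q)                             ≡⟨ cong fromℚ (*-↧ q) ⟨
           fromℚ (d /1 * q)                        ≡⟨ fromℚ-* K (d /1) q ⟩
           mul K (fromℤ d) (fromℚ q)               ∎) ⟩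
    mul K (fromℚ i) (mul K (fromℤ d) (fromℚ q))
      ≡⟨ unscale K (fromℚ q) ⟨
    fromℚ q ∎
    where
    d : ℤ
    d = ↧ q
    d≢0 : d /1 ≢ 0ℚ
    d≢0 eq = nonzero q (/1-injective d (+ 0) eq)
      where
      nonzero : ∀ q → ↧ q ≢ + 0
      nonzero record{} ()
    i : ℚ
    i = inv d≢0
    unscale : ∀ K x → x ≡ mul K (fromℚ i) (mul K (fromℤ d) x)
    unscale K x = begin
      x                                       ≡⟨ mul-identityˡ K x ⟨
      mul K one x                             ≡⟨ cong (λ q → mul K (fromℚ q) x) (trans (ℚ.*-comm i (d /1)) (*-inv d≢0)) ⟨
      mul K (fromℚ (i * d /1)) x              ≡⟨ cong (λ u → mul K u x) (fromℚ-* K i (d /1)) ⟩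
      mul K (mul K (fromℚ i) (fromℤ d)) x     ≡⟨ mul-assoc K (fromℚ i) (fromℤ d) x ⟩
      mul K (fromℚ i) (mul K (fromℤ d) x)     ∎

  map-evalCubic : ∀ G x → map (evalCubic F G x) ≡ evalCubic K G (map x)
  map-evalCubic (cubic c₀ c₁ c₂) x =
    trans (plus _ c₀) (cong (λ u → add u (fromℚ c₀)) (times (trans (plus _ c₁) (cong (λ u → add u (fromℚ c₁)) (times (plus x c₂))))))
    where
    plus : ∀ y c → map (add y (fromℚ c)) ≡ add (map y) (fromℚ c)
    plus y c = trans (map-add y (fromℚ c)) (cong (add (map y)) (map-fromℚ c))
    times : ∀ {y z} → map y ≡ z → map (mul F x y) ≡ mul K (map x) z
    times {y} refl = map-mul x y

iso-id : ∀ K → RingIso K K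
iso-id K = record
  { hom = record { map = λ x → x ; map-one = refl ; map-add = λ _ _ → refl ; map-mul = λ _ _ → refl }
  ; inj = λ eq → eq
  ; surj = λ y → y , λ eq → eq }

iso-comp : ∀ {F G H} → RingIso G H → RingIso F G → RingIso F H
iso-comp ψ φ = record
  { hom = record
    { map = λ x → Ψ.map (Φ.map x)
    ; map-one = trans (cong Ψ.map Φ.map-one) Ψ.map-one
    ; map-add = λ x y → trans (cong Ψ.map (Φ.map-add x y)) (Ψ.map-add (Φ.map x) (Φ.map y))
    ; map-mul = λ x y → trans (cong Ψ.map (Φ.map-mul x y)) (Ψ.map-mul (Φ.map x) (Φ.map y)) }
  ; inj = λ eq → Φ.inj (Ψ.inj eq)
  ; surj = λ z → let (y , y-eq) = Ψ.surj z ; (x , x-eq) = Φ.surj y in x , λ eq → y-eq (x-eq eq) }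
  where
  module Ψ = RingIso ψ
  module Φ = RingIso φ

-- Equivalent without the automorphism, which can be absorbed into the embedding of the model field.
_∼_ : Elt × Elt → Elt × Elt → Set
(ε , δ) ∼ (x , y) = (ε ≡± x × δ ≡± y) ⊎ (ε ≡± y × δ ≡± x)

Sporadic : Cubic → List (Elt × Elt × ℤ) → Cubic → Elt → Elt → Set
Sporadic F sols K ε δ = Σ (RingIso F K) λ φ → ∃[ x ] ∃[ y ] ∃[ m ]
  (x , y , m) ∈ sols × (ε , δ) ∼ (RingIso.map φ x , RingIso.map φ y)

Sporadic₃ : Cubic → Elt → Elt → Set
Sporadic₃ K ε δ = Sporadic (L j1) sporadicLm1 K ε δ ⊎ Sporadic (L i1) sporadicL1 K ε δ ⊎ Sporadic M sporadicM K ε δ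

Sporadic-map : ∀ F sols {G K} (ψ : RingIso G K) ε δ →
               Sporadic F sols G ε δ → Sporadic F sols K (RingIso.map ψ ε) (RingIso.map ψ δ)
Sporadic-map F sols ψ ε δ (φ , x , y , m , ∈sols , rel) = iso-comp ψ φ , x , y , m , ∈sols ,
  Sum.map (λ (p , q) → signed _ _ p , signed _ _ q) (λ (p , q) → signed _ _ p , signed _ _ q) rel
  where
  signed : ∀ a b → a ≡± b → RingIso.map ψ a ≡± RingIso.map ψ b
  signed a b (inj₁ eq) = inj₁ (cong (RingIso.map ψ) eq)
  signed a b (inj₂ eq) = inj₂ (trans (cong (RingIso.map ψ) eq) (Hom.map-neg (RingIso.hom ψ) b))

Model : ℤ × ℤ × ℤ → Cubic
Model (n , b , c) = ℤcubic (ℤ.- (+ 1)) c b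

-- w is a root in ℚ[X]/(X³ + bX² + cX − 1) of the polynomial that defines the sporadic field.
data Certificate (t : ℤ × ℤ × ℤ) : Set where
  inLm1 : ∀ w {_ : False (Δ (Model t) w ℚ.≟ 0ℚ)} → evalCubic (Model t) (L j1) w ≡ zero →
          ∀ {x y m} → (x , y , m) ∈ sporadicLm1 →
          (θ , add (neg θ) (fromℤ (proj₁ t))) ∼ (eval (Model t) w x , eval (Model t) w y) → Certificate t
  inL1  : ∀ w {_ : False (Δ (Model t) w ℚ.≟ 0ℚ)} → evalCubic (Model t) (L i1) w ≡ zero →
          ∀ {x y m} → (x , y , m) ∈ sporadicL1 →
          (θ , add (neg θ) (fromℤ (proj₁ t))) ∼ (eval (Model t) w x , eval (Model t) w y) → Certificate t
  inM   : ∀ w {_ : False (Δ (Model t) w ℚ.≟ 0ℚ)} → evalCubic (Model t) M w ≡ zero →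
          ∀ {x y m} → (x , y , m) ∈ sporadicM →
          (θ , add (neg θ) (fromℤ (proj₁ t))) ∼ (eval (Model t) w x , eval (Model t) w y) → Certificate t

certificate⇒sporadic : ∀ {t} → Certificate t → Sporadic₃ (Model t) θ (add (neg θ) (fromℤ (proj₁ t)))
certificate⇒sporadic {t} (inLm1 w {Δ≢0} root ∈sols rel) =
  inj₁ (evalIso (Model t) (L j1) w (toWitnessFalse Δ≢0) root , _ , _ , _ , ∈sols , rel)
certificate⇒sporadic {t} (inL1 w {Δ≢0} root ∈sols rel) =
  inj₂ (inj₁ (evalIso (Model t) (L i1) w (toWitnessFalse Δ≢0) root , _ , _ , _ , ∈sols , rel))
certificate⇒sporadic {t} (inM w {Δ≢0} root ∈sols rel) =
  inj₂ (inj₂ (evalIso (Model t) M w (toWitnessFalse Δ≢0) root , _ , _ , _ , ∈sols , rel))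

-- Each w inverts the expression of a listed unit in ω, so that ω is written in terms of θ. The
-- inner `inj₂` appear exactly where n < 0, as the listed solutions have positive sums; the outer
-- one marks the exchanged order.
certificates : All Certificate exceptions
certificates =
  inLm1 (e (+ 0) (+ 1) (+ 0)) refl (here refl) (inj₁ (inj₁ refl , inj₁ refl)) ∷
  inL1 (e (+ 1) (+ 0) (+ 1)) refl (there (here refl)) (inj₁ (inj₁ refl , inj₁ refl)) ∷
  inLm1 (e -[1+ 0 ] (+ 0) (+ 1)) refl (there (there (here refl))) (inj₁ (inj₁ refl , inj₁ refl)) ∷
  inLm1 (e (+ 1) -[1+ 0 ] (+ 1)) refl (there (here refl)) (inj₁ (inj₁ refl , inj₁ refl)) ∷
  inLm1 (e (+ 1) -[1+ 0 ] (+ 1)) refl (there (here refl)) (inj₂ (inj₁ refl , inj₁ refl)) ∷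
  inL1 (e (+ 2) -[1+ 1 ] (+ 1)) refl (there (here refl)) (inj₂ (inj₁ refl , inj₁ refl)) ∷
  inLm1 (e (+ 0) -[1+ 1 ] (+ 1)) refl (there (there (there (here refl)))) (inj₂ (inj₁ refl , inj₁ refl)) ∷
  inLm1 (e (+ 1) -[1+ 0 ] (+ 0)) refl (here refl) (inj₂ (inj₁ refl , inj₁ refl)) ∷
  inL1 (e (+ 1) -[1+ 2 ] (+ 1)) refl (here refl) (inj₂ (inj₁ refl , inj₁ refl)) ∷
  inLm1 (e -[1+ 2 ] (+ 5) -[1+ 0 ]) refl (there (there (there (there (here refl))))) (inj₁ (inj₁ refl , inj₁ refl)) ∷
  inM (e (+ 0) (+ 1) (+ 0)) refl (here refl) (inj₁ (inj₁ refl , inj₁ refl)) ∷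
  inL1 (e -[1+ 0 ] -[1+ 0 ] (+ 1)) refl (there (there (here refl))) (inj₁ (inj₁ refl , inj₁ refl)) ∷
  inLm1 (e -[1+ 0 ] (+ 1) (+ 0)) refl (there (there (there (there (there (here refl)))))) (inj₁ (inj₁ refl , inj₁ refl)) ∷
  inLm1 (e (+ 0) -[1+ 1 ] (+ 1)) refl (there (there (there (there (there (there (here refl))))))) (inj₁ (inj₁ refl , inj₁ refl)) ∷
  inLm1 (e (+ 1) -[1+ 0 ] (+ 0)) refl (there (there (there (there (there (here refl)))))) (inj₂ (inj₁ refl , inj₁ refl)) ∷
  inM (e (+ 2) -[1+ 0 ] (+ 0)) refl (here refl) (inj₂ (inj₁ refl , inj₁ refl)) ∷
  inLm1 (e (+ 1) (+ 3) -[1+ 0 ]) refl (there (there (there (there (there (there (there (here refl)))))))) (inj₁ (inj₁ refl , inj₁ refl)) ∷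
  inL1 (e (+ 1) -[1+ 2 ] (+ 1)) refl (there (there (there (here refl)))) (inj₁ (inj₁ refl , inj₁ refl)) ∷
  inLm1 (e -[1+ 2 ] (+ 5) -[1+ 0 ]) refl (there (there (there (there (there (there (there (there (here refl))))))))) (inj₁ (inj₁ refl , inj₁ refl)) ∷
  inLm1 (e (+ 0) (+ 2) (+ 1)) refl (there (there (here refl))) (inj₂ (inj₂ refl , inj₂ refl)) ∷
  inLm1 (e -[1+ 0 ] (+ 0) (+ 1)) refl (there (there (there (here refl)))) (inj₁ (inj₂ refl , inj₂ refl)) ∷
  inL1 (e -[1+ 0 ] -[1+ 0 ] (+ 1)) refl (here refl) (inj₁ (inj₂ refl , inj₂ refl)) ∷
  inLm1 (e (+ 1) (+ 3) -[1+ 0 ]) refl (there (there (there (there (here refl))))) (inj₂ (inj₂ refl , inj₂ refl)) ∷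
  inL1 (e (+ 1) (+ 3) (+ 1)) refl (there (there (here refl))) (inj₂ (inj₂ refl , inj₂ refl)) ∷
  inLm1 (e (+ 0) (+ 2) (+ 1)) refl (there (there (there (there (there (there (here refl))))))) (inj₂ (inj₂ refl , inj₂ refl)) ∷
  inLm1 (e (+ 1) -[1+ 2 ] -[1+ 0 ]) refl (there (there (there (there (there (there (there (here refl)))))))) (inj₂ (inj₂ refl , inj₂ refl)) ∷
  inL1 (e (+ 1) (+ 3) (+ 1)) refl (there (there (there (here refl)))) (inj₂ (inj₂ refl , inj₂ refl)) ∷
  inLm1 (e (+ 1) -[1+ 2 ] -[1+ 0 ]) refl (there (there (there (there (there (there (there (there (here refl))))))))) (inj₂ (inj₂ refl , inj₂ refl)) ∷
  []

exceptional-sporadic : ∀ {n b c} → (n , b , c) ∈ exceptions →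
                       Sporadic₃ (ℤcubic (ℤ.- (+ 1)) c b) θ (add (neg θ) (fromℤ n))
exceptional-sporadic ∈exceptions = certificate⇒sporadic (All.lookup certificates ∈exceptions)

-- Existence of a case

neg-involutive : ∀ x → neg (neg x) ≡ x
neg-involutive (x₀ , x₁ , x₂) = triple (twice x₀) (twice x₁) (twice x₂)
  where
  twice : ∀ q → - (- q) ≡ q
  twice q = ℚS.identity (q ∷ []) λ q → ℚS.:- (ℚS.:- q) ℚS.⊜ q

neg-rational : ∀ x → Rational (neg x) → Rational x
neg-rational x (q , eq) = - q , trans (sym (neg-involutive x)) (cong neg eq)

≡±-neg : ∀ x y → neg x ≡± y → x ≡± y
≡±-neg x y (inj₁ eq) = inj₂ (trans (sym (neg-involutive x)) (cong neg eq))
≡±-neg x y (inj₂ eq) = inj₁ (trans (sym (neg-involutive x)) (trans (cong neg eq) (neg-involutive y)))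

∼-neg : ∀ ε δ x y → (neg ε , neg δ) ∼ (x , y) → (ε , δ) ∼ (x , y)
∼-neg ε δ x y = Sum.map (λ (p , q) → ≡±-neg ε x p , ≡±-neg δ y q) (λ (p , q) → ≡±-neg ε y p , ≡±-neg δ x q)

complement : Elt → ℤ → Elt
complement x n = add (neg x) (fromℤ n)

complement-unique : ∀ x y n → add x y ≡ fromℤ n → y ≡ complement x n
complement-unique (x₀ , x₁ , x₂) (y₀ , y₁ , y₂) n eq = trans
  (triple (cancel x₀ y₀) (cancel x₁ y₁) (cancel x₂ y₂)) (cong (add (neg (x₀ , x₁ , x₂))) eq)
  where
  cancel : ∀ x y → y ≡ - x + (x + y)
  cancel x y = ℚS.identity (x ∷ y ∷ []) λ x y → y ℚS.⊜ ℚS.:- x ⊕ (x ⊕ y)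

complement-irrational : ∀ x n → ¬ Rational x → ¬ Rational (complement x n)
complement-irrational x n irrational (q , eq) = irrational (- q + n /1 , trans
  (involutive x) (cong (λ y → complement y n) eq))
  where
  involutive : ∀ x → x ≡ complement (complement x n) n
  involutive (x₀ , x₁ , x₂) = triple (twice x₀ (n /1)) (twice x₁ 0ℚ) (twice x₂ 0ℚ)
    where
    twice : ∀ x n → x ≡ - (- x + n) + n
    twice x n = ℚS.identity (x ∷ n ∷ []) λ x n → x ℚS.⊜ ℚS.:- (ℚS.:- x ⊕ n) ⊕ n

module _ (K : Cubic) where
  open KS K

  root-neg : ∀ c₀ c₁ c₂ x → evalCubic K (cubic c₀ c₁ c₂) x ≡ zero →
             evalCubic K (cubic (- c₀) c₁ (- c₂)) (neg x) ≡ zero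
  root-neg c₀ c₁ c₂ x root = trans
    (identity (fromℚ c₀ ∷ fromℚ c₁ ∷ fromℚ c₂ ∷ x ∷ []) λ c₀ c₁ c₂ x →
      :- x :* (:- x :* (:- x :+ :- c₂) :+ c₁) :+ :- c₀ ⊜ :- (x :* (x :* (x :+ c₂) :+ c₁) :+ c₀))
    (cong neg root)

  root-of-L : ∀ n x → evalCubic K (ℤcubic (ℤ.- (+ 1)) (+ 0) (ℤ.- n)) x ≡ zero → evalCubic K (L n) x ≡ zero
  root-of-L n x root = trans (cong (λ c → evalCubic K (cubic (- 1ℚ) 0ℚ c) x) (sym (/1-neg n))) root

  -- The complement δ of a root ε of X(X − n)² − 1 is the negative of a root of X³ + nX² − 1.
  root-of-L′ : ∀ n x → evalCubic K (ℤcubic (ℤ.- (+ 1)) (n ℤ.* n) (ℤ.- (n ℤ.+ n))) x ≡ zero →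
               evalCubic K (L (ℤ.- n)) (neg (complement x n)) ≡ zero
  root-of-L′ n x root = begin
    evalCubic K (L (ℤ.- n)) (neg (complement x n))
      ≡⟨ cong (λ c → evalCubic K (cubic (- 1ℚ) 0ℚ c) (neg (complement x n)))
           (trans (cong -_ (/1-neg n)) (ℚS.identity (n /1 ∷ []) λ n → ℚS.:- (ℚS.:- n) ℚS.⊜ n)) ⟩
    evalCubic K (cubic (- 1ℚ) 0ℚ (n /1)) (neg (complement x n))
      ≡⟨ (identity (fromℤ n ∷ x ∷ []) λ n x → let y = :- (:- x :+ n) in
           y :* (y :* (y :+ n) :+ con (+ 0)) :+ con (ℤ.- (+ 1))
             ⊜ x :* (x :* (x :+ (:- (n :+ n))) :+ n :* n) :+ con (ℤ.- (+ 1))) ⟩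
    add (mul K x (add (mul K x (add x (neg (add (fromℤ n) (fromℤ n))))) (mul K (fromℤ n) (fromℤ n)))) (fromℤ (ℤ.- (+ 1)))
      ≡⟨ cong₂ (λ s t → add (mul K x (add (mul K x (add x s)) t)) (fromℤ (ℤ.- (+ 1))))
           (trans (cong neg (sym (cong fromℚ (/1-+ n n)))) (sym (cong fromℚ (/1-neg (n ℤ.+ n))))) (sym (fromℤ-* K n n)) ⟩
    evalCubic K (ℤcubic (ℤ.- (+ 1)) (n ℤ.* n) (ℤ.- (n ℤ.+ n))) x
      ≡⟨ root ⟩
    zero ∎
    where open ≡-Reasoning

  eval-complement : ∀ x n → eval K x (complement θ n) ≡ complement x n
  eval-complement x n = trans
    (cong (λ u → add (fromℚ u) (mul K x (add (fromℚ (- 1ℚ)) (mul K x zero)))) (ℚ.+-identityˡ (n /1)))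
    (identity (x ∷ fromℤ n ∷ []) λ x n → n :+ x :* (con (ℤ.- (+ 1)) :+ x :* con (+ 0)) ⊜ :- x :+ n)

-- The discriminant of X³ - nX² - 1 is -4n³ - 27. This is the origin of the condition a ≥ -1.
first-bound : ∀ n → discℤ (ℤ.- (+ 1)) (+ 0) (ℤ.- n) ℤ.< + 0 → j1 ℤ.≤ n
first-bound (+ n) _ = ℤ.-≤+
first-bound -[1+ 0 ] _ = ℤ.-≤- z≤n
first-bound -[1+ suc k ] disc<0 = ⊥-elim (natural≮0 (ℤS.identity (+ k ∷ []) λ k →
  discℤP (con (ℤ.- (+ 1))) (con (+ 0)) (con (+ 2) :+ k) ⊜ hornerP cs k) (horner-natural cs k) disc<0)
  where
  open ℤS
  cs : List ℕ
  cs = 5 ∷ 48 ∷ 24 ∷ 4 ∷ []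

-- X(X - n)² - 1 has the discriminant of X³ + nX² - 1, which is 4n³ - 27; hence the same
-- coefficients as in `first-bound`.
second-bound : ∀ n → discℤ (ℤ.- (+ 1)) (n ℤ.* n) (ℤ.- (n ℤ.+ n)) ℤ.< + 0 → j1 ℤ.≤ ℤ.- n
second-bound (+ 0) _ = ℤ.-≤+
second-bound (+ 1) _ = ℤ.-≤- z≤n
second-bound -[1+ n ] _ = ℤ.-≤+
second-bound (+ suc (suc k)) disc<0 = ⊥-elim (natural≮0 (ℤS.identity (+ k ∷ []) λ k → let n = con (+ 2) :+ k in
  discℤP (con (ℤ.- (+ 1))) (n :* n) (:- (n :+ n)) ⊜ hornerP cs k) (horner-natural cs k) disc<0)
  where
  open ℤS
  cs : List ℕ
  cs = 5 ∷ 48 ∷ 24 ∷ 4 ∷ []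

sporadic⇒Case3 : ∀ K ε δ → Sporadic₃ K ε δ → Case3 K ε δ
sporadic⇒Case3 K ε δ = Sum.map (embed (L j1) sporadicLm1) (Sum.map (embed (L i1) sporadicL1) (embed M sporadicM))
  where
  embed : ∀ F sols → Sporadic F sols K ε δ → SporadicIn F sols K ε δ
  embed F sols (φ , x , y , m , ∈sols , rel) = φ , x , y , m , ∈sols , iso-id K , rel

-- The isomorphism onto K can be built so that it meets ε or -δ itself, so the automorphism in the
-- conclusion is taken to be the identity.
classified⇒case : ∀ K ε n b c → n ≢ + 0 → Δ K ε ≢ 0ℚ → evalCubic K (ℤcubic (ℤ.- (+ 1)) c b) ε ≡ zero →
  discℤ (ℤ.- (+ 1)) c b ℤ.< + 0 → Classified n b c →
  Case2 K n ε (complement ε n) ⊎ Case3 K ε (complement ε n)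
classified⇒case K ε n b c n≢0 Δ≢0 root disc<0 (first refl refl) =
  inj₁ (n , n≢0 , first-bound n disc<0 , φ , inj₁ refl , iso-id K ,
        inj₁ (inj₁ (sym (eval-θ K ε)) , inj₁ (sym (eval-complement K ε n))))
  where
  φ : RingIso (L n) K
  φ = evalIso K (L n) ε Δ≢0 (root-of-L K n ε root)
-- The generator is now -δ with a = -n, so the two units appear in exchanged order and both with a
-- minus sign.
classified⇒case K ε n b c n≢0 Δ≢0 root disc<0 (second refl refl) =
  inj₁ (ℤ.- n , (λ -n≡0 → n≢0 (ℤ.neg-injective -n≡0)) , second-bound n disc<0 , φ , inj₂ (sym (ℤ.neg-involutive n)) ,
        iso-id K , inj₂ (inj₂ ε-eq , inj₂ δ-eq))
  where
  open ≡-Reasoning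
  δ ω : Elt
  δ = complement ε n
  ω = neg δ
  Δω≢0 : Δ K ω ≢ 0ℚ
  Δω≢0 Δω≡0 = Δ≢0 (trans (sym (Δ-reflect K ε (n /1))) Δω≡0)
    where
    Δ-reflect : ∀ K x q → Δ K (neg (add (neg x) (fromℚ q))) ≡ Δ K x
    Δ-reflect (cubic c₀ c₁ c₂) (x₀ , x₁ , x₂) q =
      ℚS.identity (c₀ ∷ c₁ ∷ c₂ ∷ x₀ ∷ x₁ ∷ x₂ ∷ q ∷ []) λ c₀ c₁ c₂ x₀ x₁ x₂ q →
        ΔP (c₀ , c₁ , c₂) (:- (:- x₀ ⊕ q) , :- (:- x₁ ⊕ con (+ 0)) , :- (:- x₂ ⊕ con (+ 0))) ℚS.⊜ ΔP (c₀ , c₁ , c₂) (x₀ , x₁ , x₂)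
      where open ℚS using (:-_; con)
  φ : RingIso (L (ℤ.- n)) K
  φ = evalIso K (L (ℤ.- n)) ω Δω≢0 (root-of-L′ K n ε root)
  ε-eq : ε ≡ neg (RingIso.map φ (complement θ (ℤ.- n)))
  ε-eq = sym (begin
    neg (eval K ω (complement θ (ℤ.- n)))          ≡⟨ cong neg (eval-complement K ω (ℤ.- n)) ⟩
    neg (add (neg ω) (fromℤ (ℤ.- n)))              ≡⟨ cong (λ q → neg (add (neg ω) (fromℚ q))) (/1-neg n) ⟩
    neg (add (neg (neg δ)) (neg (fromℤ n)))        ≡⟨ KS.identity K (ε ∷ fromℤ n ∷ []) (λ ε n →
                                                        :- (:- (:- (:- ε :+ n)) :+ :- n) ⊜ ε) ⟩
    ε                                              ∎)
    where open KS K using (:-_; _:+_; _⊜_)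
  δ-eq : δ ≡ neg (RingIso.map φ θ)
  δ-eq = sym (trans (cong neg (eval-θ K ω)) (neg-involutive δ))
classified⇒case K ε n b c n≢0 Δ≢0 root disc<0 (exceptional ∈exceptions) =
  inj₂ (sporadic⇒Case3 K ε (complement ε n)
    (subst₂ (Sporadic₃ K) (eval-θ K ε) (eval-complement K ε n)
      (Sum.map (Sporadic-map _ _ ψ θ (complement θ n)) (Sum.map (Sporadic-map _ _ ψ θ (complement θ n)) (Sporadic-map _ _ ψ θ (complement θ n)))
        (exceptional-sporadic ∈exceptions))))
  where
  ψ : RingIso (ℤcubic (ℤ.- (+ 1)) c b) K
  ψ = evalIso K (ℤcubic (ℤ.- (+ 1)) c b) ε Δ≢0 root

module _ (K : Cubic) (field-K : IsField K) (disc<0 : disc K ℚ.< 0ℚ) where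

  norm-one-case : ∀ ε n b c → ¬ Rational ε → n ≢ + 0 → char K ε ≡ ℤcubic (ℤ.- (+ 1)) c b →
    IsSign (valueℤ (ℤ.- (+ 1)) c b n) → Case2 K n ε (complement ε n) ⊎ Case3 K ε (complement ε n)
  norm-one-case ε n b c irrational n≢0 char≡ sign =
    classified⇒case K ε n b c n≢0 Δε≢0 (trans (cong (λ F → evalCubic K F ε) (sym char≡)) (cayley-hamilton K ε))
      discℤ<0 (classify n b c n≢0 sign discℤ<0)
    where
    Δε≢0 : Δ K ε ≢ 0ℚ
    Δε≢0 = Δ≢0 K field-K ε irrational
    discℤ<0 : discℤ (ℤ.- (+ 1)) c b ℤ.< + 0
    discℤ<0 = /1-cancel-<0 (discℤ (ℤ.- (+ 1)) c b)
      (subst (ℚ._< 0ℚ) (trans (cong disc char≡) (disc-/1 (ℤ.- (+ 1)) c b)) (disc-char-negative K ε disc<0 Δε≢0))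

  Case2-neg : ∀ n ε δ → Case2 K (ℤ.- n) (neg ε) (neg δ) → Case2 K n ε δ
  Case2-neg n ε δ (a , a≢0 , -1≤a , φ , n≡±a , σ , rel) =
    a , a≢0 , -1≤a , φ , flip n≡±a , σ , ∼-neg ε δ (s (RingIso.map φ θ)) (s (RingIso.map φ (complement θ a))) rel
    where
    s : Elt → Elt
    s = RingIso.map σ
    flip : ℤ.- n ≡ a ⊎ ℤ.- n ≡ ℤ.- a → n ≡ a ⊎ n ≡ ℤ.- a
    flip (inj₁ eq) = inj₂ (trans (sym (ℤ.neg-involutive n)) (cong ℤ.-_ eq))
    flip (inj₂ eq) = inj₁ (ℤ.neg-injective eq)

  Case3-neg : ∀ ε δ → Case3 K (neg ε) (neg δ) → Case3 K ε δ
  Case3-neg ε δ = Sum.map flip (Sum.map flip flip)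
    where
    flip : ∀ {F sols} → SporadicIn F sols K (neg ε) (neg δ) → SporadicIn F sols K ε δ
    flip (φ , x , y , m , ∈sols , σ , rel) =
      φ , x , y , m , ∈sols , σ , ∼-neg ε δ (RingIso.map σ (RingIso.map φ x)) (RingIso.map σ (RingIso.map φ y)) rel

  IsSign-neg : ∀ {s} → IsSign s → IsSign (ℤ.- s)
  IsSign-neg (inj₁ refl) = inj₂ refl
  IsSign-neg (inj₂ refl) = inj₁ refl

  irrational-case : ∀ ε n → ¬ Rational ε → n ≢ + 0 → IsUnit K ε → IsUnit K (complement ε n) →
    Case2 K n ε (complement ε n) ⊎ Case3 K ε (complement ε n)
  irrational-case ε n irrational n≢0 ε-unit δ-unit =
    let (c₀ , c₁ , c₂ , c₀-sign , c-eq) = unit-char K field-K ε irrational ε-unit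
        (d₀ , d₁ , d₂ , d₀-sign , d-eq) = unit-char K field-K (complement ε n) (complement-irrational ε n irrational) δ-unit
    in by-norm c₀ c₁ c₂ c₀-sign c-eq (subst IsSign
         (trans (cong ℤ.-_ (constant c₀ c₁ c₂ d₀ c-eq (cong Cubic.c₀ d-eq))) (ℤ.neg-involutive (valueℤ c₀ c₁ c₂ n))) (IsSign-neg d₀-sign))
    where
    open ≡-Reasoning
    constant : ∀ c₀ c₁ c₂ d₀ → char K ε ≡ ℤcubic c₀ c₁ c₂ → Cubic.c₀ (char K (complement ε n)) ≡ d₀ /1 →
               d₀ ≡ ℤ.- valueℤ c₀ c₁ c₂ n
    constant c₀ c₁ c₂ d₀ c-eq d-eq = /1-injective d₀ (ℤ.- valueℤ c₀ c₁ c₂ n) (begin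
      d₀ /1                                    ≡⟨ d-eq ⟨
      Cubic.c₀ (char K (complement ε n))       ≡⟨ char-reflect K (n /1) ε ⟩
      - value (char K ε) (n /1)                ≡⟨ cong (λ F → - value F (n /1)) c-eq ⟩
      - value (ℤcubic c₀ c₁ c₂) (n /1)         ≡⟨ cong -_ (value-/1 c₀ c₁ c₂ n) ⟩
      - (valueℤ c₀ c₁ c₂ n /1)                 ≡⟨ /1-neg (valueℤ c₀ c₁ c₂ n) ⟨
      (ℤ.- valueℤ c₀ c₁ c₂ n) /1               ∎)
    by-norm : ∀ c₀ c₁ c₂ → IsSign c₀ → char K ε ≡ ℤcubic c₀ c₁ c₂ → IsSign (valueℤ c₀ c₁ c₂ n) →
              Case2 K n ε (complement ε n) ⊎ Case3 K ε (complement ε n)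
    by-norm c₀ c₁ c₂ (inj₂ refl) c-eq sign = norm-one-case ε n c₂ c₁ irrational n≢0 c-eq sign
    by-norm c₀ c₁ c₂ (inj₁ refl) c-eq sign =
      Sum.map (λ h → Case2-neg n ε (complement ε n) (subst (Case2 K (ℤ.- n) (neg ε)) complement-neg h))
              (λ h → Case3-neg ε (complement ε n) (subst (Case3 K (neg ε)) complement-neg h))
        (norm-one-case (neg ε) (ℤ.- n) (ℤ.- c₂) c₁ (λ r → irrational (neg-rational ε r)) (λ eq → n≢0 (ℤ.neg-injective eq))
          char-eq (subst IsSign value-eq (IsSign-neg sign)))
      where
      complement-neg : complement (neg ε) (ℤ.- n) ≡ neg (complement ε n)
      complement-neg = trans (cong (λ q → add (neg (neg ε)) (fromℚ q)) (/1-neg n))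
        (KS.identity K (ε ∷ fromℤ n ∷ []) λ ε n → :- (:- ε) :+ :- n ⊜ :- (:- ε :+ n))
        where open KS K using (:-_; _:+_; _⊜_)
      char-eq : char K (neg ε) ≡ ℤcubic (ℤ.- (+ 1)) c₁ (ℤ.- c₂)
      char-eq = trans (char-neg K ε) (trans (cong (λ (cubic d₀ d₁ d₂) → cubic (- d₀) d₁ (- d₂)) c-eq)
        (cong (cubic (- 1ℚ) (c₁ /1)) (sym (/1-neg c₂))))
      value-eq : ℤ.- valueℤ (+ 1) c₁ c₂ n ≡ valueℤ (ℤ.- (+ 1)) c₁ (ℤ.- c₂) (ℤ.- n)
      value-eq = ℤS.identity (c₁ ∷ c₂ ∷ n ∷ []) λ c₁ c₂ n →
        :- (n :* (n :* (n :+ c₂) :+ c₁) :+ con (+ 1)) ⊜ :- n :* (:- n :* (:- n :+ :- c₂) :+ c₁) :+ con (ℤ.- (+ 1))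
        where open ℤS

-- Exclusiveness of the cases

twice-rational : ∀ x q → add x x ≡ fromℚ q → Rational x
twice-rational (x₀ , x₁ , x₂) q eq =
  x₀ , triple refl (halve x₁ (cong (λ u → proj₁ (proj₂ u)) eq)) (halve x₂ (cong (λ u → proj₂ (proj₂ u)) eq))
  where
  halve : ∀ a → a + a ≡ 0ℚ → a ≡ 0ℚ
  halve a a+a≡0 = *-cancel-zero {(+ 2) /1} (λ ())
    (trans (ℚS.identity (a ∷ []) λ a → ℚS.con (+ 2) ⊗ a ℚS.⊜ a ⊕ a) a+a≡0)

-- `Equivalent` chooses the signs of ε and δ independently. For irrational x the rational sum leaves
-- only a common sign, which n then shares.
Aligned : Elt → Elt → ℤ → Elt → ℤ → Set
Aligned ε δ n x m = (ε ≡ x × δ ≡ complement x m × n ≡ m) ⊎ (neg ε ≡ x × neg δ ≡ complement x m × ℤ.- n ≡ m)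

add-neg : ∀ x y → add (neg x) (neg y) ≡ neg (add x y)
add-neg (x₀ , x₁ , x₂) (y₀ , y₁ , y₂) = triple (distrib x₀ y₀) (distrib x₁ y₁) (distrib x₂ y₂)
  where
  distrib : ∀ a b → - a + - b ≡ - (a + b)
  distrib a b = sym (ℚ.neg-distrib-+ a b)

complement-sum : ∀ x m → add x (complement x m) ≡ fromℤ m
complement-sum (x₀ , x₁ , x₂) m = triple (cancel x₀ (m /1)) (cancel x₁ 0ℚ) (cancel x₂ 0ℚ)
  where
  cancel : ∀ x m → x + (- x + m) ≡ m
  cancel x m = ℚS.identity (x ∷ m ∷ []) λ x m → x ⊕ (ℚS.:- x ⊕ m) ℚS.⊜ m

complement-difference : ∀ x m q → add x (neg (complement x m)) ≡ fromℚ q → add x x ≡ fromℚ (q + m /1)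
complement-difference (x₀ , x₁ , x₂) m q eq = trans (triple (shift x₀ (m /1)) (shift x₁ 0ℚ) (shift x₂ 0ℚ))
  (cong (λ u → add u (fromℤ m)) eq)
  where
  shift : ∀ x m → x + x ≡ x + - (- x + m) + m
  shift x m = ℚS.identity (x ∷ m ∷ []) λ x m → x ⊕ x ℚS.⊜ x ⊕ ℚS.:- (ℚS.:- x ⊕ m) ⊕ m

-- Opposite signs would make 2x rational.
align : ∀ ε δ n x m → ¬ Rational x → add ε δ ≡ fromℤ n → ε ≡± x → δ ≡± complement x m → Aligned ε δ n x m
align ε δ n x m irrational sum (inj₁ ε≡x) (inj₁ δ≡y) =
  inj₁ (ε≡x , δ≡y , /1-injective n m (cong proj₁ (trans (sym sum) (trans (cong₂ add ε≡x δ≡y) (complement-sum x m)))))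
align ε δ n x m irrational sum (inj₂ ε≡-x) (inj₂ δ≡-y) =
  inj₂ (-ε≡x , -δ≡y , /1-injective (ℤ.- n) m (trans (/1-neg n) (cong proj₁ (trans (sym (cong neg sum))
    (trans (sym (add-neg ε δ)) (trans (cong₂ add -ε≡x -δ≡y) (complement-sum x m)))))))
  where
  -ε≡x : neg ε ≡ x
  -ε≡x = trans (cong neg ε≡-x) (neg-involutive x)
  -δ≡y : neg δ ≡ complement x m
  -δ≡y = trans (cong neg δ≡-y) (neg-involutive (complement x m))
align ε δ n x m irrational sum (inj₁ ε≡x) (inj₂ δ≡-y) = ⊥-elim (irrational (twice-rational x (n /1 + m /1)
  (complement-difference x m (n /1) (trans (sym (cong₂ add ε≡x δ≡-y)) sum))))
align ε δ n x m irrational sum (inj₂ ε≡-x) (inj₁ δ≡y) = ⊥-elim (irrational (twice-rational x (- (n /1) + m /1)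
  (complement-difference x m (- (n /1)) (begin
    add x (neg (complement x m))     ≡⟨ cong₂ (λ u v → add u (neg v)) (trans (cong neg ε≡-x) (neg-involutive x)) δ≡y ⟨
    add (neg ε) (neg δ)              ≡⟨ add-neg ε δ ⟩
    neg (add ε δ)                    ≡⟨ cong neg sum ⟩
    fromℚ (- (n /1))                 ∎))))
  where open ≡-Reasoning

-- z is a root of X³ − nX² + s for some s.  This holds for ±ω_a with n = ±a, and separates case (2)
-- from case (3).
Special : Cubic → ℤ → Elt → Set
Special K n z = ∃[ s ] evalCubic K (cubic s 0ℚ (- (n /1))) z ≡ zero

Special-neg : ∀ K n z → Special K n z → Special K (ℤ.- n) (neg z)
Special-neg K n z (s , root) = - s ,
  trans (cong (λ c → evalCubic K (cubic (- s) 0ℚ (- c)) (neg z)) (/1-neg n)) (root-neg K s 0ℚ (- (n /1)) z root)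

Special-neg⁻¹ : ∀ K n z → Special K (ℤ.- n) (neg z) → Special K n z
Special-neg⁻¹ K n z h = subst₂ (Special K) (ℤ.neg-involutive n) (neg-involutive z) (Special-neg K (ℤ.- n) (neg z) h)

aligned-special : ∀ K ε δ n x m → Aligned ε δ n x m → Special K m x → Special K n ε
aligned-special K ε δ n x m (inj₁ (refl , _ , refl)) h = h
aligned-special K ε δ n x m (inj₂ (refl , _ , refl)) h = Special-neg⁻¹ K n ε h

special-aligned : ∀ K ε δ n x m → Aligned ε δ n x m →
  (Special K n ε → Special K m x) × (Special K n δ → Special K m (complement x m))
special-aligned K ε δ n x m (inj₁ (refl , refl , refl)) = (λ h → h) , (λ h → h)
special-aligned K ε δ n x m (inj₂ (refl , δ-eq , refl)) =
  Special-neg K n ε , λ h → subst (Special K (ℤ.- n)) δ-eq (Special-neg K n δ h)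

aligned-nonzero : ∀ ε δ n x m → Aligned ε δ n x m → m ≢ + 0 → n ≢ + 0
aligned-nonzero ε δ n x m (inj₁ (_ , _ , refl)) m≢0 = m≢0
aligned-nonzero ε δ n x m (inj₂ (_ , _ , refl)) m≢0 n≡0 = m≢0 (cong ℤ.-_ n≡0)

aligned-irrational : ∀ ε δ n x m → Aligned ε δ n x m → ¬ Rational x → ¬ Rational ε × ¬ Rational δ
aligned-irrational ε δ n x m (inj₁ (refl , refl , _)) irrational = irrational , complement-irrational x m irrational
aligned-irrational ε δ n x m (inj₂ (refl , δ-eq , _)) irrational =
  (λ { (q , refl) → irrational (- q , refl) }) ,
  λ { (q , refl) → complement-irrational x m irrational (- q , sym δ-eq) }

iso-irrational : ∀ {F K} (φ : RingIso F K) x → ¬ Rational x → ¬ Rational (RingIso.map φ x)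
iso-irrational φ x irrational (q , eq) =
  irrational (q , RingIso.inj φ (trans eq (sym (Hom.map-fromℚ (RingIso.hom φ) q))))

iso-complement : ∀ {F K} (φ : RingIso F K) x m → RingIso.map φ (complement x m) ≡ complement (RingIso.map φ x) m
iso-complement φ x m = trans (RingIso.map-add φ (neg x) (fromℤ m))
  (cong₂ add (Hom.map-neg (RingIso.hom φ) x) (Hom.map-fromℤ (RingIso.hom φ) m))

∼-align : ∀ ε δ n x y m → ¬ Rational x → y ≡ complement x m → add ε δ ≡ fromℤ n → (ε , δ) ∼ (x , y) →
          Aligned ε δ n x m ⊎ Aligned δ ε n x m
∼-align ε δ n x y m irrational refl sum (inj₁ (p , q)) = inj₁ (align ε δ n x m irrational sum p q)
∼-align ε δ n x y m irrational refl sum (inj₂ (p , q)) =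
  inj₂ (align δ ε n x m irrational (trans (comm δ ε) sum) q p)
  where
  comm : ∀ a b → add a b ≡ add b a
  comm (a₀ , a₁ , a₂) (b₀ , b₁ , b₂) = triple (ℚ.+-comm a₀ b₀) (ℚ.+-comm a₁ b₁) (ℚ.+-comm a₂ b₂)

θ-irrational : ¬ Rational θ
θ-irrational (q , ())

Case2⇒special : ∀ K n ε δ → add ε δ ≡ fromℤ n → Case2 K n ε δ →
                ¬ Rational ε × n ≢ + 0 × (Special K n ε ⊎ Special K n δ)
Case2⇒special K n ε δ sum (a , a≢0 , _ , φ , _ , σ , rel) =
  conclude (∼-align ε δ n x (ψ.map (complement θ a)) a x-irrational (iso-complement (iso-comp σ φ) θ a) sum rel)
  where
  module ψ = RingIso (iso-comp σ φ)
  x : Elt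
  x = ψ.map θ
  x-irrational : ¬ Rational x
  x-irrational = iso-irrational (iso-comp σ φ) θ θ-irrational
  x-special : Special K a x
  x-special = - 1ℚ , trans (sym (Hom.map-evalCubic ψ.hom (L a) θ)) (trans (cong ψ.map θ-root) (Hom.map-zero ψ.hom))
    where
    θ-root : evalCubic (L a) (L a) θ ≡ zero
    θ-root = identity³ (a /1 ∷ []) λ a → let F = con (ℤ.- (+ 1)) , con (+ 0) , :- a in
      evalCubicP F F (con (+ 0) , con (+ 1) , con (+ 0)) , fromP (con (+ 0))
      where open ℚS using (con; :-_)
  conclude : Aligned ε δ n x a ⊎ Aligned δ ε n x a → ¬ Rational ε × n ≢ + 0 × (Special K n ε ⊎ Special K n δ)
  conclude (inj₁ al) = proj₁ (aligned-irrational ε δ n x a al x-irrational) , aligned-nonzero ε δ n x a al a≢0 ,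
    inj₁ (aligned-special K ε δ n x a al x-special)
  conclude (inj₂ al) = proj₂ (aligned-irrational δ ε n x a al x-irrational) , aligned-nonzero δ ε n x a al a≢0 ,
    inj₂ (aligned-special K δ ε n x a al x-special)

-- The counterpart of `Special` in the model field: it speaks of computed coefficients instead of an
-- unknown s, so that it can be refuted by evaluation for every sporadic unit.
Lacunary : Cubic → Elt → ℤ → Set
Lacunary F x m = Cubic.c₁ (char F x) ≡ 0ℚ × Cubic.c₂ (char F x) ≡ - (m /1)

Generic : Cubic → Elt × Elt × ℤ → Set
Generic F (x , y , m) = y ≡ complement x m × m ≢ + 0 × ¬ Rational x × ¬ Lacunary F x m × ¬ Lacunary F y m

generic? : ∀ F t → Dec (Generic F t)
generic? F (x , y , m) = ≡-dec ℚ._≟_ (≡-dec ℚ._≟_ ℚ._≟_) y (complement x m) ×-dec ¬? (m ℤ.≟ + 0) ×-dec ¬? (rational? x)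
  ×-dec ¬? (lacunary? x) ×-dec ¬? (lacunary? y)
  where
  lacunary? : ∀ x → Dec (Lacunary F x m)
  lacunary? x = (Cubic.c₁ (char F x) ℚ.≟ 0ℚ) ×-dec (Cubic.c₂ (char F x) ℚ.≟ - (m /1))

genericLm1 : All (Generic (L j1)) sporadicLm1
genericLm1 = from-yes (All.all? (generic? (L j1)) sporadicLm1)

genericL1 : All (Generic (L i1)) sporadicL1
genericL1 = from-yes (All.all? (generic? (L i1)) sporadicL1)

genericM : All (Generic M) sporadicM
genericM = from-yes (All.all? (generic? M) sporadicM)

module _ (K : Cubic) (field-K : IsField K) where

  -- Both `char F x` and X³ - mX² + s vanish at the image of x, which is irrational and so satisfies
  -- only one monic cubic.
  special⇒lacunary : ∀ {F} (φ : RingIso F K) x m → ¬ Rational x → Special K m (RingIso.map φ x) → Lacunary F x m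
  special⇒lacunary {F} φ x m irrational (s , root) = cong Cubic.c₁ same , cong Cubic.c₂ same
    where
    same : char F x ≡ cubic s 0ℚ (- (m /1))
    same = cubic-unique K (RingIso.map φ x) (Δ≢0 K field-K (RingIso.map φ x) (iso-irrational φ x irrational))
      (char F x) (cubic s 0ℚ (- (m /1)))
      (trans (sym (Hom.map-evalCubic (RingIso.hom φ) (char F x) x))
        (trans (cong (RingIso.map φ) (cayley-hamilton F x)) (Hom.map-zero (RingIso.hom φ))))
      root

  sporadic⇒not-special : ∀ F sols → All (Generic F) sols → ∀ n ε δ → add ε δ ≡ fromℤ n → SporadicIn F sols K ε δ →
    ¬ Rational ε × n ≢ + 0 × ¬ Special K n ε × ¬ Special K n δ
  sporadic⇒not-special F sols generic n ε δ sum (φ , x , y , m , ∈sols , σ , rel) =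
    conclude (All.lookup generic ∈sols)
    where
    ψ : RingIso F K
    ψ = iso-comp σ φ
    X Y : Elt
    X = RingIso.map ψ x
    Y = RingIso.map ψ y
    conclude : Generic F (x , y , m) → ¬ Rational ε × n ≢ + 0 × ¬ Special K n ε × ¬ Special K n δ
    conclude (y-eq , m≢0 , irrational , x-generic , y-generic) =
      by-alignment (∼-align ε δ n X Y m X-irrational Y-eq sum rel)
      where
      X-irrational : ¬ Rational X
      X-irrational = iso-irrational ψ x irrational
      Y-eq : Y ≡ complement X m
      Y-eq = trans (cong (RingIso.map ψ) y-eq) (iso-complement ψ x m)
      y-irrational : ¬ Rational y
      y-irrational r = complement-irrational x m irrational (subst Rational y-eq r)
      X-not-special : ¬ Special K m X
      X-not-special h = x-generic (special⇒lacunary ψ x m irrational h)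
      Y-not-special : ¬ Special K m (complement X m)
      Y-not-special h = y-generic (special⇒lacunary ψ y m y-irrational (subst (Special K m) (sym Y-eq) h))
      by-alignment : Aligned ε δ n X m ⊎ Aligned δ ε n X m → ¬ Rational ε × n ≢ + 0 × ¬ Special K n ε × ¬ Special K n δ
      by-alignment (inj₁ al) =
        let (to-x , to-y) = special-aligned K ε δ n X m al in
        proj₁ (aligned-irrational ε δ n X m al X-irrational) , aligned-nonzero ε δ n X m al m≢0 ,
        (λ h → X-not-special (to-x h)) , (λ h → Y-not-special (to-y h))
      by-alignment (inj₂ al) =
        let (to-x , to-y) = special-aligned K δ ε n X m al in
        proj₂ (aligned-irrational δ ε n X m al X-irrational) , aligned-nonzero δ ε n X m al m≢0 ,
        (λ h → Y-not-special (to-y h)) , (λ h → X-not-special (to-x h))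

  Case3⇒not-special : ∀ n ε δ → add ε δ ≡ fromℤ n → Case3 K ε δ →
    ¬ Rational ε × n ≢ + 0 × ¬ Special K n ε × ¬ Special K n δ
  Case3⇒not-special n ε δ sum (inj₁ h)        = sporadic⇒not-special (L j1) sporadicLm1 genericLm1 n ε δ sum h
  Case3⇒not-special n ε δ sum (inj₂ (inj₁ h)) = sporadic⇒not-special (L i1) sporadicL1 genericL1 n ε δ sum h
  Case3⇒not-special n ε δ sum (inj₂ (inj₂ h)) = sporadic⇒not-special M sporadicM genericM n ε δ sum h

  Case2-Case3-disjoint : ∀ n ε δ → add ε δ ≡ fromℤ n → Case2 K n ε δ → ¬ Case3 K ε δ
  Case2-Case3-disjoint n ε δ sum h₂ h₃ = clash (Case2⇒special K n ε δ sum h₂) (Case3⇒not-special n ε δ sum h₃)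
    where
    clash : ¬ Rational ε × n ≢ + 0 × (Special K n ε ⊎ Special K n δ) →
            ¬ (¬ Rational ε × n ≢ + 0 × ¬ Special K n ε × ¬ Special K n δ)
    clash (_ , _ , inj₁ h) (_ , _ , not-ε , _) = not-ε h
    clash (_ , _ , inj₂ h) (_ , _ , _ , not-δ) = not-δ h

  -- Since n - ε is rational as well, both units are ±1, and opposite signs mean n = 0.
  rational-case : ∀ n ε δ → Rational ε → IsUnit K ε → IsUnit K δ → add ε δ ≡ fromℤ n → Case1 n ε δ
  rational-case n ε δ (q , ε≡q) ε-unit δ-unit sum =
    let (s , s-sign , q≡s) = rational-unit K q (subst (IsUnit K) ε≡q ε-unit)
        (t , t-sign , r≡t) = rational-unit K (- q + n /1) (subst (IsUnit K) δ≡r δ-unit)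
    in by-signs s t s-sign t-sign (trans ε≡q (cong fromℚ q≡s)) (trans δ≡r (cong fromℚ r≡t))
    where
    δ≡r : δ ≡ fromℚ (- q + n /1)
    δ≡r = trans (complement-unique ε δ n sum) (cong (λ ε → complement ε n) ε≡q)
    by-signs : ∀ s t → IsSign s → IsSign t → ε ≡ fromℤ s → δ ≡ fromℤ t → Case1 n ε δ
    by-signs _ _ (inj₁ refl) (inj₁ refl) ε≡ δ≡ = inj₂ (inj₁ (ε≡ , δ≡))
    by-signs _ _ (inj₂ refl) (inj₂ refl) ε≡ δ≡ = inj₂ (inj₂ (ε≡ , δ≡))
    by-signs _ _ (inj₁ refl) (inj₂ refl) ε≡ δ≡ =
      inj₁ (/1-injective n (+ 0) (cong proj₁ (trans (sym sum) (cong₂ add ε≡ δ≡))))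
    by-signs _ _ (inj₂ refl) (inj₁ refl) ε≡ δ≡ =
      inj₁ (/1-injective n (+ 0) (cong proj₁ (trans (sym sum) (cong₂ add ε≡ δ≡))))

  not-Case1 : ∀ n ε δ → ¬ Rational ε → n ≢ + 0 → ¬ Case1 n ε δ
  not-Case1 n ε δ irrational n≢0 (inj₁ n≡0)              = n≢0 n≡0
  not-Case1 n ε δ irrational n≢0 (inj₂ (inj₁ (eq , _)))  = irrational (1ℚ , eq)
  not-Case1 n ε δ irrational n≢0 (inj₂ (inj₂ (eq , _)))  = irrational (- 1ℚ , eq)

theorem1p3 : (K : Cubic) → IsComplexCubicField K →
    (n : ℤ) (ε δ : Elt) → IsUnit K ε → IsUnit K δ →
    add ε δ ≡ fromℤ n →
    ExactlyOne (Case1 n ε δ) (Case2 K n ε δ) (Case3 K ε δ)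
theorem1p3 K (field-K , disc<0) n ε δ ε-unit δ-unit sum = by-rationality (rational? ε)
  where
  Conclusion : Set
  Conclusion = ExactlyOne (Case1 n ε δ) (Case2 K n ε δ) (Case3 K ε δ)

  by-case : ¬ Rational ε → n ≢ + 0 → Case2 K n ε δ ⊎ Case3 K ε δ → Conclusion
  by-case irrational n≢0 (inj₁ h₂) =
    inj₂ (inj₁ (not-Case1 K field-K n ε δ irrational n≢0 , h₂ , Case2-Case3-disjoint K field-K n ε δ sum h₂))
  by-case irrational n≢0 (inj₂ h₃) =
    inj₂ (inj₂ (not-Case1 K field-K n ε δ irrational n≢0 , (λ h₂ → Case2-Case3-disjoint K field-K n ε δ sum h₂ h₃) , h₃))

  -- Case (1) includes n = 0 with irrational ε; the other cases then fail because a and all sporadic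
  -- sums are nonzero.
  by-zero : ¬ Rational ε → Dec (n ≡ + 0) → Conclusion
  by-zero irrational (yes n≡0) = inj₁ (inj₁ n≡0 ,
    (λ h₂ → proj₁ (proj₂ (Case2⇒special K n ε δ sum h₂)) n≡0) ,
    (λ h₃ → proj₁ (proj₂ (Case3⇒not-special K field-K n ε δ sum h₃)) n≡0))
  by-zero irrational (no n≢0) = by-case irrational n≢0
    (subst (λ δ → Case2 K n ε δ ⊎ Case3 K ε δ) (sym δ-eq)
      (irrational-case K field-K disc<0 ε n irrational n≢0 ε-unit (subst (IsUnit K) δ-eq δ-unit)))
    where
    δ-eq : δ ≡ complement ε n
    δ-eq = complement-unique ε δ n sum

  by-rationality : Dec (Rational ε) → Conclusion
  by-rationality (yes rational) = inj₁ (rational-case K field-K n ε δ rational ε-unit δ-unit sum ,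
    (λ h₂ → proj₁ (Case2⇒special K n ε δ sum h₂) rational) ,
    (λ h₃ → proj₁ (Case3⇒not-special K field-K n ε δ sum h₃) rational))
  by-rationality (no irrational) = by-zero irrational (n ℤ.≟ + 0)
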